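{- Let $p$ be a sufficiently large prime and let $F(X)\in\mathbb{F}_p[X]$ be a square-free polynomial of degree $d_F\geq 1$. Then for every integer $m$ with $2\leq m\ll(\log p)^{1/4}$, $$\sum_{a=0}^{m-1}\left(\widetilde{\Phi}_p(F;m,a)-\frac{1}{m}\right)^2\ll_{d_F}\frac{m^2}{\log p}.$$ The same bound holds when $R_p(F,k)$ is replaced by $N_p(F,k)$ in the definition of $\widetilde{\Phi}_p$.
   Context: $\chi_p$ denotes the Legendre symbol modulo $p$. For $1\le k\le p$, $R_p(F,k)$ is the number of positive integers $n\leq k$ such that $F(n)$ is a quadratic residue modulo $p$ (i.e. $\chi_p(F(n))=1$), and $N_p(F,k)$ is the number of positive integers $n\leq k$ such that $F(n)$ is a quadratic non-residue modulo $p$. For an integer $m\ge2$ and residue $a$, $\widetilde{\Phi}_p(F;m,a)=\frac{1}{p}\left|\{1\leq k\leq p: R_p(F,k)\equiv a\bmod m\}\right|$. -}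

module Defs where

open import Data.Nat as ℕ using (ℕ; zero; suc; _≡ᵇ_)
open import Data.Nat.DivMod as DM using ()
open import Data.Bool using (Bool; true; false; _∧_; not)
open import Data.Bool.ListAction using (any)
open import Data.List using (List; []; _∷_; map; upTo; filter; length; foldr)
open import Data.Integer as ℤ using (ℤ; +_; -[1+_])
open import Data.Rational as ℚ using (ℚ)
open import Relation.Binary.PropositionalEquality using (_≡_; _≢_)
open import Relation.Nullary using (¬_)
open import Data.Product using (Σ; ∃; ∃-syntax; _×_)

-- a % p, with the (never used) convention a % 0 = a
_%_ : ℕ → ℕ → ℕ
a % zero  = a
a % suc n = a DM.% suc n
infixl 7 _%_

-- Polynomials over F_p: coefficient lists (constant term first), entries
-- read modulo p.
Poly : Set
Poly = List ℕ

coeff : Poly → ℕ → ℕ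
coeff []      _       = 0
coeff (a ∷ F) zero    = a
coeff (a ∷ F) (suc i) = coeff F i

polyAdd : Poly → Poly → Poly
polyAdd []      G       = G
polyAdd F       []      = F
polyAdd (a ∷ F) (b ∷ G) = (a ℕ.+ b) ∷ polyAdd F G

polyMul : Poly → Poly → Poly
polyMul []      G = []
polyMul (a ∷ F) G = polyAdd (map (a ℕ.*_) G) (0 ∷ polyMul F G)

_≈[_]_ : Poly → ℕ → Poly → Set
F ≈[ p ] G = ∀ i → coeff F i % p ≡ coeff G i % p

HasDegree : ℕ → Poly → ℕ → Set
HasDegree p F d = (coeff F d % p ≢ 0) × (∀ i → d ℕ.< i → coeff F i % p ≡ 0)

SquareFree : ℕ → Poly → Set
SquareFree p F =
  ¬ (∃[ G ] ∃[ H ] ∃[ e ] (1 ℕ.≤ e × HasDegree p G e × polyMul (polyMul G G) H ≈[ p ] F))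

eval : ℕ → Poly → ℕ → ℕ
eval p F x = foldr (λ a acc → a ℕ.+ x ℕ.* acc) 0 F % p

isSquareMod : ℕ → ℕ → Bool
isSquareMod p a = any (λ x → ((x ℕ.* x) % p) ≡ᵇ (a % p)) (upTo p)

legendre : ℕ → ℕ → ℤ
legendre p a with (a % p) ≡ᵇ 0
... | true  = + 0
... | false with isSquareMod p a
...   | true  = + 1
...   | false = -[1+ 0 ]

countSym : ℤ → ℕ → Poly → ℕ → ℕ
countSym s p F k = length (filter (λ n → legendre p (eval p F n) ℤ.≟ s) (map suc (upTo k)))

R : ℕ → Poly → ℕ → ℕ
R = countSym (+ 1)

Nn : ℕ → Poly → ℕ → ℕ
Nn = countSym -[1+ 0 ]

-- a / b as a rational (b = 0 never used: b is p or m ≥ 2)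
_÷_ : ℕ → ℕ → ℚ
a ÷ zero  = ℚ.0ℚ
a ÷ suc b = (+ a) ℚ./ suc b

Phi : (ℕ → Poly → ℕ → ℕ) → ℕ → Poly → ℕ → ℕ → ℚ
Phi Cnt p F m a =
  length (filter (λ k → (Cnt p F k % m) ℕ.≟ a) (map suc (upTo p))) ÷ p

Dev : (ℕ → Poly → ℕ → ℕ) → ℕ → Poly → ℕ → ℚ
Dev Cnt p F m =
  foldr ℚ._+_ ℚ.0ℚ (map (λ a → let t = Phi Cnt p F m a ℚ.- (1 ÷ m) in t ℚ.* t) (upTo m))

{-# OPTIONS --safe #-}

-- Fix a residue a and put s(k) = 1 or -1 according as F(k) has the counted quadratic character or not.
-- The sum of m [R(k) ≡ a] - 1 over the k with s(k + 1) = 1 telescopes, so that up to O(m) the deviation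
-- from uniformity is the sum of s(k + 1) (m [R(k) ≡ a] - 1).  Averaging over windows of length
-- H = ⌊log₂ p⌋ / 16 and Cauchy-Schwarz reduce it to second moments over the sign patterns of length H.
-- For independent signs these are at most H m² because the steps are orthogonal, and every pattern occurs
-- at most 3 p / 2ᴴ times: expand the product of the 1 ± χ(F(x + j)) over j ≤ H and bound each sum of
-- χ(∏ F(x + j)) over j in S by p / 2ᴴ.  The latter is Stepanov's method over the prime field, with an
-- auxiliary polynomial f^M Σ X^(ip) (uᵢ + vᵢ f^((p-1)/2)) for f = ∏ F(X + j).  It needs that f is not
-- a constant times a square: some irreducible P ∣ F divides no F(X + t) with 0 < t ≤ H, and then
-- P(X + min S) divides f exactly once, F being square-free.
module Submission where

open import Algebra.Bundles using (CommutativeRing; RawRing; AbelianGroup)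
open import Level using (0ℓ)
open import Data.Nat as ℕ using (ℕ; zero; suc; z≤n; s≤s; _≡ᵇ_)
open import Data.Integer as ℤ using (ℤ; +_; -[1+_])
import Data.Integer.Properties as ℤP
open import Relation.Binary.PropositionalEquality as ≡ using (_≡_; _≢_)
open import Relation.Binary.Definitions using (WeaklyDecidable; tri<; tri≈; tri>)
open import Relation.Nullary using (yes; no; ¬_; Dec)
open import Data.Maybe using (just; nothing)
open import Algebra.Structures using (IsCommutativeRing)
open import Data.List using (List; []; _∷_; map; foldr; length; upTo; applyUpTo; tabulate; filter; downFrom)
open import Data.Product using (_,_; ∃-syntax; _×_; proj₁; proj₂)
import Data.Nat.Properties as ℕP
import Relation.Binary.Reasoning.Setoid as SetoidReasoning
import Algebra.Properties.CommutativeSemigroup as CommutativeSemigroupProperties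
open import Data.List.Relation.Unary.All as All using (All; []; _∷_)
open import Data.List.Relation.Unary.AllPairs as AllPairs using (AllPairs; []; _∷_)
open import Data.Empty using (⊥; ⊥-elim)
open import Data.Sum using (_⊎_; inj₁; inj₂)
import Data.Nat.DivMod as DM
open import Data.Nat.Coprimality using (prime⇒coprime; coprime-Bézout)
open import Data.Nat.GCD using (module Bézout)
open import Data.Nat.Primality using (Prime; ¬prime[1])
open import Data.Bool using (Bool; true; false; T)
open import Data.Bool.Properties using (T-≡)
open import Data.List.Properties using (length-applyUpTo; length-map)
import Data.List.Relation.Unary.Any.Properties as AnyP
open import Data.List.Relation.Unary.Any as Any using (Any)
open import Data.List.Membership.Propositional using (lose)
open import Data.List.Membership.Propositional.Properties using (∈-upTo⁺)
import Data.List.Relation.Unary.All.Properties as AllP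
import Data.List.Relation.Unary.AllPairs.Properties as AllPairsP
open import Function.Bundles using (Equivalence)
open import Data.Fin as Fin using (Fin; toℕ; fromℕ<; combine; remQuot; splitAt; _↑ˡ_; _↑ʳ_; funToFin; finToFun)
import Data.Fin.Properties as FinP
open import Function using (_∘_)
open import Defs using (legendre; isSquareMod)
import Defs

-- The frequency of one pattern expands into 2ᴴ character sums, so each of them must save a factor Θ
-- = 2ᴴ, for polynomials whose degree, up to `H * d`, grows with p. As Θ is at most p^(1/16),
-- something far weaker than Weil's bound suffices: all parameters of Stepanov's method are bounded
-- by powers of Θ, and the 16 is the price of crude bookkeeping with these powers. Zeros of F fit
-- neither sign. They are recorded as misses, and a correction that counts them, at most d for each
-- position in the window, restores a majorant for the pattern frequencies. A window sum depends on
-- its sign pattern and on the residue of R(k) modulo m where the window starts. Summing over all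
-- starting residues costs one factor m: each a contributes a multiple of m / H to the deviation,
-- all of them together m² / H. The setting is constructive. Irreducible factors exist only under a
-- double negation, which is enough because they serve to prove that some u vanishes, and that is
-- decidable over a finite field.

-- A ring solver with integer coefficients for any commutative ring.

module IntegerSolver (R : CommutativeRing 0ℓ 0ℓ) where
  open CommutativeRing R
  open import Algebra.Properties.Ring ring
    using (-‿distribˡ-*; -‿distribʳ-*)
  open import Algebra.Properties.AbelianGroup +-abelianGroup
    using (⁻¹-involutive; ⁻¹-∙-comm; ε⁻¹≈ε)
  open import Algebra.Properties.Semiring.Mult.TCOptimised semiring
    using (×-homo-+; ×1-homo-*; 1+×) renaming (_×_ to _·_)
  open import Relation.Binary.Reasoning.Setoid setoid
  open import Algebra.Solver.Ring.AlmostCommutativeRing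
    using (fromCommutativeRing; _-Raw-AlmostCommutative⟶_; Induced-equivalence)

  -- The solver needs coefficients whose equality it can test, and equality in `R` need not be
  -- decidable. Integers, sent to `R` by the canonical homomorphism, serve instead.
  embed : ℤ → Carrier
  embed (+ n)    = n · 1#
  embed -[1+ n ] = - (suc n · 1#)

  embed-neg : ∀ i → embed (ℤ.- i) ≈ - embed i
  embed-neg (+ zero)   = sym ε⁻¹≈ε
  embed-neg (+ suc n)  = refl
  embed-neg -[1+ n ]   = sym (⁻¹-involutive _)

  embed-⊖ : ∀ m n → embed (m ℤ.⊖ n) ≈ m · 1# - n · 1#
  embed-⊖ m       zero    = begin
    embed (m ℤ.⊖ 0) ≡⟨ ≡.cong embed (ℤP.⊖-≥ {m} {0} ℕ.z≤n) ⟩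
    m · 1#          ≈⟨ +-identityʳ _ ⟨
    m · 1# + 0#     ≈⟨ +-congˡ ε⁻¹≈ε ⟨
    m · 1# - 0#     ∎
  embed-⊖ zero    (suc n) = sym (+-identityˡ _)
  embed-⊖ (suc m) (suc n) = begin
    embed (suc m ℤ.⊖ suc n)              ≡⟨ ≡.cong embed (ℤP.[1+m]⊖[1+n]≡m⊖n m n) ⟩
    embed (m ℤ.⊖ n)                      ≈⟨ embed-⊖ m n ⟩
    a - b                                ≈⟨ +-congʳ (+-identityʳ _) ⟨
    (a + 0#) - b                         ≈⟨ +-congʳ (+-congˡ (-‿inverseʳ 1#)) ⟨
    (a + (1# - 1#)) - b                  ≈⟨ +-congʳ (+-assoc _ _ _) ⟨
    ((a + 1#) - 1#) - b                  ≈⟨ +-assoc _ _ _ ⟩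
    (a + 1#) + (- 1# - b)                ≈⟨ +-cong (+-comm _ _) (⁻¹-∙-comm _ _) ⟩
    (1# + a) - (1# + b)                  ≈⟨ +-cong (1+× m 1#) (-‿cong (1+× n 1#)) ⟨
    suc m · 1# - suc n · 1#              ∎
    where
    a = m · 1#
    b = n · 1#

  embed-+ : ∀ i j → embed (i ℤ.+ j) ≈ embed i + embed j
  embed-+ (+ m)    (+ n)    = ×-homo-+ 1# m n
  embed-+ (+ m)    -[1+ n ] = embed-⊖ m (suc n)
  embed-+ -[1+ m ] (+ n)    = trans (embed-⊖ n (suc m)) (+-comm _ _)
  embed-+ -[1+ m ] -[1+ n ] = begin
    - (suc (suc (m ℕ.+ n)) · 1#)      ≡⟨ ≡.cong (λ k → - (k · 1#)) (≡.cong suc (≡.sym (ℕP.+-suc m n))) ⟩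
    - ((suc m ℕ.+ suc n) · 1#)        ≈⟨ -‿cong (×-homo-+ 1# (suc m) (suc n)) ⟩
    - (suc m · 1# + suc n · 1#)       ≈⟨ ⁻¹-∙-comm _ _ ⟨
    - (suc m · 1#) + - (suc n · 1#)   ∎
    where import Data.Nat.Properties as ℕP

  embed-*⁺ : ∀ m j → embed (+ m ℤ.* j) ≈ embed (+ m) * embed j
  embed-*⁺ m (+ n)    = trans (reflexive (≡.cong embed (≡.sym (ℤP.pos-* m n)))) (×1-homo-* m n)
  embed-*⁺ m -[1+ n ] = begin
    embed (+ m ℤ.* -[1+ n ])         ≡⟨ ≡.cong embed (ℤP.neg-distribʳ-* (+ m) (+ suc n)) ⟨
    embed (ℤ.- (+ m ℤ.* + suc n))    ≈⟨ embed-neg (+ m ℤ.* + suc n) ⟩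
    - embed (+ m ℤ.* + suc n)        ≈⟨ -‿cong (embed-*⁺ m (+ suc n)) ⟩
    - (m · 1# * (suc n · 1#))        ≈⟨ -‿distribʳ-* _ _ ⟩
    m · 1# * - (suc n · 1#)          ∎

  embed-* : ∀ i j → embed (i ℤ.* j) ≈ embed i * embed j
  embed-* (+ m)    j = embed-*⁺ m j
  embed-* -[1+ m ] j = begin
    embed (-[1+ m ] ℤ.* j)           ≡⟨ ≡.cong embed (ℤP.neg-distribˡ-* (+ suc m) j) ⟨
    embed (ℤ.- (+ suc m ℤ.* j))      ≈⟨ embed-neg (+ suc m ℤ.* j) ⟩
    - embed (+ suc m ℤ.* j)          ≈⟨ -‿cong (embed-*⁺ (suc m) j) ⟩
    - (suc m · 1# * embed j)         ≈⟨ -‿distribˡ-* _ _ ⟩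
    - (suc m · 1#) * embed j         ∎

  ℤ-rawRing : RawRing 0ℓ 0ℓ
  ℤ-rawRing = CommutativeRing.rawRing ℤP.+-*-commutativeRing

  embedding : ℤ-rawRing -Raw-AlmostCommutative⟶ fromCommutativeRing R
  embedding = record
    { ⟦_⟧    = embed
    ; +-homo = embed-+
    ; *-homo = embed-*
    ; -‿homo = embed-neg
    ; 0-homo = refl
    ; 1-homo = refl
    }

  _embed≟_ : WeaklyDecidable (Induced-equivalence embedding)
  i embed≟ j with i ℤ.≟ j
  ... | yes ≡.refl = just refl
  ... | no  _      = nothing

  open import Algebra.Solver.Ring ℤ-rawRing (fromCommutativeRing R) embedding _embed≟_ public
    using (solve; _:=_; _:+_; _:*_; _:-_; :-_; con)

-- Coefficient lists form a commutative ring.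

module Polynomials (R : CommutativeRing 0ℓ 0ℓ) where
  open CommutativeRing R
  open import Algebra.Properties.AbelianGroup +-abelianGroup using (ε⁻¹≈ε)
  open import Algebra.Properties.Ring ring using (-‿distribʳ-*)

  Polynomial : Set
  Polynomial = List Carrier

  coefficient : Polynomial → ℕ → Carrier
  coefficient []      _       = 0#
  coefficient (a ∷ F) zero    = a
  coefficient (a ∷ F) (suc i) = coefficient F i

  add : Polynomial → Polynomial → Polynomial
  add []      G       = G
  add (a ∷ F) []      = a ∷ F
  add (a ∷ F) (b ∷ G) = (a + b) ∷ add F G

  scale : Carrier → Polynomial → Polynomial
  scale a = map (a *_)

  negate : Polynomial → Polynomial
  negate = map (-_)

  mul : Polynomial → Polynomial → Polynomial
  mul []      G = []
  mul (a ∷ F) G = add (scale a G) (0# ∷ mul F G)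

  infix 4 _≋_
  -- Lists may end in zeros, so equality compares all coefficients. Being a record, it lets `F` and
  -- `G` be inferred from a proof, which the bare family of equations would not allow.
  record _≋_ (F G : Polynomial) : Set where
    constructor coefficientwise
    field at : ∀ i → coefficient F i ≈ coefficient G i
  open _≋_ public

  ≋-refl : ∀ {F} → F ≋ F
  ≋-refl .at i = refl

  ≋-sym : ∀ {F G} → F ≋ G → G ≋ F
  ≋-sym p .at i = sym (at p i)

  ≋-trans : ∀ {F G H} → F ≋ G → G ≋ H → F ≋ H
  ≋-trans p q .at i = trans (at p i) (at q i)

  coefficient-add : ∀ F G i → coefficient (add F G) i ≈ coefficient F i + coefficient G i
  coefficient-add []      G       i       = sym (+-identityˡ _)
  coefficient-add (a ∷ F) []      i       = sym (+-identityʳ _)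
  coefficient-add (a ∷ F) (b ∷ G) zero    = refl
  coefficient-add (a ∷ F) (b ∷ G) (suc i) = coefficient-add F G i

  coefficient-scale : ∀ a F i → coefficient (scale a F) i ≈ a * coefficient F i
  coefficient-scale a []      i       = sym (zeroʳ a)
  coefficient-scale a (b ∷ F) zero    = refl
  coefficient-scale a (b ∷ F) (suc i) = coefficient-scale a F i

  coefficient-negate : ∀ F i → coefficient (negate F) i ≈ - coefficient F i
  coefficient-negate []      i       = sym ε⁻¹≈ε
  coefficient-negate (b ∷ F) zero    = refl
  coefficient-negate (b ∷ F) (suc i) = coefficient-negate F i

  ∷-cong : ∀ {a b F G} → a ≈ b → F ≋ G → (a ∷ F) ≋ (b ∷ G)
  ∷-cong p q .at zero    = p
  ∷-cong p q .at (suc i) = at q i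

  tail-cong : ∀ {a b F G} → (a ∷ F) ≋ (b ∷ G) → F ≋ G
  tail-cong p .at i = at p (suc i)

  tail-zero : ∀ {a F} → (a ∷ F) ≋ [] → F ≋ []
  tail-zero p .at i = at p (suc i)

  0∷[] : (0# ∷ []) ≋ []
  0∷[] .at zero    = refl
  0∷[] .at (suc i) = refl

  add-cong : ∀ {F F′ G G′} → F ≋ F′ → G ≋ G′ → add F G ≋ add F′ G′
  add-cong {F} {F′} {G} {G′} p q .at i =
    trans (coefficient-add F G i) (trans (+-cong (at p i) (at q i)) (sym (coefficient-add F′ G′ i)))

  polyAdditiveGroup : AbelianGroup 0ℓ 0ℓ
  polyAdditiveGroup = record
    { Carrier = Polynomial ; _≈_ = _≋_ ; _∙_ = add ; ε = [] ; _⁻¹ = negate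
    ; isAbelianGroup = record
      { isGroup = record
        { isMonoid = record
          { isSemigroup = record
            { isMagma = record
              { isEquivalence = record { refl = ≋-refl ; sym = ≋-sym ; trans = ≋-trans }
              ; ∙-cong = add-cong }
            ; assoc = λ F G H → coefficientwise λ i → begin
                coefficient (add (add F G) H) i                             ≈⟨ coefficient-add (add F G) H i ⟩
                coefficient (add F G) i + coefficient H i                   ≈⟨ +-congʳ (coefficient-add F G i) ⟩
                coefficient F i + coefficient G i + coefficient H i         ≈⟨ +-assoc _ _ _ ⟩
                coefficient F i + (coefficient G i + coefficient H i)       ≈⟨ +-congˡ (coefficient-add G H i) ⟨
                coefficient F i + coefficient (add G H) i                   ≈⟨ coefficient-add F (add G H) i ⟨
                coefficient (add F (add G H)) i                             ∎ }
          ; identity = (λ F → ≋-refl) , (λ F → coefficientwise λ i →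
              trans (coefficient-add F [] i) (+-identityʳ _)) }
        ; inverse = (λ F → coefficientwise λ i → trans (coefficient-add (negate F) F i)
                      (trans (+-congʳ (coefficient-negate F i)) (-‿inverseˡ _)))
                  , (λ F → coefficientwise λ i → trans (coefficient-add F (negate F) i)
                      (trans (+-congˡ (coefficient-negate F i)) (-‿inverseʳ _)))
        ; ⁻¹-cong = λ {F} {G} p → coefficientwise λ i → trans (coefficient-negate F i)
            (trans (-‿cong (at p i)) (sym (coefficient-negate G i))) }
      ; comm = λ F G → coefficientwise λ i → trans (coefficient-add F G i)
          (trans (+-comm _ _) (sym (coefficient-add G F i))) } }
    where open SetoidReasoning setoid

  private
    module G = AbelianGroup polyAdditiveGroup
  open CommutativeSemigroupProperties G.commutativeSemigroup using (interchange; x∙yz≈y∙xz)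

  scale-cong : ∀ {a b F G} → a ≈ b → F ≋ G → scale a F ≋ scale b G
  scale-cong {a} {b} {F} {G} p q .at i =
    trans (coefficient-scale a F i) (trans (*-cong p (at q i)) (sym (coefficient-scale b G i)))

  scale-distribˡ : ∀ a F G → scale a (add F G) ≋ add (scale a F) (scale a G)
  scale-distribˡ a F G .at i = begin
    coefficient (scale a (add F G)) i                         ≈⟨ coefficient-scale a (add F G) i ⟩
    a * coefficient (add F G) i                               ≈⟨ *-congˡ (coefficient-add F G i) ⟩
    a * (coefficient F i + coefficient G i)                   ≈⟨ distribˡ _ _ _ ⟩
    a * coefficient F i + a * coefficient G i
      ≈⟨ +-cong (coefficient-scale a F i) (coefficient-scale a G i) ⟨
    coefficient (scale a F) i + coefficient (scale a G) i     ≈⟨ coefficient-add (scale a F) (scale a G) i ⟨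
    coefficient (add (scale a F) (scale a G)) i               ∎
    where open SetoidReasoning setoid

  scale-distribʳ : ∀ a b F → scale (a + b) F ≋ add (scale a F) (scale b F)
  scale-distribʳ a b F .at i = begin
    coefficient (scale (a + b) F) i                           ≈⟨ coefficient-scale (a + b) F i ⟩
    (a + b) * coefficient F i                                 ≈⟨ distribʳ _ _ _ ⟩
    a * coefficient F i + b * coefficient F i
      ≈⟨ +-cong (coefficient-scale a F i) (coefficient-scale b F i) ⟨
    coefficient (scale a F) i + coefficient (scale b F) i     ≈⟨ coefficient-add (scale a F) (scale b F) i ⟨
    coefficient (add (scale a F) (scale b F)) i               ∎
    where open SetoidReasoning setoid

  scale-scale : ∀ a b F → scale a (scale b F) ≋ scale (a * b) F
  scale-scale a b F .at i = trans (coefficient-scale a (scale b F) i)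
    (trans (*-congˡ (coefficient-scale b F i))
    (trans (sym (*-assoc a b _)) (sym (coefficient-scale (a * b) F i))))

  scale-0 : ∀ F → scale 0# F ≋ []
  scale-0 F .at i = trans (coefficient-scale 0# F i) (zeroˡ _)

  scale-1 : ∀ F → scale 1# F ≋ F
  scale-1 F .at i = trans (coefficient-scale 1# F i) (*-identityˡ _)

  0∷-distrib : ∀ F G → (0# ∷ add F G) ≋ add (0# ∷ F) (0# ∷ G)
  0∷-distrib F G = ∷-cong (sym (+-identityˡ 0#)) ≋-refl

  open SetoidReasoning G.setoid

  mul-zeroʳ : ∀ F → mul F [] ≋ []
  mul-zeroʳ []      = ≋-refl
  mul-zeroʳ (a ∷ F) = ≋-trans (∷-cong refl (mul-zeroʳ F)) 0∷[]

  -- `mul` recurses on its left argument. This is the matching recursion on the right, from which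
  -- commutativity follows by induction.
  mul-∷ʳ : ∀ F b G → mul F (b ∷ G) ≋ add (scale b F) (0# ∷ mul F G)
  mul-∷ʳ []      b G = ≋-sym 0∷[]
  mul-∷ʳ (a ∷ F) b G = ∷-cong (+-congʳ (*-comm a b)) (begin
    add (scale a G) (mul F (b ∷ G))                      ≈⟨ add-cong (≋-refl {scale a G}) (mul-∷ʳ F b G) ⟩
    add (scale a G) (add (scale b F) (0# ∷ mul F G))     ≈⟨ x∙yz≈y∙xz (scale a G) (scale b F) _ ⟩
    add (scale b F) (add (scale a G) (0# ∷ mul F G))     ∎)

  mul-comm : ∀ F G → mul F G ≋ mul G F
  mul-comm []      G = ≋-sym (mul-zeroʳ G)
  mul-comm (a ∷ F) G = begin
    add (scale a G) (0# ∷ mul F G)     ≈⟨ add-cong (≋-refl {scale a G}) (∷-cong refl (mul-comm F G)) ⟩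
    add (scale a G) (0# ∷ mul G F)     ≈⟨ mul-∷ʳ G a F ⟨
    mul G (a ∷ F)                      ∎

  mul-congˡ : ∀ F {G G′} → G ≋ G′ → mul F G ≋ mul F G′
  mul-congˡ []      p = ≋-refl
  mul-congˡ (a ∷ F) p = add-cong (scale-cong refl p) (∷-cong refl (mul-congˡ F p))

  -- Equal polynomials may be lists of different lengths, which makes induction on the left argument
  -- awkward; commutativity moves both changes to the right.
  mul-cong : ∀ {F F′ G G′} → F ≋ F′ → G ≋ G′ → mul F G ≋ mul F′ G′
  mul-cong {F} {F′} {G} {G′} p q = begin
    mul F G      ≈⟨ mul-congˡ F q ⟩
    mul F G′     ≈⟨ mul-comm F G′ ⟩
    mul G′ F     ≈⟨ mul-congˡ G′ p ⟩
    mul G′ F′    ≈⟨ mul-comm G′ F′ ⟩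
    mul F′ G′    ∎

  mul-distribʳ : ∀ H F G → mul (add F G) H ≋ add (mul F H) (mul G H)
  mul-distribʳ H []      G       = ≋-refl
  mul-distribʳ H (a ∷ F) []      = ≋-sym (G.identityʳ _)
  mul-distribʳ H (a ∷ F) (b ∷ G) = begin
    add (scale (a + b) H) (0# ∷ mul (add F G) H)
      ≈⟨ add-cong (scale-distribʳ a b H) (∷-cong refl (mul-distribʳ H F G)) ⟩
    add (add (scale a H) (scale b H)) (0# ∷ add (mul F H) (mul G H))
      ≈⟨ add-cong (≋-refl {add (scale a H) (scale b H)}) (0∷-distrib (mul F H) (mul G H)) ⟩
    add (add (scale a H) (scale b H)) (add (0# ∷ mul F H) (0# ∷ mul G H))
      ≈⟨ interchange (scale a H) (scale b H) _ _ ⟩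
    add (add (scale a H) (0# ∷ mul F H)) (add (scale b H) (0# ∷ mul G H)) ∎

  0∷-mul : ∀ F G → mul (0# ∷ F) G ≋ (0# ∷ mul F G)
  0∷-mul F G = add-cong (scale-0 G) ≋-refl

  scale-mul : ∀ a F G → mul (scale a F) G ≋ scale a (mul F G)
  scale-mul a []      G = ≋-refl
  scale-mul a (b ∷ F) G = begin
    add (scale (a * b) G) (0# ∷ mul (scale a F) G)
      ≈⟨ add-cong (≋-sym (scale-scale a b G)) (∷-cong (sym (zeroʳ a)) (scale-mul a F G)) ⟩
    add (scale a (scale b G)) (scale a (0# ∷ mul F G))
      ≈⟨ scale-distribˡ a (scale b G) (0# ∷ mul F G) ⟨
    scale a (add (scale b G) (0# ∷ mul F G)) ∎

  mul-assoc : ∀ F G H → mul (mul F G) H ≋ mul F (mul G H)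
  mul-assoc []      G H = ≋-refl
  mul-assoc (a ∷ F) G H = begin
    mul (add (scale a G) (0# ∷ mul F G)) H           ≈⟨ mul-distribʳ H (scale a G) _ ⟩
    add (mul (scale a G) H) (mul (0# ∷ mul F G) H)
      ≈⟨ add-cong (scale-mul a G H) (≋-trans (0∷-mul (mul F G) H) (∷-cong refl (mul-assoc F G H))) ⟩
    add (scale a (mul G H)) (0# ∷ mul F (mul G H))   ∎

  mul-identityˡ : ∀ F → mul (1# ∷ []) F ≋ F
  mul-identityˡ F = begin
    add (scale 1# F) (0# ∷ [])    ≈⟨ add-cong (scale-1 F) 0∷[] ⟩
    add F []                      ≈⟨ G.identityʳ F ⟩
    F                             ∎

  infixl 6 _⊕_
  infixl 7 _⊗_
  infix 8 ⊖_

  -- Opaque, so that comparing two polynomial expressions never unfolds into coefficients.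
  opaque
    _⊕_ : Polynomial → Polynomial → Polynomial
    _⊕_ = add

    _⊗_ : Polynomial → Polynomial → Polynomial
    _⊗_ = mul

    ⊖_ : Polynomial → Polynomial
    ⊖_ = negate

    𝟙 : Polynomial
    𝟙 = 1# ∷ []

  opaque
    unfolding _⊕_

    polyIsCommutativeRing : IsCommutativeRing _≋_ _⊕_ _⊗_ ⊖_ [] 𝟙
    polyIsCommutativeRing = record
      { isRing = record
        { +-isAbelianGroup = G.isAbelianGroup
        ; *-cong = mul-cong
        ; *-assoc = mul-assoc
        ; *-identity = mul-identityˡ , λ F → ≋-trans (mul-comm F (1# ∷ [])) (mul-identityˡ F)
        ; distrib = (λ F G H → ≋-trans (mul-comm F (add G H)) (≋-trans (mul-distribʳ F G H)
                      (add-cong (mul-comm G F) (mul-comm H F)))) , mul-distribʳ }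
      ; *-comm = mul-comm }

  polyRing : CommutativeRing 0ℓ 0ℓ
  polyRing = record { isCommutativeRing = polyIsCommutativeRing }

-- Evaluation, derivative, degree bounds and translation of polynomials.

module PolynomialOperations (R : CommutativeRing 0ℓ 0ℓ) where
  open CommutativeRing R
  open Polynomials R public
  open CommutativeRing polyRing public
    using ()
    renaming (_≉_ to _≇_; _-_ to _⊝_; setoid to polySetoid;
              +-cong to ⊕-cong; +-congˡ to ⊕-congˡ; +-congʳ to ⊕-congʳ; -‿cong to ⊖-cong;
              *-congˡ to ⊗-congˡ; *-congʳ to ⊗-congʳ; *-cong to ⊗-cong; +-identityˡ to ⊕-identityˡ;
              +-identityʳ to ⊕-identityʳ; *-identityˡ to ⊗-identityˡ; *-identityʳ to ⊗-identityʳ;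
              zeroˡ to ⊗-zeroˡ; zeroʳ to ⊗-zeroʳ; *-comm to ⊗-comm; *-assoc to ⊗-assoc;
              -‿inverseʳ to ⊝-inverse)
  open import Algebra.Properties.Semiring.Exp semiring public using (_^_; ^-congˡ)
  open import Algebra.Properties.Semiring.Exp (CommutativeRing.semiring polyRing) public
    using () renaming (_^_ to _^ₚ_)
  open import Algebra.Properties.Semiring.Mult semiring public
    using () renaming (_×_ to _·_; ×-congʳ to ·-congʳ)
  open import Algebra.Properties.Semiring.Mult (CommutativeRing.semiring polyRing) public
    using () renaming (_×_ to _·ₚ_)
  module KSolver = IntegerSolver R
  module PSolver = IntegerSolver polyRing
  module K-Reasoning = SetoidReasoning setoid
  module P-Reasoning = SetoidReasoning polySetoid

  C : Carrier → Polynomial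
  C a = a ∷ []

  X : Polynomial
  X = 0# ∷ 1# ∷ []

  opaque
    unfolding _⊕_

    X⊗ : ∀ F → (0# ∷ F) ≋ X ⊗ F
    X⊗ F = ≋-sym (begin
      add (scale 0# F) (0# ∷ (𝟙 ⊗ F))   ≈⟨ add-cong (scale-0 F) (∷-cong refl (⊗-identityˡ F)) ⟩
      (0# ∷ F)                          ∎)
      where open P-Reasoning

    ∷-decompose : ∀ a F → (a ∷ F) ≋ C a ⊕ X ⊗ F
    ∷-decompose a F = begin
      a ∷ F              ≈⟨ ∷-cong (sym (+-identityʳ a)) ≋-refl ⟩
      C a ⊕ (0# ∷ F)     ≈⟨ ⊕-congˡ {C a} (X⊗ F) ⟩
      C a ⊕ X ⊗ F        ∎
      where open P-Reasoning

    C⊗ : ∀ a F → scale a F ≋ C a ⊗ F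
    C⊗ a F = ≋-sym (≋-trans (⊕-congˡ {scale a F} 0∷[]) (⊕-identityʳ _))

    C-+ : ∀ a b → C (a + b) ≋ C a ⊕ C b
    C-+ a b = ≋-refl

    C-1 : C 1# ≋ 𝟙
    C-1 = ≋-refl

    coefficient-⊕ : ∀ F G i → coefficient (F ⊕ G) i ≈ coefficient F i + coefficient G i
    coefficient-⊕ = coefficient-add

    coefficient-⊖ : ∀ F i → coefficient (⊖ F) i ≈ - coefficient F i
    coefficient-⊖ = coefficient-negate

    C-* : ∀ a b → C (a * b) ≋ C a ⊗ C b
    C-* a b = C⊗ a (C b)

    C-cong : ∀ {a b} → a ≈ b → C a ≋ C b
    C-cong p = ∷-cong p ≋-refl

  eval : Polynomial → Carrier → Carrier
  eval F x = foldr (λ a s → a + x * s) 0# F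

  eval-zero : ∀ {F} x → F ≋ [] → eval F x ≈ 0#
  eval-zero {[]}    x p = refl
  eval-zero {a ∷ F} x p = begin
    a + x * eval F x   ≈⟨ +-cong (at p 0) (*-congˡ (eval-zero x (tail-zero p))) ⟩
    0# + x * 0#        ≈⟨ +-identityˡ _ ⟩
    x * 0#             ≈⟨ zeroʳ x ⟩
    0#                 ∎
    where open K-Reasoning

  opaque
    unfolding _⊕_

    eval-cong : ∀ {F G} x → F ≋ G → eval F x ≈ eval G x
    eval-cong {[]}    {G}     x p = sym (eval-zero x (≋-sym p))
    eval-cong {a ∷ F} {[]}    x p = eval-zero {a ∷ F} x p
    eval-cong {a ∷ F} {b ∷ G} x p = +-cong (at p 0) (*-congˡ (eval-cong x (tail-cong p)))

  eval-congʳ : ∀ F {x y} → x ≈ y → eval F x ≈ eval F y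
  eval-congʳ []      p = refl
  eval-congʳ (a ∷ F) p = +-congˡ (*-cong p (eval-congʳ F p))

  opaque
    unfolding _⊕_

    eval-⊕ : ∀ F G x → eval (F ⊕ G) x ≈ eval F x + eval G x
    eval-⊕ []      G       x = sym (+-identityˡ _)
    eval-⊕ (a ∷ F) []      x = sym (+-identityʳ _)
    eval-⊕ (a ∷ F) (b ∷ G) x = trans (+-congˡ (*-congˡ (eval-⊕ F G x)))
      (solve 5 (λ a b x s t → a :+ b :+ x :* (s :+ t) := (a :+ x :* s) :+ (b :+ x :* t)) refl a b x _ _)
      where open KSolver

  eval-scale : ∀ a F x → eval (scale a F) x ≈ a * eval F x
  eval-scale a []      x = sym (zeroʳ a)
  eval-scale a (b ∷ F) x = trans (+-congˡ (*-congˡ (eval-scale a F x)))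
    (solve 4 (λ a b x s → a :* b :+ x :* (a :* s) := a :* (b :+ x :* s)) refl a b x _)
    where open KSolver

  opaque
    unfolding _⊕_

    eval-⊗ : ∀ F G x → eval (F ⊗ G) x ≈ eval F x * eval G x
    eval-⊗ []      G x = sym (zeroˡ _)
    eval-⊗ (a ∷ F) G x = begin
      eval (scale a G ⊕ (0# ∷ F ⊗ G)) x                     ≈⟨ eval-⊕ (scale a G) _ x ⟩
      eval (scale a G) x + (0# + x * eval (F ⊗ G) x)        ≈⟨ +-cong (eval-scale a G x) (+-congˡ (*-congˡ (eval-⊗ F G x))) ⟩
      a * eval G x + (0# + x * (eval F x * eval G x))
        ≈⟨ solve 4 (λ a x f g → a :* g :+ (con (+ 0) :+ x :* (f :* g)) := (a :+ x :* f) :* g) refl a x _ _ ⟩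
      (a + x * eval F x) * eval G x                         ∎
      where open K-Reasoning
            open KSolver

    eval-C : ∀ a x → eval (C a) x ≈ a
    eval-C a x = trans (+-congˡ (zeroʳ x)) (+-identityʳ a)

  opaque
    unfolding _⊕_

    eval-^ : ∀ F n x → eval (F ^ₚ n) x ≈ eval F x ^ n
    eval-^ F zero    x = eval-C 1# x
    eval-^ F (suc n) x = trans (eval-⊗ F (F ^ₚ n) x) (*-congˡ (eval-^ F n x))

  opaque
    unfolding _⊕_

    eval-X : ∀ x → eval X x ≈ x
    eval-X x = solve 1 (λ x → con (+ 0) :+ x :* (con (+ 1) :+ x :* con (+ 0)) := x) refl x
      where open KSolver

  -- The product rule for a + X F, which avoids numbering the coefficients.
  D : Polynomial → Polynomial
  D []      = []
  D (a ∷ F) = F ⊕ (0# ∷ D F)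

  opaque
    unfolding _⊕_

    coefficient-D : ∀ F i → coefficient (D F) i ≈ suc i · coefficient F (suc i)
    coefficient-D []      i       = sym (·-zero (suc i))
      where
      ·-zero : ∀ n → n · 0# ≈ 0#
      ·-zero zero    = refl
      ·-zero (suc n) = trans (+-identityˡ _) (·-zero n)
    coefficient-D (a ∷ F) zero    = coefficient-add F (0# ∷ D F) 0
    coefficient-D (a ∷ F) (suc i) = trans (coefficient-add F (0# ∷ D F) (suc i)) (+-congˡ (coefficient-D F i))

    D-cong : ∀ {F G} → F ≋ G → D F ≋ D G
    D-cong {F} {G} p .at i =
      trans (coefficient-D F i) (trans (·-congʳ (suc i) (at p (suc i))) (sym (coefficient-D G i)))

    D-⊕ : ∀ F G → D (F ⊕ G) ≋ D F ⊕ D G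
    D-⊕ []      G       = ≋-refl
    D-⊕ (a ∷ F) []      = ≋-sym (⊕-identityʳ (D (a ∷ F)))
    D-⊕ (a ∷ F) (b ∷ G) = begin
      (F ⊕ G) ⊕ (0# ∷ D (F ⊕ G))                 ≈⟨ ⊕-congˡ {F ⊕ G} (∷-cong refl (D-⊕ F G)) ⟩
      (F ⊕ G) ⊕ (0# ∷ (D F ⊕ D G))               ≈⟨ ⊕-congˡ {F ⊕ G} (0∷-distrib (D F) (D G)) ⟩
      (F ⊕ G) ⊕ ((0# ∷ D F) ⊕ (0# ∷ D G))
        ≈⟨ solve 4 (λ a b c d → (a :+ b) :+ (c :+ d) := (a :+ c) :+ (b :+ d)) ≋-refl F G (0# ∷ D F) (0# ∷ D G) ⟩
      (F ⊕ (0# ∷ D F)) ⊕ (G ⊕ (0# ∷ D G))        ∎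
      where open P-Reasoning
            open PSolver

    D-scale : ∀ a F → D (scale a F) ≋ scale a (D F)
    D-scale a []      = ≋-refl
    D-scale a (b ∷ F) = begin
      scale a F ⊕ (0# ∷ D (scale a F))     ≈⟨ ⊕-congˡ {scale a F} (∷-cong (sym (zeroʳ a)) (D-scale a F)) ⟩
      scale a F ⊕ scale a (0# ∷ D F)       ≈⟨ scale-distribˡ a F (0# ∷ D F) ⟨
      scale a (F ⊕ (0# ∷ D F))             ∎
      where open P-Reasoning

    D-⊗ : ∀ F G → D (F ⊗ G) ≋ D F ⊗ G ⊕ F ⊗ D G
    D-⊗ []      G = ≋-refl
    D-⊗ (a ∷ F) G = begin
      D (scale a G ⊕ (0# ∷ F ⊗ G))                                ≈⟨ D-⊕ (scale a G) _ ⟩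
      D (scale a G) ⊕ (F ⊗ G ⊕ (0# ∷ D (F ⊗ G)))
        ≈⟨ ⊕-cong (≋-trans (D-scale a G) (C⊗ a (D G))) (⊕-congˡ {F ⊗ G} (≋-trans (∷-cong refl (D-⊗ F G)) (X⊗ _))) ⟩
      C a ⊗ D G ⊕ (F ⊗ G ⊕ X ⊗ (D F ⊗ G ⊕ F ⊗ D G))
        ≈⟨ solve 6 (λ a x f g f′ g′ → a :* g′ :+ (f :* g :+ x :* (f′ :* g :+ f :* g′)) :=
              (f :+ x :* f′) :* g :+ (a :+ x :* f) :* g′) ≋-refl (C a) X F G (D F) (D G) ⟩
      (F ⊕ X ⊗ D F) ⊗ G ⊕ (C a ⊕ X ⊗ F) ⊗ D G
        ≈⟨ ⊕-cong (⊗-congʳ {G} (⊕-congˡ {F} (X⊗ (D F)))) (⊗-congʳ {D G} (∷-decompose a F)) ⟨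
      D (a ∷ F) ⊗ G ⊕ (a ∷ F) ⊗ D G                               ∎
      where open P-Reasoning
            open PSolver

  N : ℕ → Polynomial
  N n = n ·ₚ 𝟙

  opaque
    unfolding _⊕_

    -- The extra factor `F` avoids the exponent n - 1, so that n = 0 is no exception. Stepanov's
    -- operator also meets the derivative of a power in exactly this form, as f D(f^h).
    ⊗D-^ : ∀ F n → F ⊗ D (F ^ₚ n) ≋ N n ⊗ (F ^ₚ n ⊗ D F)
    ⊗D-^ F zero    = ≋-trans (⊗-congˡ {F} 0∷[]) (⊗-zeroʳ F)
    ⊗D-^ F (suc n) = begin
      F ⊗ D (F ⊗ F ^ₚ n)                              ≈⟨ ⊗-congˡ {F} (D-⊗ F (F ^ₚ n)) ⟩
      F ⊗ (D F ⊗ F ^ₚ n ⊕ F ⊗ D (F ^ₚ n))             ≈⟨ ⊗-congˡ {F} (⊕-congˡ {D F ⊗ F ^ₚ n} (⊗D-^ F n)) ⟩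
      F ⊗ (D F ⊗ F ^ₚ n ⊕ N n ⊗ (F ^ₚ n ⊗ D F))
        ≈⟨ solve 4 (λ f f′ g n → f :* (f′ :* g :+ n :* (g :* f′)) := (con (+ 1) :+ n) :* (f :* g :* f′)) ≋-refl F (D F) (F ^ₚ n) (N n) ⟩
      N (suc n) ⊗ (F ^ₚ suc n ⊗ D F)                  ∎
      where open P-Reasoning
            open PSolver

    D-^ : ∀ F n → D (F ^ₚ suc n) ≋ N (suc n) ⊗ (F ^ₚ n ⊗ D F)
    D-^ F n = begin
      D (F ⊗ F ^ₚ n)                            ≈⟨ D-⊗ F (F ^ₚ n) ⟩
      D F ⊗ F ^ₚ n ⊕ F ⊗ D (F ^ₚ n)             ≈⟨ ⊕-congˡ {D F ⊗ F ^ₚ n} (⊗D-^ F n) ⟩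
      D F ⊗ F ^ₚ n ⊕ N n ⊗ (F ^ₚ n ⊗ D F)
        ≈⟨ solve 3 (λ f′ g n → f′ :* g :+ n :* (g :* f′) := (con (+ 1) :+ n) :* (g :* f′)) ≋-refl (D F) (F ^ₚ n) (N n) ⟩
      N (suc n) ⊗ (F ^ₚ n ⊗ D F)                ∎
      where open P-Reasoning
            open PSolver

    N-C : ∀ n → N n ≋ C (n · 1#)
    N-C zero    = ≋-sym 0∷[]
    N-C (suc n) = ⊕-congˡ {𝟙} (N-C n)

    eval-N : ∀ n x → eval (N n) x ≈ n · 1#
    eval-N n x = trans (eval-cong x (N-C n)) (eval-C _ x)

  -- A strict upper bound includes the zero polynomial and needs no test whether a coefficient
  -- vanishes.
  record Deg< (n : ℕ) (F : Polynomial) : Set where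
    constructor deg
    field vanish : ∀ i → n ℕ.≤ i → coefficient F i ≈ 0#
  open Deg< public

  deg-cong : ∀ {n F G} → F ≋ G → Deg< n F → Deg< n G
  deg-cong p d .vanish i n≤i = trans (sym (at p i)) (vanish d i n≤i)

  deg-mono : ∀ {m n F} → m ℕ.≤ n → Deg< m F → Deg< n F
  deg-mono m≤n d .vanish i n≤i = vanish d i (ℕP.≤-trans m≤n n≤i)

  deg-[] : ∀ {n} → Deg< n []
  deg-[] .vanish i _ = refl

  deg-zero : ∀ {F} → Deg< 0 F → F ≋ []
  deg-zero d .at i = vanish d i z≤n

  opaque
    unfolding _⊕_

    deg-⊕ : ∀ {n F G} → Deg< n F → Deg< n G → Deg< n (F ⊕ G)
    deg-⊕ {n} {F} {G} d e .vanish i n≤i = trans (coefficient-add F G i)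
      (trans (+-cong (vanish d i n≤i) (vanish e i n≤i)) (+-identityˡ 0#))

    deg-⊖ : ∀ {n F} → Deg< n F → Deg< n (⊖ F)
    deg-⊖ {n} {F} d .vanish i n≤i = trans (coefficient-negate F i) (trans (-‿cong (vanish d i n≤i)) ε⁻¹≈ε)
      where open import Algebra.Properties.AbelianGroup +-abelianGroup using (ε⁻¹≈ε)

  deg-scale : ∀ {n} a {F} → Deg< n F → Deg< n (scale a F)
  deg-scale a {F} d .vanish i n≤i = trans (coefficient-scale a F i) (trans (*-congˡ (vanish d i n≤i)) (zeroʳ a))

  deg-∷ : ∀ {n a F} → Deg< n F → Deg< (suc n) (a ∷ F)
  deg-∷ d .vanish (suc i) (s≤s n≤i) = vanish d i n≤i

  deg-tail : ∀ {n a F} → Deg< (suc n) (a ∷ F) → Deg< n F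
  deg-tail d .vanish i n≤i = vanish d (suc i) (s≤s n≤i)

  deg-C : ∀ {a} → Deg< 1 (C a)
  deg-C = deg-∷ deg-[]

  deg-lin : ∀ {a b} → Deg< 2 (a ∷ b ∷ [])
  deg-lin = deg-∷ deg-C

  opaque
    unfolding _⊕_

    constant⊗ : ∀ {a F} G → Deg< 1 (a ∷ F) → (a ∷ F) ⊗ G ≋ scale a G
    constant⊗ {a} {F} G d = ≋-trans
      (⊕-congˡ {scale a G} (≋-trans (∷-cong refl (⊗-congʳ {G} {F} (deg-zero (deg-tail d)))) 0∷[]))
      (⊕-identityʳ _)

  opaque
    unfolding _⊕_

    -- The asymmetric form avoids predecessors: degree at most n on one side and below m on the
    -- other.
    deg-⊗ : ∀ {n m F G} → Deg< (suc n) F → Deg< m G → Deg< (n ℕ.+ m) (F ⊗ G)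
    deg-⊗ {n}     {m} {[]}    {G} d e = deg-[]
    deg-⊗ {zero}  {m} {a ∷ F} {G} d e = deg-cong (≋-sym (constant⊗ {a} {F} G d)) (deg-scale a e)
    deg-⊗ {suc n} {m} {a ∷ F} {G} d e =
      deg-⊕ {F = scale a G} (deg-mono (ℕP.m≤n+m m (suc n)) (deg-scale a e)) (deg-∷ (deg-⊗ {n} (deg-tail d) e))

    coefficient-top : ∀ {n m F G} → Deg< (suc n) F → Deg< (suc m) G →
                      coefficient (F ⊗ G) (n ℕ.+ m) ≈ coefficient F n * coefficient G m
    coefficient-top {n}     {m} {[]}    {G} d e = sym (zeroˡ _)
    coefficient-top {zero}  {m} {a ∷ F} {G} d e = trans (at (constant⊗ {a} {F} G d) m) (coefficient-scale a G m)
    coefficient-top {suc n} {m} {a ∷ F} {G} d e = begin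
      coefficient (scale a G ⊕ (0# ∷ F ⊗ G)) (suc n ℕ.+ m)         ≈⟨ coefficient-add (scale a G) _ (suc n ℕ.+ m) ⟩
      coefficient (scale a G) (suc n ℕ.+ m) + coefficient (F ⊗ G) (n ℕ.+ m)
        ≈⟨ +-cong (vanish (deg-scale a e) (suc n ℕ.+ m) (s≤s (ℕP.m≤n+m m n))) (coefficient-top {n} (deg-tail d) e) ⟩
      0# + coefficient F n * coefficient G m                        ≈⟨ +-identityˡ _ ⟩
      coefficient F n * coefficient G m                             ∎
      where open K-Reasoning

    deg-^ : ∀ {n F} k → Deg< (suc n) F → Deg< (suc (k ℕ.* n)) (F ^ₚ k)
    deg-^         zero    d = deg-C
    deg-^ {n} {F} (suc k) d = deg-mono (ℕP.≤-reflexive (ℕP.+-suc n (k ℕ.* n))) (deg-⊗ {n} d (deg-^ k d))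

    deg-D : ∀ {n F} → Deg< n F → Deg< n (D F)
    deg-D {n} {F} d .vanish i n≤i = begin
      coefficient (D F) i               ≈⟨ coefficient-D F i ⟩
      suc i · coefficient F (suc i)     ≈⟨ ·-congʳ (suc i) (vanish d (suc i) (ℕP.m≤n⇒m≤1+n n≤i)) ⟩
      suc i · 0#                        ≈⟨ coefficient-D [] i ⟨
      0#                                ∎
      where open K-Reasoning

  -- The translate F(X + c), by Horner's rule in the linear polynomial X + c.
  shift : Carrier → Polynomial → Polynomial
  shift c []      = []
  shift c (a ∷ F) = C a ⊕ (c ∷ C 1#) ⊗ shift c F

  opaque
    unfolding _⊕_

    shift-zero : ∀ c {F} → F ≋ [] → shift c F ≋ []
    shift-zero c {[]}    p = ≋-refl
    shift-zero c {a ∷ F} p = begin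
      C a ⊕ L ⊗ shift c F     ≈⟨ ⊕-cong {C a} (≋-trans (C-cong (at p 0)) 0∷[]) (⊗-congˡ {L} (shift-zero c (tail-zero p))) ⟩
      L ⊗ []                  ≈⟨ ⊗-zeroʳ L ⟩
      []                      ∎
      where
      open P-Reasoning
      L : Polynomial
      L = c ∷ C 1#

    shift-cong : ∀ c {F G} → F ≋ G → shift c F ≋ shift c G
    shift-cong c {[]}    {G}     p = ≋-sym (shift-zero c (≋-sym p))
    shift-cong c {a ∷ F} {[]}    p = shift-zero c {a ∷ F} p
    shift-cong c {a ∷ F} {b ∷ G} p = ⊕-cong {C a} (C-cong (at p 0)) (⊗-congˡ {c ∷ C 1#} (shift-cong c (tail-cong p)))

    shift-⊕ : ∀ c F G → shift c (F ⊕ G) ≋ shift c F ⊕ shift c G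
    shift-⊕ c []      G       = ≋-refl
    shift-⊕ c (a ∷ F) []      = ≋-sym (⊕-identityʳ (shift c (a ∷ F)))
    shift-⊕ c (a ∷ F) (b ∷ G) = begin
      (C a ⊕ C b) ⊕ L ⊗ shift c (F ⊕ G)               ≈⟨ ⊕-congˡ {C a ⊕ C b} (⊗-congˡ {L} (shift-⊕ c F G)) ⟩
      (C a ⊕ C b) ⊕ L ⊗ (shift c F ⊕ shift c G)
        ≈⟨ solve 5 (λ a b l f g → (a :+ b) :+ l :* (f :+ g) := (a :+ l :* f) :+ (b :+ l :* g)) ≋-refl (C a) (C b) L (shift c F) (shift c G) ⟩
      shift c (a ∷ F) ⊕ shift c (b ∷ G)               ∎
      where
      open P-Reasoning
      open PSolver
      L : Polynomial
      L = c ∷ C 1#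

    shift-scale : ∀ c a F → shift c (scale a F) ≋ C a ⊗ shift c F
    shift-scale c a []      = ≋-sym (⊗-zeroʳ (C a))
    shift-scale c a (b ∷ F) = begin
      C (a * b) ⊕ L ⊗ shift c (scale a F)          ≈⟨ ⊕-cong {C (a * b)} (C-* a b) (⊗-congˡ {L} (shift-scale c a F)) ⟩
      C a ⊗ C b ⊕ L ⊗ (C a ⊗ shift c F)
        ≈⟨ solve 4 (λ a b l f → a :* b :+ l :* (a :* f) := a :* (b :+ l :* f)) ≋-refl (C a) (C b) L (shift c F) ⟩
      C a ⊗ shift c (b ∷ F)                        ∎
      where
      open P-Reasoning
      open PSolver
      L : Polynomial
      L = c ∷ C 1#

    shift-⊗ : ∀ c F G → shift c (F ⊗ G) ≋ shift c F ⊗ shift c G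
    shift-⊗ c []      G = ≋-refl
    shift-⊗ c (a ∷ F) G = begin
      shift c (scale a G ⊕ (0# ∷ F ⊗ G))                    ≈⟨ shift-⊕ c (scale a G) _ ⟩
      shift c (scale a G) ⊕ (C 0# ⊕ L ⊗ shift c (F ⊗ G))
        ≈⟨ ⊕-cong (shift-scale c a G) (⊕-cong {C 0#} 0∷[] (⊗-congˡ {L} (shift-⊗ c F G))) ⟩
      C a ⊗ shift c G ⊕ L ⊗ (shift c F ⊗ shift c G)
        ≈⟨ solve 4 (λ a l f g → a :* g :+ l :* (f :* g) := (a :+ l :* f) :* g) ≋-refl (C a) L (shift c F) (shift c G) ⟩
      shift c (a ∷ F) ⊗ shift c G                           ∎
      where
      open P-Reasoning
      open PSolver
      L : Polynomial
      L = c ∷ C 1#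

    shift-C : ∀ c a → shift c (C a) ≋ C a
    shift-C c a = ≋-trans (⊕-congˡ {C a} (⊗-zeroʳ (c ∷ C 1#))) (⊕-identityʳ (C a))

    deg-shift : ∀ c {n F} → Deg< n F → Deg< n (shift c F)
    deg-shift c {n}     {[]}    d = deg-[]
    deg-shift c {zero}  {a ∷ F} d = deg-cong (≋-sym (shift-zero c (deg-zero d))) deg-[]
    deg-shift c {suc n} {a ∷ F} d =
      deg-⊕ {F = C a} (deg-mono (s≤s z≤n) deg-C) (deg-⊗ {1} deg-lin (deg-shift c (deg-tail d)))

    shift-top : ∀ c {n F} → Deg< (suc n) F → coefficient (shift c F) n ≈ coefficient F n
    shift-top c {n}     {[]}    d = refl
    shift-top c {zero}  {a ∷ F} d =
      at (≋-trans (shift-cong c {a ∷ F} {C a} (∷-cong refl (deg-zero (deg-tail d)))) (shift-C c a)) 0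
    shift-top c {suc n} {a ∷ F} d = trans (coefficient-add (C a) ((c ∷ C 1#) ⊗ shift c F) (suc n))
      (trans (+-identityˡ _) (trans (coefficient-top {1} deg-lin (deg-shift c (deg-tail d)))
      (trans (*-identityˡ _) (shift-top c (deg-tail d)))))

    eval-shift : ∀ c F x → eval (shift c F) x ≈ eval F (x + c)
    eval-shift c []      x = refl
    eval-shift c (a ∷ F) x = trans (eval-⊕ (C a) (L ⊗ shift c F) x) (+-cong (eval-C a x)
      (trans (eval-⊗ L (shift c F) x) (*-cong eval-L (eval-shift c F x))))
      where
      L : Polynomial
      L = c ∷ C 1#
      eval-L : c + x * (1# + x * 0#) ≈ x + c
      eval-L = trans (+-congˡ (trans (*-congˡ (trans (+-congˡ (zeroʳ x)) (+-identityʳ 1#))) (*-identityʳ x))) (+-comm c x)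

  opaque
    unfolding _⊕_

    shift-shift : ∀ a b F → shift a (shift b F) ≋ shift (a + b) F
    shift-shift a b []      = ≋-refl
    shift-shift a b (e ∷ F) = begin
      shift a (C e ⊕ (b ∷ C 1#) ⊗ shift b F)
        ≈⟨ shift-⊕ a (C e) ((b ∷ C 1#) ⊗ shift b F) ⟩
      shift a (C e) ⊕ shift a ((b ∷ C 1#) ⊗ shift b F)
        ≈⟨ ⊕-cong (shift-C a e) (≋-trans (shift-⊗ a (b ∷ C 1#) (shift b F)) (⊗-cong shift-L (shift-shift a b F))) ⟩
      C e ⊕ (a + b ∷ C 1#) ⊗ shift (a + b) F ∎
      where
      open P-Reasoning
      shift-L : shift a (b ∷ C 1#) ≋ (a + b ∷ C 1#)
      shift-L = begin
        C b ⊕ (a ∷ C 1#) ⊗ shift a 𝟙        ≈⟨ ⊕-congˡ {C b} (⊗-congˡ {a ∷ C 1#} (shift-C a 1#)) ⟩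
        C b ⊕ (a ∷ C 1#) ⊗ 𝟙                ≈⟨ ⊕-congˡ {C b} (⊗-identityʳ (a ∷ C 1#)) ⟩
        C b ⊕ (a ∷ C 1#)                    ≈⟨ ∷-cong (+-comm b a) ≋-refl ⟩
        a + b ∷ C 1#                        ∎

    shift-congˡ : ∀ {a b} F → a ≈ b → shift a F ≋ shift b F
    shift-congˡ []      p = ≋-refl
    shift-congˡ (e ∷ F) p = ⊕-congˡ {C e} (⊗-cong (∷-cong p (≋-refl {C 1#})) (shift-congˡ F p))

    shift-0 : ∀ F → shift 0# F ≋ F
    shift-0 []      = ≋-refl
    shift-0 (a ∷ F) = ≋-trans (⊕-congˡ {C a} (⊗-congˡ {X} (shift-0 F))) (≋-sym (∷-decompose a F))

  opaque
    unfolding _⊕_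

    lin : Carrier → Polynomial
    lin x = - x ∷ 1# ∷ []

    eval-lin : ∀ x y → eval (lin x) y ≈ y - x
    eval-lin x y = solve 2 (λ x y → :- x :+ y :* (con (+ 1) :+ y :* con (+ 0)) := y :- x) refl x y
      where open KSolver

    lin-⊕ : ∀ x → X ≋ lin x ⊕ C x
    lin-⊕ x = ∷-cong (sym (-‿inverseˡ x)) ≋-refl

    D-lin : ∀ x → D (lin x) ≋ 𝟙
    D-lin x = ≋-trans (⊕-congˡ {𝟙} {0# ∷ (0# ∷ [])} (≋-trans (∷-cong refl 0∷[]) 0∷[])) (⊕-identityʳ 𝟙)

    lin-bounded : ∀ x → Deg< 2 (lin x)
    lin-bounded x = deg-lin

    lin-leading : ∀ x → coefficient (lin x) 1 ≈ 1#
    lin-leading x = refl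

  remainder-theorem : ∀ F x → ∃[ G ] F ≋ C (eval F x) ⊕ lin x ⊗ G
  remainder-theorem []      x = [] , ≋-sym (≋-trans (⊕-cong {C 0#} 0∷[] (⊗-zeroʳ (lin x))) (⊕-identityʳ []))
  remainder-theorem (a ∷ F) x with remainder-theorem F x
  ... | G , F≋ = C e ⊕ X ⊗ G , (begin
      a ∷ F                                         ≈⟨ ∷-decompose a F ⟩
      C a ⊕ X ⊗ F                                   ≈⟨ ⊕-congˡ {C a} (⊗-congˡ {X} F≋) ⟩
      C a ⊕ X ⊗ (C e ⊕ lin x ⊗ G)
        ≈⟨ solve 5 (λ a t e l g → a :+ t :* (e :+ l :* g) := (a :+ t :* e) :+ l :* (t :* g)) ≋-refl (C a) X (C e) (lin x) G ⟩
      (C a ⊕ X ⊗ C e) ⊕ lin x ⊗ (X ⊗ G)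
        ≈⟨ ⊕-congʳ {lin x ⊗ (X ⊗ G)} (⊕-congˡ {C a} (⊗-congʳ {C e} (lin-⊕ x))) ⟩
      (C a ⊕ (lin x ⊕ C x) ⊗ C e) ⊕ lin x ⊗ (X ⊗ G)
        ≈⟨ solve 6 (λ a t x e l g → (a :+ (l :+ x) :* e) :+ l :* (t :* g) := (a :+ x :* e) :+ l :* (e :+ t :* g)) ≋-refl (C a) X (C x) (C e) (lin x) G ⟩
      (C a ⊕ C x ⊗ C e) ⊕ lin x ⊗ (C e ⊕ X ⊗ G)
        ≈⟨ ⊕-congʳ {lin x ⊗ (C e ⊕ X ⊗ G)} (≋-trans (C-+ a (x * e)) (⊕-congˡ {C a} (C-* x e))) ⟨
      C (a + x * e) ⊕ lin x ⊗ (C e ⊕ X ⊗ G)         ∎)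
    where
    e = eval F x
    open P-Reasoning
    open PSolver

  factor-theorem : ∀ F x → eval F x ≈ 0# → ∃[ G ] F ≋ lin x ⊗ G
  factor-theorem F x p with remainder-theorem F x
  ... | G , F≋ = G , ≋-trans F≋ (≋-trans (⊕-congʳ {lin x ⊗ G} (≋-trans (C-cong p) 0∷[])) (⊕-identityˡ _))

  eval-𝟙 : ∀ x → eval 𝟙 x ≈ 1#
  eval-𝟙 x = trans (eval-cong x (≋-sym C-1)) (eval-C 1# x)

  eval-⊖ : ∀ F x → eval (⊖ F) x ≈ - eval F x
  eval-⊖ F x = inverseʳ-unique (eval F x) (eval (⊖ F) x)
    (trans (sym (eval-⊕ F (⊖ F) x)) (eval-zero x (⊝-inverse F)))
    where open import Algebra.Properties.AbelianGroup +-abelianGroup using (inverseʳ-unique)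

  eval-⊝ : ∀ F G x → eval (F ⊝ G) x ≈ eval F x - eval G x
  eval-⊝ F G x = trans (eval-⊕ F (⊖ G) x) (+-congˡ (eval-⊖ G x))

  coefficient-0 : ∀ F → coefficient F 0 ≈ eval F 0#
  coefficient-0 []      = refl
  coefficient-0 (a ∷ F) = sym (trans (+-congˡ (zeroˡ _)) (+-identityʳ a))

-- Polynomials over a field with decidable equality: exact degrees and cancellation.

module PolynomialsOverField
  (R : CommutativeRing 0ℓ 0ℓ)
  (_≈?_ : ∀ x y → Dec (CommutativeRing._≈_ R x y))
  (invert : ∀ x → ¬ CommutativeRing._≈_ R x (CommutativeRing.0# R) →
            ∃[ y ] CommutativeRing._≈_ R (CommutativeRing._*_ R x y) (CommutativeRing.1# R))
  (1≉0 : ¬ CommutativeRing._≈_ R (CommutativeRing.1# R) (CommutativeRing.0# R)) where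

  open CommutativeRing R
  open PolynomialOperations R public
  open import Algebra.Properties.AbelianGroup +-abelianGroup using (x∙y⁻¹≈ε⇒x≈y)

  cancel-zeroˡ : ∀ {x y} → x ≉ 0# → x * y ≈ 0# → y ≈ 0#
  cancel-zeroˡ {x} {y} x≉0 p with invert x x≉0
  ... | z , xz≈1 = begin
      y               ≈⟨ *-identityˡ y ⟨
      1# * y          ≈⟨ *-congʳ (trans (*-comm z x) xz≈1) ⟨
      (z * x) * y     ≈⟨ *-assoc z x y ⟩
      z * (x * y)     ≈⟨ *-congˡ p ⟩
      z * 0#          ≈⟨ zeroʳ z ⟩
      0#              ∎
    where open K-Reasoning

  noZeroDivisors : ∀ x y → x * y ≈ 0# → x ≈ 0# ⊎ y ≈ 0#
  noZeroDivisors x y p with x ≈? 0#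
  ... | yes x≈0 = inj₁ x≈0
  ... | no  x≉0 = inj₂ (cancel-zeroˡ x≉0 p)

  record Degree (F : Polynomial) (e : ℕ) : Set where
    constructor degree
    field
      leading : coefficient F e ≉ 0#
      bounded : Deg< (suc e) F
  open Degree public

  data DegreeView (F : Polynomial) : Set where
    isZero    : F ≋ [] → DegreeView F
    hasDegree : ∀ e → Degree F e → DegreeView F

  degreeView : ∀ F → DegreeView F
  degreeView []      = isZero ≋-refl
  degreeView (a ∷ F) with degreeView F
  ... | hasDegree e (degree l b) = hasDegree (suc e) (degree l (deg-∷ b))
  ... | isZero F≋0 with a ≈? 0#
  ...   | yes a≈0 = isZero (≋-trans (∷-cong a≈0 F≋0) 0∷[])
  ...   | no  a≉0 = hasDegree 0 (degree a≉0 (deg-∷ (deg-cong (≋-sym F≋0) deg-[])))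

  zero? : ∀ F → Dec (F ≋ [])
  zero? F with degreeView F
  ... | isZero F≋0               = yes F≋0
  ... | hasDegree e (degree l _) = no λ F≋0 → l (at F≋0 e)

  degree-nonzero : ∀ {F e} → Degree F e → F ≇ []
  degree-nonzero {e = e} d F≋0 = leading d (at F≋0 e)

  degree-cong : ∀ {F G e} → F ≋ G → Degree F e → Degree G e
  degree-cong {e = e} p (degree l b) = degree (λ q → l (trans (at p e) q)) (deg-cong p b)

  degree-< : ∀ {F e n} → Degree F e → Deg< n F → e ℕ.< n
  degree-< {e = e} {n} d b with n ℕP.≤? e
  ... | yes n≤e = ⊥-elim (leading d (vanish b e n≤e))
  ... | no  n≰e = ℕP.≰⇒> n≰e

  degree-unique : ∀ {F d e} → Degree F d → Degree F e → d ≡ e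
  degree-unique p q = ℕP.≤-antisym (ℕP.≤-pred (degree-< p (bounded q))) (ℕP.≤-pred (degree-< q (bounded p)))

  degree-⊗ : ∀ {F G m n} → Degree F m → Degree G n → Degree (F ⊗ G) (m ℕ.+ n)
  degree-⊗ {F} {G} {m} {n} (degree l b) (degree l′ b′) = degree
    (λ p → case-⊎ (noZeroDivisors _ _ (trans (sym (coefficient-top {m} b b′)) p)))
    (deg-mono (ℕP.≤-reflexive (ℕP.+-suc m n)) (deg-⊗ {m} b b′))
    where
    case-⊎ : coefficient F m ≈ 0# ⊎ coefficient G n ≈ 0# → ⊥
    case-⊎ (inj₁ p) = l p
    case-⊎ (inj₂ p) = l′ p

  degree-^ : ∀ {F e} k → Degree F e → Degree (F ^ₚ k) (k ℕ.* e)
  degree-^ zero    d = degree-cong C-1 (degree 1≉0 deg-C)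
  degree-^ (suc k) d = degree-⊗ d (degree-^ k d)

  degree-lin : ∀ x → Degree (lin x) 1
  degree-lin x = degree (λ p → 1≉0 (trans (sym (lin-leading x)) p)) (lin-bounded x)

  degree-shift : ∀ c {F e} → Degree F e → Degree (shift c F) e
  degree-shift c (degree l b) = degree (λ p → l (trans (sym (shift-top c b)) p)) (deg-shift c b)

  polyNoZeroDivisors : ∀ F G → F ⊗ G ≋ [] → F ≋ [] ⊎ G ≋ []
  polyNoZeroDivisors F G p with degreeView F | degreeView G
  ... | isZero q        | _               = inj₁ q
  ... | hasDegree _ _   | isZero q        = inj₂ q
  ... | hasDegree _ dF  | hasDegree _ dG  = ⊥-elim (degree-nonzero (degree-⊗ dF dG) p)

  ⊗-nonzero : ∀ {F G} → F ≇ [] → G ≇ [] → F ⊗ G ≇ []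
  ⊗-nonzero {F} {G} F≇0 G≇0 p with polyNoZeroDivisors F G p
  ... | inj₁ q = F≇0 q
  ... | inj₂ q = G≇0 q

  ^-nonzero : ∀ {F} k → F ≇ [] → F ^ₚ k ≇ []
  ^-nonzero zero    F≇0 p = 1≉0 (trans (at C-1 0) (at p 0))
  ^-nonzero (suc k) F≇0   = ⊗-nonzero F≇0 (^-nonzero k F≇0)

  open import Algebra.Properties.AbelianGroup (CommutativeRing.+-abelianGroup polyRing) public using ()
    renaming (x∙y⁻¹≈ε⇒x≈y to ⊝≋0⇒≋; x≈y⇒x∙y⁻¹≈ε to ≋⇒⊝≋0)

  ⊗-cancelˡ : ∀ F G H → F ≇ [] → F ⊗ G ≋ F ⊗ H → G ≋ H
  ⊗-cancelˡ F G H F≇0 p = conclude (polyNoZeroDivisors F (G ⊝ H) difference)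
    where
    open P-Reasoning
    open PSolver
    difference : F ⊗ (G ⊝ H) ≋ []
    difference = begin
      F ⊗ (G ⊝ H)         ≈⟨ solve 3 (λ f g h → f :* (g :- h) := f :* g :- f :* h) ≋-refl F G H ⟩
      F ⊗ G ⊝ F ⊗ H       ≈⟨ ≋⇒⊝≋0 p ⟩
      []                  ∎
    conclude : F ≋ [] ⊎ (G ⊝ H) ≋ [] → G ≋ H
    conclude (inj₁ q) = ⊥-elim (F≇0 q)
    conclude (inj₂ q) = ⊝≋0⇒≋ G H q

  -- Divisibility and the number of roots.

  infix 4 _∣_
  _∣_ : Polynomial → Polynomial → Set
  F ∣ G = ∃[ H ] G ≋ F ⊗ H

  ∣-cong : ∀ {F G G′} → G ≋ G′ → F ∣ G → F ∣ G′
  ∣-cong p (H , q) = H , ≋-trans (≋-sym p) q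

  ∣⇒degree-≤ : ∀ {F G d e} → Degree F d → Degree G e → F ∣ G → d ℕ.≤ e
  ∣⇒degree-≤ {F} {G} {d} dF dG (H , p) with degreeView H
  ... | isZero q         = ⊥-elim (degree-nonzero dG (≋-trans p (≋-trans (⊗-congˡ {F} q) (⊗-zeroʳ F))))
  ... | hasDegree e′ dH  = ≡.subst (d ℕ.≤_) (degree-unique (degree-⊗ dF dH) (degree-cong p dG)) (ℕP.m≤m+n d e′)

  *-nonzero : ∀ {x y} → x ≉ 0# → y ≉ 0# → x * y ≉ 0#
  *-nonzero {x} {y} x≉0 y≉0 p with noZeroDivisors x y p
  ... | inj₁ q = x≉0 q
  ... | inj₂ q = y≉0 q

  power-nonzero : ∀ {x} k → x ≉ 0# → x ^ k ≉ 0#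
  power-nonzero zero    x≉0 = 1≉0
  power-nonzero (suc k) x≉0 = *-nonzero x≉0 (power-nonzero k x≉0)

  -- Coprimality of distinct linear polynomials without greatest common divisors: at x the product
  -- with `lin x` vanishes while (x - y)^M does not, so the cofactor `H` has the root x, and `lin x`
  -- cancels.
  lin^∣-cancel : ∀ M {x y} G → x ≉ y → lin y ^ₚ M ∣ lin x ⊗ G → lin y ^ₚ M ∣ G
  lin^∣-cancel M {x} {y} G x≉y (H , p) = divide (factor-theorem H x (cancel-zeroˡ (power-nonzero M x-y≉0) root))
    where
    x-y≉0 : x - y ≉ 0#
    x-y≉0 q = x≉y (x∙y⁻¹≈ε⇒x≈y x y q)
    root : (x - y) ^ M * eval H x ≈ 0#
    root = begin
      (x - y) ^ M * eval H x                ≈⟨ *-congʳ (^-congˡ M (eval-lin y x)) ⟨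
      eval (lin y) x ^ M * eval H x         ≈⟨ *-congʳ (eval-^ (lin y) M x) ⟨
      eval (lin y ^ₚ M) x * eval H x        ≈⟨ eval-⊗ (lin y ^ₚ M) H x ⟨
      eval (lin y ^ₚ M ⊗ H) x               ≈⟨ eval-cong x p ⟨
      eval (lin x ⊗ G) x                    ≈⟨ eval-⊗ (lin x) G x ⟩
      eval (lin x) x * eval G x             ≈⟨ *-congʳ (trans (eval-lin x x) (-‿inverseʳ x)) ⟩
      0# * eval G x                         ≈⟨ zeroˡ _ ⟩
      0#                                    ∎
      where open K-Reasoning
    divide : (∃[ H₁ ] H ≋ lin x ⊗ H₁) → lin y ^ₚ M ∣ G
    divide (H₁ , q) = H₁ , ⊗-cancelˡ (lin x) G _ (degree-nonzero (degree-lin x)) (begin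
      lin x ⊗ G                         ≈⟨ p ⟩
      lin y ^ₚ M ⊗ H                    ≈⟨ ⊗-congˡ {lin y ^ₚ M} q ⟩
      lin y ^ₚ M ⊗ (lin x ⊗ H₁)
        ≈⟨ solve 3 (λ a b c → a :* (b :* c) := b :* (a :* c)) ≋-refl (lin y ^ₚ M) (lin x) H₁ ⟩
      lin x ⊗ (lin y ^ₚ M ⊗ H₁)         ∎)
      where
      open P-Reasoning
      open PSolver

  lin^∣-cancel^ : ∀ M k {x y} G → x ≉ y → lin y ^ₚ M ∣ lin x ^ₚ k ⊗ G → lin y ^ₚ M ∣ G
  lin^∣-cancel^ M zero        G x≉y d = ∣-cong {lin _ ^ₚ M} (⊗-identityˡ G) d
  lin^∣-cancel^ M (suc k) {x} G x≉y d = lin^∣-cancel^ M k G x≉y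
    (lin^∣-cancel M (lin x ^ₚ k ⊗ G) x≉y (∣-cong {lin _ ^ₚ M} (⊗-assoc (lin x) (lin x ^ₚ k) G) d))

  -- Splitting off `lin x ^ₚ M` lowers the degree by M, and the powers at the other points still
  -- divide the quotient because those points differ from x.
  rootsBound : ∀ M xs Ψ n → AllPairs _≉_ xs → All (λ x → lin x ^ₚ M ∣ Ψ) xs →
               Ψ ≇ [] → Deg< n Ψ → length xs ℕ.* M ℕ.< n
  rootsBound M [] Ψ zero    _ _ Ψ≇0 b = ⊥-elim (Ψ≇0 (deg-zero b))
  rootsBound M [] Ψ (suc n) _ _ Ψ≇0 b = s≤s z≤n
  rootsBound M (x ∷ xs) Ψ n (x≉ ∷ ≉s) ((Ψ₁ , p) ∷ ds) Ψ≇0 b with degreeView Ψ₁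
  ... | isZero q = ⊥-elim (Ψ≇0 (≋-trans p (≋-trans (⊗-congˡ {lin x ^ₚ M} q) (⊗-zeroʳ (lin x ^ₚ M)))))
  ... | hasDegree e d = ℕP.<-≤-trans
      (ℕP.+-monoʳ-< M (rootsBound M xs Ψ₁ (suc e) ≉s (All.zipWith step (x≉ , ds)) (degree-nonzero d) (bounded d)))
      (≡.subst (ℕ._≤ n) (≡.trans (≡.cong (λ k → suc (k ℕ.+ e)) (ℕP.*-identityʳ M)) (≡.sym (ℕP.+-suc M e)))
        (degree-< (degree-⊗ (degree-^ M (degree-lin x)) d) (deg-cong p b)))
    where
    step : ∀ {y} → (x ≉ y) × lin y ^ₚ M ∣ Ψ → lin y ^ₚ M ∣ Ψ₁
    step (x≉y , d) = lin^∣-cancel^ M M Ψ₁ x≉y (∣-cong {lin _ ^ₚ M} p d)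

  root⇒∣ : ∀ F x → eval F x ≈ 0# → lin x ^ₚ 1 ∣ F
  root⇒∣ F x p with factor-theorem F x p
  ... | G , q = G , ≋-trans q (⊗-congʳ {G} (≋-sym (⊗-identityʳ (lin x))))

  simpleRootsBound : ∀ xs Ψ n → AllPairs _≉_ xs → All (λ x → eval Ψ x ≈ 0#) xs →
                     Ψ ≇ [] → Deg< n Ψ → length xs ℕ.< n
  simpleRootsBound xs Ψ n ≉s rs Ψ≇0 b = ≡.subst (ℕ._< n) (ℕP.*-identityʳ _)
    (rootsBound 1 xs Ψ n ≉s (All.map (root⇒∣ Ψ _) rs) Ψ≇0 b)

  -- Multiplicity of a root from the vanishing of derivatives.

  D^ : ℕ → Polynomial → Polynomial
  D^ zero    F = F
  D^ (suc i) F = D^ i (D F)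

  module _ (x : Carrier) where
    private L = lin x

    L^≇0 : ∀ k → L ^ₚ k ≇ []
    L^≇0 k = ^-nonzero k (degree-nonzero (degree-lin x))

    L-zero : ∀ G → eval (L ⊗ G) x ≈ 0#
    L-zero G = trans (eval-⊗ L G x) (trans (*-congʳ (trans (eval-lin x x) (-‿inverseʳ x))) (zeroˡ _))

    -- Differentiate `L ^ₚ suc j ⊗ Q`, where D L = 1, compare with the second factorisation and
    -- cancel the common L^j.
    ^∣-derivative : ∀ F j Q W → F ≋ L ^ₚ suc j ⊗ Q → D F ≋ L ^ₚ suc j ⊗ W →
                    N (suc j) ⊗ Q ⊕ L ⊗ D Q ≋ L ⊗ W
    ^∣-derivative F j Q W p q = ⊗-cancelˡ (L ^ₚ j) _ _ (L^≇0 j) (begin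
      L ^ₚ j ⊗ (N (suc j) ⊗ Q ⊕ L ⊗ D Q)
        ≈⟨ solve 5 (λ l g n q q′ → g :* (n :* q :+ l :* q′) := (n :* (g :* con (+ 1))) :* q :+ (l :* g) :* q′)
                ≋-refl L (L ^ₚ j) (N (suc j)) Q (D Q) ⟩
      (N (suc j) ⊗ (L ^ₚ j ⊗ 𝟙)) ⊗ Q ⊕ L ^ₚ suc j ⊗ D Q
        ≈⟨ ⊕-congʳ {L ^ₚ suc j ⊗ D Q} (⊗-congʳ {Q} (⊗-congˡ {N (suc j)} (⊗-congˡ {L ^ₚ j} (D-lin x)))) ⟨
      (N (suc j) ⊗ (L ^ₚ j ⊗ D L)) ⊗ Q ⊕ L ^ₚ suc j ⊗ D Q
        ≈⟨ ⊕-congʳ {L ^ₚ suc j ⊗ D Q} (⊗-congʳ {Q} (D-^ L j)) ⟨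
      D (L ^ₚ suc j) ⊗ Q ⊕ L ^ₚ suc j ⊗ D Q                 ≈⟨ D-⊗ (L ^ₚ suc j) Q ⟨
      D (L ^ₚ suc j ⊗ Q)                                    ≈⟨ D-cong p ⟨
      D F                                                   ≈⟨ q ⟩
      L ^ₚ suc j ⊗ W
        ≈⟨ solve 3 (λ l g w → (l :* g) :* w := g :* (l :* w)) ≋-refl L (L ^ₚ j) W ⟩
      L ^ₚ j ⊗ (L ⊗ W)                                      ∎)
      where
      open P-Reasoning
      open PSolver

    -- At x the identity of `^∣-derivative` becomes (j + 1) Q(x) = 0. So Q has the root x, provided
    -- that j + 1 is nonzero in the field.
    raise : ∀ F j → suc j · 1# ≉ 0# → L ^ₚ suc j ∣ F → L ^ₚ suc j ∣ D F → L ^ₚ suc (suc j) ∣ F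
    raise F j j≉0 (Q , p) (W , q) = extend (factor-theorem Q x (cancel-zeroˡ j≉0 root))
      where
      root : suc j · 1# * eval Q x ≈ 0#
      root = begin
        suc j · 1# * eval Q x                                ≈⟨ *-congʳ (eval-N (suc j) x) ⟨
        eval (N (suc j)) x * eval Q x                        ≈⟨ eval-⊗ (N (suc j)) Q x ⟨
        eval (N (suc j) ⊗ Q) x                               ≈⟨ +-identityʳ _ ⟨
        eval (N (suc j) ⊗ Q) x + 0#                          ≈⟨ +-congˡ (L-zero (D Q)) ⟨
        eval (N (suc j) ⊗ Q) x + eval (L ⊗ D Q) x            ≈⟨ eval-⊕ (N (suc j) ⊗ Q) (L ⊗ D Q) x ⟨
        eval (N (suc j) ⊗ Q ⊕ L ⊗ D Q) x                     ≈⟨ eval-cong x (^∣-derivative F j Q W p q) ⟩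
        eval (L ⊗ W) x                                       ≈⟨ L-zero W ⟩
        0#                                                   ∎
        where open K-Reasoning
      extend : (∃[ G ] Q ≋ L ⊗ G) → L ^ₚ suc (suc j) ∣ F
      extend (G , r) = G , (begin
        F                              ≈⟨ p ⟩
        L ^ₚ suc j ⊗ Q                 ≈⟨ ⊗-congˡ {L ^ₚ suc j} r ⟩
        L ^ₚ suc j ⊗ (L ⊗ G)
          ≈⟨ solve 3 (λ l a g → a :* (l :* g) := (l :* a) :* g) ≋-refl L (L ^ₚ suc j) G ⟩
        L ^ₚ suc (suc j) ⊗ G           ∎)
        where
        open P-Reasoning
        open PSolver

    ^∣-lower : ∀ F {j k} → j ℕ.≤ k → L ^ₚ k ∣ F → L ^ₚ j ∣ F
    ^∣-lower F {zero}  {k}     z≤n       (G , p) = F , ≋-sym (⊗-identityˡ F)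
    ^∣-lower F {suc j} {suc k} (s≤s j≤k) (G , p)
      with ^∣-lower (L ^ₚ k ⊗ G) {j} {k} j≤k (G , ≋-refl)
    ... | H , q = H , (begin
        F                            ≈⟨ p ⟩
        L ^ₚ suc k ⊗ G               ≈⟨ ⊗-assoc L (L ^ₚ k) G ⟩
        L ⊗ (L ^ₚ k ⊗ G)             ≈⟨ ⊗-congˡ {L} q ⟩
        L ⊗ (L ^ₚ j ⊗ H)             ≈⟨ ⊗-assoc L (L ^ₚ j) H ⟨
        L ^ₚ suc j ⊗ H               ∎)
      where open P-Reasoning

    -- By induction `L ^ₚ k` divides D F. The value F(x) = 0 supplies the first factor of F, and
    -- `raise` then adds the others one at a time. Each addition divides by an integer below k, so k
    -- may not exceed the characteristic.
    multiplicity : ∀ k F → (∀ i → 1 ℕ.≤ i → i ℕ.< k → i · 1# ≉ 0#) →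
                   (∀ i → i ℕ.< k → eval (D^ i F) x ≈ 0#) → L ^ₚ k ∣ F
    multiplicity zero    F char zs = F , ≋-sym (⊗-identityˡ F)
    multiplicity (suc k) F char zs = climb k ℕP.≤-refl
      where
      inD : L ^ₚ k ∣ D F
      inD = multiplicity k (D F) (λ i 1≤i i<k → char i 1≤i (ℕP.m<n⇒m<1+n i<k)) (λ i i<k → zs (suc i) (s≤s i<k))
      climb : ∀ j → j ℕ.≤ k → L ^ₚ suc j ∣ F
      climb zero    _   = root⇒∣ F x (zs 0 (s≤s z≤n))
      climb (suc j) j<k = raise F j (char (suc j) (s≤s z≤n) (s≤s j<k)) (climb j (ℕP.<⇒≤ j<k))
                            (^∣-lower (D F) j<k inD)

  deg-drop : ∀ {e F} → Deg< (suc e) F → coefficient F e ≈ 0# → Deg< e F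
  deg-drop {e} d z .vanish i e≤i with e ℕP.≟ i
  ... | yes ≡.refl = z
  ... | no  e≢i    = vanish d i (ℕP.≤∧≢⇒< e≤i e≢i)

  -- Recursion along the dividend: if A leaves the remainder S, then a + X S has degree at most e,
  -- and one constant multiple of G removes its top coefficient.
  divide : ∀ {G e} → Degree G e → ∀ A → ∃[ Q ] ∃[ S ] (A ≋ G ⊗ Q ⊕ S × Deg< e S)
  divide {G} dG []      = [] , [] , ≋-sym (≋-trans (⊕-identityʳ (G ⊗ [])) (⊗-zeroʳ G)) , deg-[]
  divide {G} {e} dG (a ∷ A) with divide dG A | invert (coefficient G e) (leading dG)
  ... | Q , S , A≋ , dS | g , lg≈1 = X ⊗ Q ⊕ C c , (a ∷ S) ⊝ C c ⊗ G , quotient , deg-drop dS′ top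
    where
    c = coefficient (a ∷ S) e * g
    dS′ : Deg< (suc e) ((a ∷ S) ⊝ C c ⊗ G)
    dS′ = deg-⊕ (deg-∷ dS) (deg-⊖ (deg-⊗ {0} deg-C (bounded dG)))
    top : coefficient ((a ∷ S) ⊝ C c ⊗ G) e ≈ 0#
    top = begin
      coefficient ((a ∷ S) ⊝ C c ⊗ G) e       ≈⟨ coefficient-⊕ (a ∷ S) _ e ⟩
      s + coefficient (⊖ (C c ⊗ G)) e         ≈⟨ +-congˡ (coefficient-⊖ (C c ⊗ G) e) ⟩
      s - coefficient (C c ⊗ G) e             ≈⟨ +-congˡ (-‿cong (coefficient-top {0} deg-C (bounded dG))) ⟩
      s - (s * g) * coefficient G e
        ≈⟨ +-congˡ (-‿cong (trans (*-assoc s g _) (trans (*-congˡ (trans (*-comm g _) lg≈1)) (*-identityʳ s)))) ⟩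
      s - s                                   ≈⟨ -‿inverseʳ s ⟩
      0#                                      ∎
      where
      open K-Reasoning
      s = coefficient (a ∷ S) e
    quotient : (a ∷ A) ≋ G ⊗ (X ⊗ Q ⊕ C c) ⊕ ((a ∷ S) ⊝ C c ⊗ G)
    quotient = begin
      a ∷ A                                   ≈⟨ ∷-decompose a A ⟩
      C a ⊕ X ⊗ A                             ≈⟨ ⊕-congˡ {C a} (⊗-congˡ {X} A≋) ⟩
      C a ⊕ X ⊗ (G ⊗ Q ⊕ S)
        ≈⟨ solve 6 (λ a x g q s c → a :+ x :* (g :* q :+ s) := g :* (x :* q :+ c) :+ ((a :+ x :* s) :- c :* g))
                ≋-refl (C a) X G Q S (C c) ⟩
      G ⊗ (X ⊗ Q ⊕ C c) ⊕ ((C a ⊕ X ⊗ S) ⊝ C c ⊗ G)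
        ≈⟨ ⊕-congˡ {G ⊗ (X ⊗ Q ⊕ C c)} (⊕-congʳ {⊖ (C c ⊗ G)} (∷-decompose a S)) ⟨
      G ⊗ (X ⊗ Q ⊕ C c) ⊕ ((a ∷ S) ⊝ C c ⊗ G) ∎
      where
      open P-Reasoning
      open PSolver

  ∣-trans : ∀ {F G H} → F ∣ G → G ∣ H → F ∣ H
  ∣-trans {F} (A , p) (B , q) = A ⊗ B , ≋-trans q (≋-trans (⊗-congʳ {B} p) (⊗-assoc F A B))

  ∣-refl : ∀ F → F ∣ F
  ∣-refl F = 𝟙 , ≋-sym (⊗-identityʳ F)

  ∣-⊗ʳ : ∀ {F G} H → F ∣ G → F ∣ G ⊗ H
  ∣-⊗ʳ {F} H (A , p) = A ⊗ H , ≋-trans (⊗-congʳ {H} p) (⊗-assoc F A H)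

  ∣-⊕ : ∀ {F G H} → F ∣ G → F ∣ H → F ∣ G ⊕ H
  ∣-⊕ {F} (A , p) (B , q) = A ⊕ B , ≋-trans (⊕-cong p q) (≋-sym (CommutativeRing.distribˡ polyRing F A B))

  ∣-⊖ : ∀ {F G} → F ∣ G → F ∣ ⊖ G
  ∣-⊖ {F} (A , p) = ⊖ A , ≋-trans (⊖-cong p) (-‿distribʳ-* F A)
    where open import Algebra.Properties.Ring (CommutativeRing.ring polyRing) using (-‿distribʳ-*)

  ∣-low⇒zero : ∀ {F e G} → Degree F e → Deg< e G → F ∣ G → G ≋ []
  ∣-low⇒zero {F} {e} {G} dF b d with degreeView G
  ... | isZero z       = z
  ... | hasDegree g dG = ⊥-elim (ℕP.<-irrefl ≡.refl (ℕP.≤-<-trans (∣⇒degree-≤ dF dG d) (degree-< dG b)))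

  shift-∣ : ∀ c {F G} → F ∣ G → shift c F ∣ shift c G
  shift-∣ c {F} (A , p) = shift c A , ≋-trans (shift-cong c p) (shift-⊗ c F A)

  unshift : ∀ c F → shift (- c) (shift c F) ≋ F
  unshift c F = ≋-trans (shift-shift (- c) c F) (≋-trans (shift-congˡ F (-‿inverseˡ c)) (shift-0 F))

  reshift : ∀ c F → shift c (shift (- c) F) ≋ F
  reshift c F = ≋-trans (shift-shift c (- c) F) (≋-trans (shift-congˡ F (-‿inverseʳ c)) (shift-0 F))

  ∣-congˡ : ∀ {F F′ G} → F ≋ F′ → F ∣ G → F′ ∣ G
  ∣-congˡ p (A , q) = A , ≋-trans q (⊗-congʳ {A} p)

  shift-∣⁻ : ∀ c {F G} → shift c F ∣ shift c G → F ∣ G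
  shift-∣⁻ c {F} {G} d = ∣-congˡ (unshift c F) (∣-cong {shift (- c) (shift c F)} (unshift c G) (shift-∣ (- c) d))

  -- Irreducible polynomials, Euclid's lemma and descent on squares.

  record Irreducible (P : Polynomial) (e : ℕ) : Set where
    field
      degreeOf    : Degree P e
      nonconstant : 1 ℕ.≤ e
      noFactor    : ∀ G d → Degree G d → 1 ℕ.≤ d → d ℕ.< e → ¬ G ∣ P
  open Irreducible public

  irreducible-shift : ∀ c {P e} → Irreducible P e → Irreducible (shift c P) e
  irreducible-shift c irr .degreeOf    = degree-shift c (degreeOf irr)
  irreducible-shift c irr .nonconstant = nonconstant irr
  irreducible-shift c {P} irr .noFactor G d dG 1≤d d<e G∣ = noFactor irr (shift (- c) G) d (degree-shift (- c) dG) 1≤d d<e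
    (∣-cong {shift (- c) G} (unshift c P) (shift-∣ (- c) G∣))

  -- Constructively only the double negation of the existence of an irreducible factor is at hand.
  irreducibleFactor : ∀ n G e → e ℕ.< n → Degree G e → 1 ℕ.≤ e →
                      (∀ P d → Irreducible P d → P ∣ G → ⊥) → ⊥
  irreducibleFactor (suc n) G e (s≤s e≤n) dG 1≤e k = k G e irr (∣-refl G)
    where
    irr : Irreducible G e
    irr .degreeOf    = dG
    irr .nonconstant = 1≤e
    irr .noFactor H d dH 1≤d d<e H∣G = irreducibleFactor n H d (ℕP.<-≤-trans d<e e≤n) dH 1≤d
      (λ P f irrP P∣H → k P f irrP (∣-trans P∣H H∣G))

  -- Dividing P, not S, gives P = S Q + V with V of lower degree than S, and V is nonzero because S
  -- would otherwise be a proper factor of P. If V T is 1 modulo P, then so is S (- Q T).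
  invertModulo : ∀ {P e} → Irreducible P e → ∀ n S → n ℕ.≤ e → Deg< n S → S ≇ [] →
                 ∃[ T ] ∃[ U ] S ⊗ T ≋ 𝟙 ⊕ P ⊗ U
  invertModulo irr zero S n≤e b S≇0 = ⊥-elim (S≇0 (deg-zero b))
  invertModulo {P} {e} irr (suc n) S n<e b S≇0 with degreeView S
  ... | isZero z = ⊥-elim (S≇0 z)
  ... | hasDegree zero dS with invert (coefficient S 0) (leading dS)
  ...   | t , st≈1 = C t , [] , (begin
      S ⊗ C t                            ≈⟨ ⊗-congʳ {C t} constant ⟩
      C (coefficient S 0) ⊗ C t          ≈⟨ C-* (coefficient S 0) t ⟨
      C (coefficient S 0 * t)            ≈⟨ ≋-trans (C-cong st≈1) C-1 ⟩
      𝟙                                  ≈⟨ ≋-trans (⊕-congˡ {𝟙} (⊗-zeroʳ P)) (⊕-identityʳ 𝟙) ⟨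
      𝟙 ⊕ P ⊗ []                         ∎)
      where
      open P-Reasoning
      constant : S ≋ C (coefficient S 0)
      constant .at zero    = refl
      constant .at (suc i) = vanish (bounded dS) (suc i) (s≤s z≤n)
  invertModulo {P} {e} irr (suc n) S n<e b S≇0 | hasDegree (suc d) dS with divide dS P
  ... | Q , V , P≋ , dV = continue (invertModulo irr n V (ℕP.<⇒≤ n<e) (deg-mono d<n dV) V≇0)
    where
    d<n : suc d ℕ.≤ n
    d<n = ℕP.≤-pred (degree-< dS b)
    V≇0 : V ≇ []
    V≇0 V≋0 = noFactor irr S (suc d) dS (s≤s z≤n) (ℕP.≤-<-trans d<n n<e)
      (Q , ≋-trans P≋ (≋-trans (⊕-congˡ {S ⊗ Q} V≋0) (⊕-identityʳ _)))
    continue : (∃[ T ] ∃[ U ] V ⊗ T ≋ 𝟙 ⊕ P ⊗ U) → ∃[ T ] ∃[ U ] S ⊗ T ≋ 𝟙 ⊕ P ⊗ U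
    continue (T , U , VT≋) = ⊖ (Q ⊗ T) , U ⊝ T , (begin
      S ⊗ (⊖ (Q ⊗ T))
        ≈⟨ solve 4 (λ s q t v → s :* (:- (q :* t)) := v :* t :- (s :* q :+ v) :* t) ≋-refl S Q T V ⟩
      V ⊗ T ⊝ (S ⊗ Q ⊕ V) ⊗ T
        ≈⟨ ⊕-cong VT≋ (⊖-cong (⊗-congʳ {T} (≋-sym P≋))) ⟩
      (𝟙 ⊕ P ⊗ U) ⊝ P ⊗ T
        ≈⟨ solve 3 (λ p u t → (con (+ 1) :+ p :* u) :- p :* t := con (+ 1) :+ p :* (u :- t)) ≋-refl P U T ⟩
      𝟙 ⊕ P ⊗ (U ⊝ T)                  ∎)
      where
      open P-Reasoning
      open PSolver

  -- If the remainder S of A modulo P is nonzero, it is invertible modulo P, and multiplying A B by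
  -- that inverse recovers B up to multiples of P.
  euclid : ∀ {P e} → Irreducible P e → ∀ A B → P ∣ A ⊗ B → P ∣ A ⊎ P ∣ B
  euclid {P} {e} irr A B (W , AB≋) = fromDivision (divide (degreeOf irr) A)
    where
    fromDivision : (∃[ Q ] ∃[ S ] (A ≋ P ⊗ Q ⊕ S × Deg< e S)) → P ∣ A ⊎ P ∣ B
    fromDivision (Q , S , A≋ , dS) = split (zero? S)
      where
      useInverse : (∃[ T ] ∃[ U ] S ⊗ T ≋ 𝟙 ⊕ P ⊗ U) → P ∣ B
      useInverse (T , U , ST≋) = W ⊗ T ⊝ (Q ⊗ T ⊗ B ⊕ U ⊗ B) , (begin
        B
          ≈⟨ solve 3 (λ b p u → b := (con (+ 1) :+ p :* u) :* b :- p :* (u :* b)) ≋-refl B P U ⟩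
        (𝟙 ⊕ P ⊗ U) ⊗ B ⊝ P ⊗ (U ⊗ B)
          ≈⟨ ⊕-congʳ {⊖ (P ⊗ (U ⊗ B))} (⊗-congʳ {B} ST≋) ⟨
        S ⊗ T ⊗ B ⊝ P ⊗ (U ⊗ B)
          ≈⟨ solve 6 (λ s t b p u q → s :* t :* b :- p :* (u :* b) := ((p :* q :+ s) :* b) :* t :- p :* (q :* t :* b :+ u :* b))
                  ≋-refl S T B P U Q ⟩
        ((P ⊗ Q ⊕ S) ⊗ B) ⊗ T ⊝ P ⊗ (Q ⊗ T ⊗ B ⊕ U ⊗ B)
          ≈⟨ ⊕-congʳ {⊖ (P ⊗ (Q ⊗ T ⊗ B ⊕ U ⊗ B))} (⊗-congʳ {T} (≋-trans (⊗-congʳ {B} (≋-sym A≋)) AB≋)) ⟩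
        (P ⊗ W) ⊗ T ⊝ P ⊗ (Q ⊗ T ⊗ B ⊕ U ⊗ B)
          ≈⟨ solve 4 (λ p w t z → (p :* w) :* t :- p :* z := p :* (w :* t :- z)) ≋-refl P W T (Q ⊗ T ⊗ B ⊕ U ⊗ B) ⟩
        P ⊗ (W ⊗ T ⊝ (Q ⊗ T ⊗ B ⊕ U ⊗ B)) ∎)
        where
        open P-Reasoning
        open PSolver
      split : Dec (S ≋ []) → P ∣ A ⊎ P ∣ B
      split (yes S≋0) = inj₁ (Q , ≋-trans A≋ (≋-trans (⊕-congˡ {P ⊗ Q} S≋0) (⊕-identityʳ _)))
      split (no S≇0)  = inj₂ (useInverse (invertModulo irr e S ℕP.≤-refl dS S≇0))

  -- The valuation at P is odd on the left and even on the right. Concretely, P divides v, hence u²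
  -- k and hence u, and (u, v) can be replaced by (u / P, v / P). The degree of u drops since P is
  -- nonconstant, so the descent ends at u = 0.
  squareDescent : ∀ {P e} → Irreducible P e → ∀ {f k c} → f ≋ P ⊗ k → ¬ P ∣ k → c ≉ 0# →
                  ∀ n u v → Deg< n u → C c ⊗ (u ⊗ u ⊗ f) ≋ v ⊗ v → u ≋ []
  squareDescent irr f≋ P∤k c≉0 zero u v b _ = deg-zero b
  squareDescent {P} {e} irr {f} {k} {c} f≋ P∤k c≉0 (suc n) u v b eq = fromV (irrSquare v P∣vv)
    where
    open P-Reasoning
    open PSolver
    P≇0 : P ≇ []
    P≇0 = degree-nonzero (degreeOf irr)
    irrSquare : ∀ w → P ∣ w ⊗ w → P ∣ w
    irrSquare w d with euclid irr w w d
    ... | inj₁ q = q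
    ... | inj₂ q = q
    P∣vv : P ∣ v ⊗ v
    P∣vv = C c ⊗ (u ⊗ u ⊗ k) , (begin
      v ⊗ v                            ≈⟨ eq ⟨
      C c ⊗ (u ⊗ u ⊗ f)                ≈⟨ ⊗-congˡ {C c} (⊗-congˡ {u ⊗ u} f≋) ⟩
      C c ⊗ (u ⊗ u ⊗ (P ⊗ k))
        ≈⟨ solve 4 (λ c u p k → c :* (u :* u :* (p :* k)) := p :* (c :* (u :* u :* k))) ≋-refl (C c) u P k ⟩
      P ⊗ (C c ⊗ (u ⊗ u ⊗ k))          ∎)
    fromV : P ∣ v → u ≋ []
    fromV (w , v≋) = fromC (euclid irr (C c ⊗ (u ⊗ u)) k (w ⊗ w , ⊗-cancelˡ P _ _ P≇0 (begin
        P ⊗ (C c ⊗ (u ⊗ u) ⊗ k)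
          ≈⟨ solve 4 (λ c u p k → p :* (c :* (u :* u) :* k) := c :* (u :* u :* (p :* k))) ≋-refl (C c) u P k ⟩
        C c ⊗ (u ⊗ u ⊗ (P ⊗ k))        ≈⟨ ⊗-congˡ {C c} (⊗-congˡ {u ⊗ u} f≋) ⟨
        C c ⊗ (u ⊗ u ⊗ f)              ≈⟨ eq ⟩
        v ⊗ v                          ≈⟨ ⊗-cong v≋ v≋ ⟩
        P ⊗ w ⊗ (P ⊗ w)
          ≈⟨ solve 2 (λ p w → p :* w :* (p :* w) := p :* (p :* (w :* w))) ≋-refl P w ⟩
        P ⊗ (P ⊗ (w ⊗ w))              ∎)))
      where
      fromU : P ∣ u → u ≋ []
      fromU (u₁ , u≋) = zeroCase (degreeView u₁)
        where
        eq₁ : C c ⊗ (u₁ ⊗ u₁ ⊗ f) ≋ w ⊗ w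
        eq₁ = ⊗-cancelˡ (P ⊗ P) _ _ (⊗-nonzero P≇0 P≇0) (begin
          P ⊗ P ⊗ (C c ⊗ (u₁ ⊗ u₁ ⊗ f))
            ≈⟨ solve 4 (λ c u p f → p :* p :* (c :* (u :* u :* f)) := c :* ((p :* u) :* (p :* u) :* f)) ≋-refl (C c) u₁ P f ⟩
          C c ⊗ ((P ⊗ u₁) ⊗ (P ⊗ u₁) ⊗ f)  ≈⟨ ⊗-congˡ {C c} (⊗-congʳ {f} (⊗-cong u≋ u≋)) ⟨
          C c ⊗ (u ⊗ u ⊗ f)                ≈⟨ eq ⟩
          v ⊗ v                            ≈⟨ ⊗-cong v≋ v≋ ⟩
          P ⊗ w ⊗ (P ⊗ w)
            ≈⟨ solve 2 (λ p w → p :* w :* (p :* w) := p :* p :* (w :* w)) ≋-refl P w ⟩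
          P ⊗ P ⊗ (w ⊗ w)                  ∎)
        vanishing : u₁ ≋ [] → u ≋ []
        vanishing z = ≋-trans u≋ (≋-trans (⊗-congˡ {P} z) (⊗-zeroʳ P))
        zeroCase : DegreeView u₁ → u ≋ []
        zeroCase (isZero z)       = vanishing z
        zeroCase (hasDegree d d₁) = vanishing (squareDescent irr f≋ P∤k c≉0 n u₁ w (deg-mono d<n (bounded d₁)) eq₁)
          where
          d<n : suc d ℕ.≤ n
          d<n = ℕP.≤-trans (ℕP.+-monoˡ-≤ d (nonconstant irr))
            (ℕP.≤-pred (degree-< (degree-⊗ (degreeOf irr) d₁) (deg-cong u≋ b)))
      fromUU : P ∣ C c ⊎ P ∣ u ⊗ u → u ≋ []
      fromUU (inj₁ d) = ⊥-elim (c≉0 (at (∣-low⇒zero (degreeOf irr) (deg-mono (nonconstant irr) deg-C) d) 0))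
      fromUU (inj₂ d) = fromU (irrSquare u d)
      fromC : P ∣ C c ⊗ (u ⊗ u) ⊎ P ∣ k → u ≋ []
      fromC (inj₁ d) = fromUU (euclid irr (C c) (u ⊗ u) d)
      fromC (inj₂ d) = ⊥-elim (P∤k d)

-- The field with p elements: Fermat, Frobenius and Euler's criterion.

module PrimeField (h : ℕ) (isPrime : Prime (suc (h ℕ.+ h))) where

  p : ℕ
  p = suc (h ℕ.+ h)

  1≤h : 1 ℕ.≤ h
  1≤h = positive h isPrime
    where
    positive : ∀ k → Prime (suc (k ℕ.+ k)) → 1 ℕ.≤ k
    positive zero    q = ⊥-elim (¬prime[1] q)
    positive (suc k) q = s≤s z≤n

  infix 4 _≈ₚ_
  record _≈ₚ_ (a b : ℕ) : Set where
    constructor residues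
    field same : a DM.% p ≡ b DM.% p
  open _≈ₚ_ public

  ≡⇒≈ₚ : ∀ {a b} → a ≡ b → a ≈ₚ b
  ≡⇒≈ₚ q = residues (≡.cong (DM._% p) q)

  -- Elements are unreduced naturals. Negation is multiplication by p - 1, so that a plus its
  -- negative is literally p times a.
  primeRing : CommutativeRing 0ℓ 0ℓ
  primeRing = record
    { Carrier = ℕ ; _≈_ = _≈ₚ_ ; _+_ = ℕ._+_ ; _*_ = ℕ._*_ ; -_ = (h ℕ.+ h) ℕ.*_ ; 0# = 0 ; 1# = 1
    ; isCommutativeRing = record
      { isRing = record
        { +-isAbelianGroup = record
          { isGroup = record
            { isMonoid = record
              { isSemigroup = record
                { isMagma = record
                  { isEquivalence = record
                    { refl = residues ≡.refl
                    ; sym = λ q → residues (≡.sym (same q))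
                    ; trans = λ q r → residues (≡.trans (same q) (same r)) }
                  ; ∙-cong = λ {a} {b} {c} {d} q r → residues (≡.trans (DM.%-distribˡ-+ a c p)
                      (≡.trans (≡.cong₂ (λ x y → (x ℕ.+ y) DM.% p) (same q) (same r))
                        (≡.sym (DM.%-distribˡ-+ b d p)))) }
                ; assoc = λ a b c → ≡⇒≈ₚ (ℕP.+-assoc a b c) }
              ; identity = (λ a → ≡⇒≈ₚ ≡.refl) , (λ a → ≡⇒≈ₚ (ℕP.+-identityʳ a)) }
            ; inverse = (λ a → residues (≡.trans (≡.cong (DM._% p) (ℕP.+-comm _ a)) (multiple a)))
                      , (λ a → residues (multiple a))
            ; ⁻¹-cong = *-cong {h ℕ.+ h} {h ℕ.+ h} (residues ≡.refl) }
          ; comm = λ a b → ≡⇒≈ₚ (ℕP.+-comm a b) }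
        ; *-cong = *-cong
        ; *-assoc = λ a b c → ≡⇒≈ₚ (ℕP.*-assoc a b c)
        ; *-identity = (λ a → ≡⇒≈ₚ (ℕP.*-identityˡ a)) , (λ a → ≡⇒≈ₚ (ℕP.*-identityʳ a))
        ; distrib = (λ a b c → ≡⇒≈ₚ (ℕP.*-distribˡ-+ a b c)) , (λ a b c → ≡⇒≈ₚ (ℕP.*-distribʳ-+ a b c)) }
      ; *-comm = λ a b → ≡⇒≈ₚ (ℕP.*-comm a b) } }
    where
    *-cong : ∀ {a b c d} → a ≈ₚ b → c ≈ₚ d → a ℕ.* c ≈ₚ b ℕ.* d
    *-cong {a} {b} {c} {d} q r = residues (≡.trans (DM.%-distribˡ-* a c p)
      (≡.trans (≡.cong₂ (λ x y → (x ℕ.* y) DM.% p) (same q) (same r)) (≡.sym (DM.%-distribˡ-* b d p))))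
    multiple : ∀ a → (p ℕ.* a) DM.% p ≡ 0
    multiple a = ≡.trans (≡.cong (DM._% p) (ℕP.*-comm p a)) (DM.m*n%n≡0 a p)

  open CommutativeRing primeRing hiding (zero; +-rawMagma)

  _≟ₚ_ : ∀ a b → Dec (a ≈ₚ b)
  a ≟ₚ b with a DM.% p ℕP.≟ b DM.% p
  ... | yes q = yes (residues q)
  ... | no ¬q = no λ q → ¬q (same q)

  reduce : ∀ a → a DM.% p ≈ₚ a
  reduce a = residues (DM.m%n%n≡m%n a p)

  p≈0 : p ≈ₚ 0
  p≈0 = residues (DM.n%n≡0 p)

  small-injective : ∀ {a b} → a ℕ.< p → b ℕ.< p → a ≈ₚ b → a ≡ b
  small-injective a<p b<p q = ≡.trans (≡.sym (DM.m<n⇒m%n≡m a<p)) (≡.trans (same q) (DM.m<n⇒m%n≡m b<p))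

  small-nonzero : ∀ {a} → 1 ℕ.≤ a → a ℕ.< p → a ≉ 0
  small-nonzero 1≤a a<p q = ℕP.<⇒≢ 1≤a (≡.sym (small-injective a<p (s≤s z≤n) q))

  1≉0 : 1 ≉ 0
  1≉0 = small-nonzero (s≤s z≤n) (s≤s (ℕP.≤-trans 1≤h (ℕP.m≤m+n h h)))

  invert : ∀ a → a ≉ 0 → ∃[ b ] a * b ≈ₚ 1
  invert a a≉0 = b , trans (*-congʳ (sym (reduce a))) inverse
    where
    r = a DM.% p
    fromBézout : Bézout.Identity 1 p r → ∃[ b ] r * b ≈ₚ 1
    fromBézout (Bézout.-+ x y eq) = y , (begin
      r * y             ≈⟨ *-comm r y ⟩
      y * r             ≡⟨ eq ⟨
      1 + x * p         ≈⟨ +-congˡ {1} (trans (*-congˡ {x} p≈0) (zeroʳ x)) ⟩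
      1                 ∎)
      where open import Relation.Binary.Reasoning.Setoid setoid
    fromBézout (Bézout.+- x y eq) = - y , (begin
      r * - y                       ≈⟨ -‿distribʳ-* r y ⟨
      - (r * y)                     ≈⟨ -‿cong (*-comm r y) ⟩
      - (y * r)                     ≈⟨ +-identityˡ (- (y * r)) ⟨
      0 - y * r                     ≈⟨ +-congʳ (trans (*-congˡ {x} p≈0) (zeroʳ x)) ⟨
      x * p - y * r                 ≡⟨ ≡.cong (_- y * r) eq ⟨
      (1 + y * r) - y * r           ≈⟨ +-assoc 1 (y * r) (- (y * r)) ⟩
      1 + (y * r - y * r)           ≈⟨ +-congˡ {1} (-‿inverseʳ (y * r)) ⟩
      1 + 0                         ∎)
      where
      open import Relation.Binary.Reasoning.Setoid setoid
      open import Algebra.Properties.Ring ring using (-‿distribʳ-*)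
    instance
      r≢0 : ℕ.NonZero r
      r≢0 = ℕ.≢-nonZero λ r≡0 → a≉0 (residues r≡0)
    found = fromBézout (coprime-Bézout (prime⇒coprime isPrime (DM.m%n<n a p)))
    b = proj₁ found
    inverse : r * b ≈ₚ 1
    inverse = proj₂ found

  open PolynomialsOverField primeRing _≟ₚ_ invert 1≉0 public

  ·≡* : ∀ n a → n · a ≡ n ℕ.* a
  ·≡* zero    a = ≡.refl
  ·≡* (suc n) a = ≡.cong (a ℕ.+_) (·≡* n a)

  multiple-nonzero : ∀ i → 1 ℕ.≤ i → i ℕ.< p → i · 1 ≉ 0
  multiple-nonzero i 1≤i i<p q = small-nonzero 1≤i i<p
    (trans (≡⇒≈ₚ (≡.sym (≡.trans (·≡* i 1) (ℕP.*-identityʳ i)))) q)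

  -- Coefficient i of F enters D F multiplied by i, which is invertible for 0 < i < p. The
  -- derivative does not see the coefficient of X^p, whence the restriction.
  derivativeZero : ∀ F → D F ≋ [] → ∀ i → 1 ℕ.≤ i → i ℕ.< p → coefficient F i ≈ₚ 0
  derivativeZero F z (suc i) _ i<p = cancel-zeroˡ (small-nonzero (s≤s z≤n) i<p) (begin
    suc i * coefficient F (suc i)      ≡⟨ ·≡* (suc i) _ ⟨
    suc i · coefficient F (suc i)      ≈⟨ coefficient-D F i ⟨
    coefficient (D F) i                ≈⟨ at z i ⟩
    0                                  ∎)
    where open K-Reasoning

  D-^p : ∀ F → D (F ^ₚ p) ≋ []
  D-^p F = begin
    D (F ^ₚ p)                          ≈⟨ D-^ F (h ℕ.+ h) ⟩
    N p ⊗ (F ^ₚ (h ℕ.+ h) ⊗ D F)        ≈⟨ ⊗-congʳ {F ^ₚ (h ℕ.+ h) ⊗ D F} Np≋0 ⟩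
    [] ⊗ (F ^ₚ (h ℕ.+ h) ⊗ D F)         ≈⟨ ⊗-zeroˡ _ ⟩
    []                                  ∎
    where
    open P-Reasoning
    Np≋0 : N p ≋ []
    Np≋0 = ≋-trans (N-C p) (≋-trans (C-cong
      (trans (≡⇒≈ₚ (≡.trans (·≡* p 1) (ℕP.*-identityʳ p))) p≈0)) 0∷[])

  1^ : ∀ n → 1 ^ n ≈ₚ 1
  1^ zero    = refl
  1^ (suc n) = trans (*-identityˡ (1 ^ n)) (1^ n)

  0^ : ∀ n → 1 ℕ.≤ n → 0 ^ n ≈ₚ 0
  0^ (suc n) _ = zeroˡ (0 ^ n)

  monic^-top : ∀ a k → coefficient ((a ∷ 1 ∷ []) ^ₚ k) k ≈ₚ 1
  monic^-top a zero    = sym (at C-1 0)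
  monic^-top a (suc k) = trans
    (coefficient-top {1} deg-lin (≡.subst (λ n → Deg< (suc n) ((a ∷ 1 ∷ []) ^ₚ k)) (ℕP.*-identityʳ k) (deg-^ k deg-lin)))
    (trans (*-identityˡ (coefficient ((a ∷ 1 ∷ []) ^ₚ k) k)) (monic^-top a k))

  -- (1 + X)ᵖ - Xᵖ - 1 has zero derivative and degree below p, hence it is constant.
  successor^p : ∀ x → suc x ^ p ≈ₚ suc (x ^ p)
  successor^p x = x∙y⁻¹≈ε⇒x≈y (suc x ^ p) (suc (x ^ p)) (begin
    suc x ^ p - (1 + x ^ p)
      ≈⟨ +-cong (evalPower 1) (-‿cong (+-cong {1} (sym (eval-𝟙 x)) (evalPower 0))) ⟩
    eval A x - (eval 𝟙 x + eval B x)        ≈⟨ +-congˡ {eval A x} (-‿cong (eval-⊕ 𝟙 B x)) ⟨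
    eval A x - eval (𝟙 ⊕ B) x               ≈⟨ eval-⊝ A (𝟙 ⊕ B) x ⟨
    eval W x                                ≈⟨ eval-zero x W≋0 ⟩
    0                                       ∎)
    where
    open K-Reasoning
    open import Algebra.Properties.AbelianGroup +-abelianGroup using (x∙y⁻¹≈ε⇒x≈y)
    A = (1 ∷ 1 ∷ []) ^ₚ p
    B = X ^ₚ p
    W = A ⊝ (𝟙 ⊕ B)
    evalPower : ∀ a → (a + x) ^ p ≈ₚ eval ((a ∷ 1 ∷ []) ^ₚ p) x
    evalPower a = trans (^-congˡ p (+-congˡ {a} (trans (sym (*-identityʳ x)) (*-congˡ {x} (sym (eval-C 1 x))))))
      (sym (eval-^ (a ∷ 1 ∷ []) p x))
    bounded^ : ∀ a → Deg< (suc p) ((a ∷ 1 ∷ []) ^ₚ p)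
    bounded^ a = ≡.subst (λ n → Deg< (suc n) ((a ∷ 1 ∷ []) ^ₚ p)) (ℕP.*-identityʳ p) (deg-^ p deg-lin)
    coefficient-W : ∀ i → coefficient W i ≈ₚ coefficient A i - (coefficient 𝟙 i + coefficient B i)
    coefficient-W i = trans (coefficient-⊕ A (⊖ (𝟙 ⊕ B)) i) (+-congˡ {coefficient A i}
      (trans (coefficient-⊖ (𝟙 ⊕ B) i) (-‿cong (coefficient-⊕ 𝟙 B i))))
    DW : D W ≋ []
    DW .at i = begin
      coefficient (D W) i            ≈⟨ coefficient-D W i ⟩
      suc i · coefficient W (suc i)  ≈⟨ ·-congʳ (suc i) (trans (coefficient-W (suc i)) (+-congˡ {coefficient A (suc i)}
                                          (-‿cong (+-congʳ (at (≋-sym C-1) (suc i)))))) ⟩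
      suc i · (coefficient A (suc i) - coefficient B (suc i))
        ≈⟨ ·≈* (coefficient A (suc i) - coefficient B (suc i)) ⟩
      suc i * (coefficient A (suc i) - coefficient B (suc i))
        ≈⟨ distribˡ (suc i) (coefficient A (suc i)) (- coefficient B (suc i)) ⟩
      suc i * coefficient A (suc i) + suc i * (- coefficient B (suc i))
        ≈⟨ +-congˡ {suc i * coefficient A (suc i)} (-‿distribʳ-* (suc i) (coefficient B (suc i))) ⟨
      suc i * coefficient A (suc i) - suc i * coefficient B (suc i)
        ≈⟨ +-cong (power A (D-^p (1 ∷ 1 ∷ []))) (-‿cong (power B (D-^p X))) ⟩
      0 - 0                          ≈⟨ -‿inverseʳ 0 ⟩
      0                              ∎
      where
      open import Algebra.Properties.Ring ring using (-‿distribʳ-*)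
      ·≈* : ∀ c → suc i · c ≈ₚ suc i * c
      ·≈* c = ≡⇒≈ₚ (·≡* (suc i) c)
      power : ∀ F → D F ≋ [] → suc i * coefficient F (suc i) ≈ₚ 0
      power F z = trans (sym (·≈* (coefficient F (suc i)))) (trans (sym (coefficient-D F i)) (at z i))
    W≋0 : W ≋ []
    W≋0 .at zero = begin
      coefficient W 0                ≈⟨ coefficient-0 W ⟩
      eval W 0                       ≈⟨ trans (eval-⊝ A (𝟙 ⊕ B) 0) (+-congˡ {eval A 0} (-‿cong (eval-⊕ 𝟙 B 0))) ⟩
      eval A 0 - (eval 𝟙 0 + eval B 0)
        ≈⟨ +-cong (trans (eval-^ (1 ∷ 1 ∷ []) p 0) (1^ p)) (-‿cong (+-cong (eval-𝟙 0) (trans (eval-^ X p 0) (0^ p (s≤s z≤n))))) ⟩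
      1 - (1 + 0)                    ≈⟨ -‿inverseʳ 1 ⟩
      0                              ∎
    W≋0 .at (suc i) with ℕP.<-cmp (suc i) p
    ... | tri< i<p _ _ = derivativeZero W DW (suc i) (s≤s z≤n) i<p
    ... | tri≈ _ ≡.refl _ = begin
      coefficient W p                ≈⟨ coefficient-W p ⟩
      coefficient A p - (coefficient 𝟙 p + coefficient B p)
        ≈⟨ +-cong (monic^-top 1 p) (-‿cong (+-cong (at (≋-sym C-1) p) (monic^-top 0 p))) ⟩
      1 - (0 + 1)                    ≈⟨ -‿inverseʳ 1 ⟩
      0                              ∎
    ... | tri> _ _ p<i = vanish (deg-⊕ (bounded^ 1) (deg-⊖ (deg-⊕ (deg-mono (s≤s z≤n) (deg-cong C-1 deg-C)) (bounded^ 0))))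
                           (suc i) p<i

  fermat : ∀ x → x ^ p ≈ₚ x
  fermat zero    = 0^ p (s≤s z≤n)
  fermat (suc x) = trans (successor^p x) (+-congˡ {1} (fermat x))

  fermat-unit : ∀ x → x ≉ 0 → x ^ (h ℕ.+ h) ≈ₚ 1
  fermat-unit x x≉0 = cancel (invert x x≉0)
    where
    open K-Reasoning
    w = x ^ (h ℕ.+ h)
    cancel : (∃[ y ] x * y ≈ₚ 1) → w ≈ₚ 1
    cancel (y , xy≈1) = begin
      w             ≈⟨ *-identityˡ w ⟨
      1 * w         ≈⟨ *-congʳ {w} (trans (*-comm y x) xy≈1) ⟨
      y * x * w     ≈⟨ *-assoc y x w ⟩
      y * (x * w)   ≈⟨ *-congˡ {y} (fermat x) ⟩
      y * x         ≈⟨ trans (*-comm y x) xy≈1 ⟩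
      1             ∎

  -- This is F^p ≡ F(0) modulo X^p. The derivative of F^p vanishes, which settles the positive
  -- indices; the constant term is Fermat's theorem. The identity F(X)^p = F(X^p) is thereby
  -- bypassed.
  frobenius : ∀ F i → i ℕ.< p → coefficient (F ^ₚ p) i ≈ₚ coefficient (C (eval F 0)) i
  frobenius F zero    _   = trans (coefficient-0 (F ^ₚ p)) (trans (eval-^ F p 0) (fermat (eval F 0)))
  frobenius F (suc i) i<p = derivativeZero (F ^ₚ p) (D-^p F) (suc i) (s≤s z≤n) i<p

  -- X^h - 1 already has the h distinct roots 1², ..., h², so a nonsquare cannot be another root. As
  -- the square of a^h is 1, only -1 remains.
  eulerNonresidue : ∀ a → (∀ x → ¬ x * x ≈ₚ a) → a ^ h ≈ₚ - 1
  eulerNonresidue a nonsquare = split (noZeroDivisors (w - 1) (w + 1) product)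
    where
    open import Algebra.Properties.AbelianGroup +-abelianGroup using (x∙y⁻¹≈ε⇒x≈y; inverseˡ-unique)
    w = a ^ h
    a≉0 : a ≉ 0
    a≉0 a≈0 = nonsquare 0 (sym a≈0)
    product : (w - 1) * (w + 1) ≈ₚ 0
    product = begin
      (w - 1) * (w + 1)
        ≈⟨ solve 1 (λ w → (w :- con (+ 1)) :* (w :+ con (+ 1)) := w :* w :- con (+ 1)) refl w ⟩
      w * w - 1                 ≈⟨ +-congʳ {(- 1)} (^-homo-* a h h) ⟨
      a ^ (h ℕ.+ h) - 1         ≈⟨ +-congʳ {(- 1)} (fermat-unit a a≉0) ⟩
      1 - 1                     ≈⟨ -‿inverseʳ 1 ⟩
      0                         ∎
      where
      open K-Reasoning
      open KSolver
      open import Algebra.Properties.Semiring.Exp semiring using (^-homo-*)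
    square : ℕ → ℕ
    square i = suc i * suc i
    Ψ = X ^ₚ h ⊝ 𝟙
    evalΨ : ∀ x → eval Ψ x ≈ₚ x ^ h - 1
    evalΨ x = trans (eval-⊝ (X ^ₚ h) 𝟙 x)
      (+-cong (trans (eval-^ X h x) (^-congˡ h (eval-X x))) (-‿cong (eval-𝟙 x)))
    boundedΨ : Deg< (suc h) Ψ
    boundedΨ = deg-⊕ (≡.subst (λ n → Deg< (suc n) (X ^ₚ h)) (ℕP.*-identityʳ h) (deg-^ h deg-lin))
                     (deg-⊖ (deg-mono (s≤s z≤n) (deg-cong C-1 deg-C)))
    Ψ≇0 : Ψ ≇ []
    Ψ≇0 z = 1≉0 (begin
      1             ≈⟨ ⁻¹-involutive 1 ⟨
      - (0 - 1)     ≈⟨ -‿cong (+-congʳ {(- 1)} (0^ h 1≤h)) ⟨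
      - (0 ^ h - 1) ≈⟨ -‿cong (trans (sym (evalΨ 0)) (eval-zero 0 z)) ⟩
      - 0           ≈⟨ ε⁻¹≈ε ⟩
      0             ∎)
      where
      open K-Reasoning
      open import Algebra.Properties.AbelianGroup +-abelianGroup using (⁻¹-involutive; ε⁻¹≈ε)
    distinct : ∀ {i j} → i ℕ.< j → j ℕ.< h → square i ≉ square j
    distinct {i} {j} i<j j<h eq = cases (noZeroDivisors (suc j - suc i) (suc j + suc i) (begin
        (suc j - suc i) * (suc j + suc i)
          ≈⟨ solve 2 (λ x y → (y :- x) :* (y :+ x) := y :* y :- x :* x) refl (suc i) (suc j) ⟩
        square j - square i      ≈⟨ +-congˡ {square j} (-‿cong eq) ⟩
        square j - square j      ≈⟨ -‿inverseʳ (square j) ⟩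
        0                        ∎))
      where
      open K-Reasoning
      open KSolver
      j<p : suc j ℕ.< p
      j<p = s≤s (ℕP.≤-trans j<h (ℕP.m≤m+n h h))
      cases : suc j - suc i ≈ₚ 0 ⊎ suc j + suc i ≈ₚ 0 → ⊥
      cases (inj₁ q) = ℕP.<-irrefl (≡.sym (ℕP.suc-injective (small-injective j<p (ℕP.<-trans (s≤s i<j) j<p)
                         (x∙y⁻¹≈ε⇒x≈y (suc j) (suc i) q)))) i<j
      cases (inj₂ q) = small-nonzero (s≤s z≤n) (s≤s (ℕP.+-mono-≤ j<h (ℕP.<-trans i<j j<h))) q
    rootSquare : ∀ i → i ℕ.< h → eval Ψ (square i) ≈ₚ 0
    rootSquare i i<h = begin
      eval Ψ (square i)                   ≈⟨ evalΨ (square i) ⟩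
      square i ^ h - 1                    ≈⟨ +-congʳ {(- 1)} (^-distrib-* (suc i) (suc i) h) ⟩
      suc i ^ h * suc i ^ h - 1           ≈⟨ +-congʳ {(- 1)} (^-homo-* (suc i) h h) ⟨
      suc i ^ (h ℕ.+ h) - 1
        ≈⟨ +-congʳ {(- 1)} (fermat-unit (suc i) (small-nonzero (s≤s z≤n) (s≤s (ℕP.≤-trans i<h (ℕP.m≤m+n h h))))) ⟩
      1 - 1                               ≈⟨ -‿inverseʳ 1 ⟩
      0                                   ∎
      where
      open K-Reasoning
      open import Algebra.Properties.Semiring.Exp semiring using (^-homo-*)
      open import Algebra.Properties.CommutativeSemiring.Exp commutativeSemiring using (^-distrib-*)
    split : w - 1 ≈ₚ 0 ⊎ w + 1 ≈ₚ 0 → w ≈ₚ - 1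
    split (inj₂ q) = inverseˡ-unique w 1 q
    split (inj₁ q) = ⊥-elim (ℕP.<-irrefl (≡.cong suc (length-applyUpTo square h))
      (simpleRootsBound (a ∷ applyUpTo square h) Ψ (suc h)
        (AllP.applyUpTo⁺₁ square h (λ {i} _ eq → nonsquare (suc i) (sym eq)) ∷ AllPairsP.applyUpTo⁺₁ square h distinct)
        (trans (evalΨ a) q ∷ AllP.applyUpTo⁺₁ square h (λ {i} → rootSquare i))
        Ψ≇0 boundedΨ))

  eulerResidue : ∀ a x → x * x ≈ₚ a → a ≉ 0 → a ^ h ≈ₚ 1
  eulerResidue a x xx≈a a≉0 = begin
    a ^ h               ≈⟨ ^-congˡ h xx≈a ⟨
    (x * x) ^ h         ≈⟨ ^-distrib-* x x h ⟩
    x ^ h * x ^ h       ≈⟨ ^-homo-* x h h ⟨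
    x ^ (h ℕ.+ h)       ≈⟨ fermat-unit x x≉0 ⟩
    1                   ∎
    where
    open K-Reasoning
    open import Algebra.Properties.Semiring.Exp semiring using (^-homo-*)
    open import Algebra.Properties.CommutativeSemiring.Exp commutativeSemiring using (^-distrib-*)
    x≉0 : x ≉ 0
    x≉0 x≈0 = a≉0 (trans (sym xx≈a) (trans (*-congʳ {x} x≈0) (zeroˡ x)))

  -- Links the integer values 0, 1, -1 of the Legendre symbol to residues modulo p. The relation is
  -- multiplicative, so Euler's criterion passes from the symbol of one value to products of
  -- symbols.
  data SignOf : ℤ → ℕ → Set where
    zero  : ∀ {b} → b ≈ₚ 0 → SignOf (+ 0) b
    plus  : ∀ {b} → b ≈ₚ 1 → SignOf (+ 1) b
    minus : ∀ {b} → b ≈ₚ - 1 → SignOf -[1+ 0 ] b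

  SignOf-cong : ∀ {z b c} → b ≈ₚ c → SignOf z b → SignOf z c
  SignOf-cong q (zero r)  = zero (trans (sym q) r)
  SignOf-cong q (plus r)  = plus (trans (sym q) r)
  SignOf-cong q (minus r) = minus (trans (sym q) r)

  SignOf-* : ∀ {y z b c} → SignOf y b → SignOf z c → SignOf (y ℤ.* z) (b * c)
  SignOf-* {z = z} {b} {c} (zero q) s =
    ≡.subst (λ t → SignOf t (b * c)) (≡.sym (ℤP.*-zeroˡ z)) (zero (trans (*-congʳ {c} q) (zeroˡ c)))
  SignOf-* {b = b} (plus q)  (zero r)  = zero (trans (*-congˡ {b} r) (zeroʳ b))
  SignOf-* {b = b} (minus q) (zero r)  = zero (trans (*-congˡ {b} r) (zeroʳ b))
  SignOf-* (plus q)  (plus r)  = plus (*-cong q r)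
  SignOf-* {c = c} (plus q)  (minus r) = minus (trans (*-cong q r) (*-identityˡ (- 1)))
  SignOf-* (minus q) (plus r)  = minus (trans (*-cong q r) (*-identityʳ (- 1)))
  SignOf-* (minus q) (minus r) = plus (trans (*-cong q r) (trans (-1*x≈-x (- 1)) (⁻¹-involutive 1)))
    where
    open import Algebra.Properties.Ring ring using (-1*x≈-x)
    open import Algebra.Properties.AbelianGroup +-abelianGroup using (⁻¹-involutive)

  private
    squareTest : ℕ → ℕ → Bool
    squareTest a x = ((x ℕ.* x) DM.% p) ≡ᵇ (a DM.% p)

  isSquareMod-true : ∀ a → isSquareMod p a ≡ true → ∃[ x ] x * x ≈ₚ a
  isSquareMod-true a eq with Any.satisfied (AnyP.any⁻ (squareTest a) (upTo p) (Equivalence.from T-≡ eq))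
  ... | x , t = x , residues (ℕP.≡ᵇ⇒≡ _ _ t)

  isSquareMod-false : ∀ a → isSquareMod p a ≡ false → ∀ x → ¬ x * x ≈ₚ a
  isSquareMod-false a eq x xx≈a = absurd (≡.trans (≡.sym eq) (Equivalence.to T-≡
      (AnyP.any⁺ (squareTest a) (lose (∈-upTo⁺ (DM.m%n<n x p)) (ℕP.≡⇒≡ᵇ _ _ (same rr≈a))))))
    where
    r = x DM.% p
    rr≈a : r * r ≈ₚ a
    rr≈a = trans (*-cong (reduce x) (reduce x)) xx≈a
    absurd : ¬ false ≡ true
    absurd ()

  legendre-sign : ∀ a → SignOf (legendre p a) (a ^ h)
  legendre-sign a with (a DM.% p) ≡ᵇ 0 in eq₀
  ... | true  = zero (trans (^-congˡ h (residues (ℕP.≡ᵇ⇒≡ _ _ (Equivalence.from T-≡ eq₀)))) (0^ h 1≤h))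
  ... | false with isSquareMod p a in eq₁
  ...   | true  = plus (eulerResidue a (proj₁ root) (proj₂ root) a≉0)
    where
    root = isSquareMod-true a eq₁
    a≉0 : a ≉ 0
    a≉0 q = ≡.subst T eq₀ (ℕP.≡⇒≡ᵇ _ _ (same q))
  ...   | false = minus (eulerNonresidue a (isSquareMod-false a eq₁))

-- Pigeonhole for maps between finite coordinate spaces.

funToFin-cong : ∀ {m n} {φ ψ : Fin m → Fin n} → (∀ i → φ i ≡ ψ i) → funToFin φ ≡ funToFin ψ
funToFin-cong {zero}  eq = ≡.refl
funToFin-cong {suc m} eq = ≡.cong₂ combine (eq Fin.zero) (funToFin-cong (eq ∘ Fin.suc))

-- Replaces linear algebra: over a finite field, a map into fewer coordinates is not injective.
collision : ∀ {n U E} → 1 ℕ.< n → E ℕ.< U → (φ : (Fin U → Fin n) → (Fin E → Fin n)) →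
            ∃[ w ] ∃[ w′ ] ((∃[ i ] w i ≢ w′ i) × (∀ r → φ w r ≡ φ w′ r))
collision {n} {U} {E} 1<n E<U φ = fromPigeons
  (FinP.pigeonhole (ℕP.^-monoʳ-< n 1<n E<U) (λ i → funToFin (φ (finToFun i))))
  where
  fromPigeons : (∃[ i ] ∃[ j ] (i Fin.< j × funToFin (φ (finToFun i)) ≡ funToFin (φ (finToFun j)))) →
                ∃[ w ] ∃[ w′ ] ((∃[ i ] w i ≢ w′ i) × (∀ r → φ w r ≡ φ w′ r))
  fromPigeons (i , j , i<j , eq) = finToFun i , finToFun j ,
    FinP.¬∀⟶∃¬ U (λ r → finToFun i r ≡ finToFun j r) (λ r → finToFun i r FinP.≟ finToFun j r)
      (λ same → FinP.<-irrefl (≡.trans (≡.sym (FinP.funToFin-finToFin {U} {n} i))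
        (≡.trans (funToFin-cong same) (FinP.funToFin-finToFin {U} {n} j))) i<j) ,
    λ r → ≡.trans (≡.sym (FinP.finToFun-funToFin (φ (finToFun i)) r))
      (≡.trans (≡.cong (λ k → finToFun k r) eq) (FinP.finToFun-funToFin (φ (finToFun j)) r))

-- Stepanov's method.

module Stepanov (h : ℕ) (isPrime : Prime (suc (h ℕ.+ h))) where
  open PrimeField h isPrime
  open CommutativeRing primeRing hiding (zero; +-rawMagma)

  -- The sum of Y^j t_j. `Y` is a parameter because X^p is replaced by X when values at points of
  -- the prime field are taken.
  horner : Polynomial → ∀ {J} → (Fin J → Polynomial) → Polynomial
  horner Y {zero}  t = []
  horner Y {suc J} t = t Fin.zero ⊕ Y ⊗ horner Y (t ∘ Fin.suc)

  horner-cong : ∀ Y {J} {t t′ : Fin J → Polynomial} → (∀ j → t j ≋ t′ j) → horner Y t ≋ horner Y t′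
  horner-cong Y {zero}  eq = ≋-refl
  horner-cong Y {suc J} eq = ⊕-cong (eq Fin.zero) (⊗-congˡ {Y} (horner-cong Y (eq ∘ Fin.suc)))

  horner-⊝ : ∀ Y {J} (t t′ : Fin J → Polynomial) → horner Y (λ j → t j ⊝ t′ j) ≋ horner Y t ⊝ horner Y t′
  horner-⊝ Y {zero}  t t′ = ≋-sym (⊝-inverse [])
  horner-⊝ Y {suc J} t t′ = begin
    (t₀ ⊝ t₀′) ⊕ Y ⊗ horner Y (λ j → t (Fin.suc j) ⊝ t′ (Fin.suc j))
      ≈⟨ ⊕-congˡ {t₀ ⊝ t₀′} (⊗-congˡ {Y} (horner-⊝ Y (t ∘ Fin.suc) (t′ ∘ Fin.suc))) ⟩
    (t₀ ⊝ t₀′) ⊕ Y ⊗ (Z ⊝ Z′)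
      ≈⟨ solve 5 (λ a b y z z′ → (a :- b) :+ y :* (z :- z′) := (a :+ y :* z) :- (b :+ y :* z′)) ≋-refl t₀ t₀′ Y Z Z′ ⟩
    (t₀ ⊕ Y ⊗ Z) ⊝ (t₀′ ⊕ Y ⊗ Z′) ∎
    where
    open P-Reasoning
    open PSolver
    t₀ = t Fin.zero
    t₀′ = t′ Fin.zero
    Z = horner Y (t ∘ Fin.suc)
    Z′ = horner Y (t′ ∘ Fin.suc)

  horner-⊗ : ∀ Y G {J} (t : Fin J → Polynomial) → G ⊗ horner Y t ≋ horner Y (λ j → G ⊗ t j)
  horner-⊗ Y G {zero}  t = ⊗-zeroʳ G
  horner-⊗ Y G {suc J} t = begin
    G ⊗ (t Fin.zero ⊕ Y ⊗ horner Y (t ∘ Fin.suc))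
      ≈⟨ solve 4 (λ g a y z → g :* (a :+ y :* z) := g :* a :+ y :* (g :* z)) ≋-refl G (t Fin.zero) Y (horner Y (t ∘ Fin.suc)) ⟩
    G ⊗ t Fin.zero ⊕ Y ⊗ (G ⊗ horner Y (t ∘ Fin.suc))
      ≈⟨ ⊕-congˡ {G ⊗ t Fin.zero} (⊗-congˡ {Y} (horner-⊗ Y G (t ∘ Fin.suc))) ⟩
    G ⊗ t Fin.zero ⊕ Y ⊗ horner Y (λ j → G ⊗ t (Fin.suc j)) ∎
    where
    open P-Reasoning
    open PSolver

  horner-⊕ : ∀ Y {J} (t t′ : Fin J → Polynomial) → horner Y (λ j → t j ⊕ t′ j) ≋ horner Y t ⊕ horner Y t′
  horner-⊕ Y {zero}  t t′ = ≋-sym (⊕-identityʳ [])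
  horner-⊕ Y {suc J} t t′ = begin
    (t₀ ⊕ t₀′) ⊕ Y ⊗ horner Y (λ j → t (Fin.suc j) ⊕ t′ (Fin.suc j))
      ≈⟨ ⊕-congˡ {t₀ ⊕ t₀′} (⊗-congˡ {Y} (horner-⊕ Y (t ∘ Fin.suc) (t′ ∘ Fin.suc))) ⟩
    (t₀ ⊕ t₀′) ⊕ Y ⊗ (Z ⊕ Z′)
      ≈⟨ solve 5 (λ a b y z z′ → (a :+ b) :+ y :* (z :+ z′) := (a :+ y :* z) :+ (b :+ y :* z′)) ≋-refl t₀ t₀′ Y Z Z′ ⟩
    (t₀ ⊕ Y ⊗ Z) ⊕ (t₀′ ⊕ Y ⊗ Z′) ∎
    where
    open P-Reasoning
    open PSolver
    t₀ = t Fin.zero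
    t₀′ = t′ Fin.zero
    Z = horner Y (t ∘ Fin.suc)
    Z′ = horner Y (t′ ∘ Fin.suc)

  -- A polynomial with zero derivative behaves like a constant. This is the advantage of X^p: it
  -- raises the degree of the auxiliary polynomial but is invisible to differentiation.
  D-horner : ∀ Y → D Y ≋ [] → ∀ {J} (t : Fin J → Polynomial) → D (horner Y t) ≋ horner Y (D ∘ t)
  D-horner Y DY {zero}  t = ≋-refl
  D-horner Y DY {suc J} t = begin
    D (t Fin.zero ⊕ Y ⊗ Z)                          ≈⟨ D-⊕ (t Fin.zero) (Y ⊗ Z) ⟩
    D (t Fin.zero) ⊕ D (Y ⊗ Z)                      ≈⟨ ⊕-congˡ {D (t Fin.zero)} (D-⊗ Y Z) ⟩
    D (t Fin.zero) ⊕ (D Y ⊗ Z ⊕ Y ⊗ D Z)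
      ≈⟨ ⊕-congˡ {D (t Fin.zero)} (⊕-cong (≋-trans (⊗-congʳ {Z} DY) (⊗-zeroˡ Z)) (⊗-congˡ {Y} (D-horner Y DY (t ∘ Fin.suc)))) ⟩
    D (t Fin.zero) ⊕ ([] ⊕ Y ⊗ horner Y (D ∘ t ∘ Fin.suc))
      ≈⟨ ⊕-congˡ {D (t Fin.zero)} (⊕-identityˡ _) ⟩
    D (t Fin.zero) ⊕ Y ⊗ horner Y (D ∘ t ∘ Fin.suc) ∎
    where
    open P-Reasoning
    Z = horner Y (t ∘ Fin.suc)

  deg-horner : ∀ {Y y n} → Deg< (suc y) Y → ∀ {J} {t : Fin J → Polynomial} → (∀ j → Deg< n (t j)) →
               Deg< (J ℕ.* y ℕ.+ n) (horner Y t)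
  deg-horner dY {zero}  dt = deg-[]
  deg-horner {y = y} {n} dY {suc J} dt =
    deg-⊕ (deg-mono (ℕP.m≤n+m n (suc J ℕ.* y)) (dt Fin.zero))
      (deg-mono (ℕP.≤-reflexive (≡.sym (ℕP.+-assoc y (J ℕ.* y) n))) (deg-⊗ {y} dY (deg-horner dY (dt ∘ Fin.suc))))

  eval-horner : ∀ Y Y′ x → eval Y x ≈ₚ eval Y′ x → ∀ {J} {t t′ : Fin J → Polynomial} →
                (∀ j → eval (t j) x ≈ₚ eval (t′ j) x) → eval (horner Y t) x ≈ₚ eval (horner Y′ t′) x
  eval-horner Y Y′ x eqY {zero}  eq = refl
  eval-horner Y Y′ x eqY {suc J} {t} {t′} eq = begin
    eval (t Fin.zero ⊕ Y ⊗ Z) x               ≈⟨ trans (eval-⊕ (t Fin.zero) (Y ⊗ Z) x) (+-congˡ {eval (t Fin.zero) x} (eval-⊗ Y Z x)) ⟩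
    eval (t Fin.zero) x + eval Y x * eval Z x
      ≈⟨ +-cong (eq Fin.zero) (*-cong {eval Y x} {eval Y′ x} eqY (eval-horner Y Y′ x eqY (eq ∘ Fin.suc))) ⟩
    eval (t′ Fin.zero) x + eval Y′ x * eval Z′ x
      ≈⟨ trans (eval-⊕ (t′ Fin.zero) (Y′ ⊗ Z′) x) (+-congˡ {eval (t′ Fin.zero) x} (eval-⊗ Y′ Z′ x)) ⟨
    eval (t′ Fin.zero ⊕ Y′ ⊗ Z′) x            ∎
    where
    open K-Reasoning
    Z = horner Y (t ∘ Fin.suc)
    Z′ = horner Y′ (t′ ∘ Fin.suc)

  Xᵖ : Polynomial
  Xᵖ = X ^ₚ p

  degree-X : Degree X 1
  degree-X = degree 1≉0 deg-lin

  degree-Xᵖ : Degree Xᵖ p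
  degree-Xᵖ = ≡.subst (Degree Xᵖ) (ℕP.*-identityʳ p) (degree-^ p degree-X)

  eval-Xᵖ : ∀ x → eval Xᵖ x ≈ₚ eval X x
  eval-Xᵖ x = trans (eval-^ X p x) (fermat (eval X x))

  lowZero⇒X^∣ : ∀ n F → (∀ i → i ℕ.< n → coefficient F i ≈ₚ 0) → X ^ₚ n ∣ F
  lowZero⇒X^∣ zero    F       z = F , ≋-sym (⊗-identityˡ F)
  lowZero⇒X^∣ (suc n) []      z = [] , ≋-sym (⊗-zeroʳ (X ^ₚ suc n))
  lowZero⇒X^∣ (suc n) (a ∷ F) z with lowZero⇒X^∣ n F (λ i i<n → z (suc i) (s≤s i<n))
  ... | H , q = H , (begin
      a ∷ F                      ≈⟨ ∷-cong (z 0 (s≤s z≤n)) q ⟩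
      0 ∷ (X ^ₚ n ⊗ H)           ≈⟨ X⊗ (X ^ₚ n ⊗ H) ⟩
      X ⊗ (X ^ₚ n ⊗ H)           ≈⟨ ⊗-assoc X (X ^ₚ n) H ⟨
      X ^ₚ suc n ⊗ H             ∎)
      where open P-Reasoning

  D-⊝ : ∀ F G → D (F ⊝ G) ≋ D F ⊝ D G
  D-⊝ F G = ≋-trans (D-⊕ F (⊖ G)) (⊕-congˡ {D F} (inverseʳ-unique (D G) (D (⊖ G))
    (≋-trans (≋-sym (D-⊕ G (⊖ G))) (D-cong (⊝-inverse G)))))
    where open import Algebra.Properties.AbelianGroup (CommutativeRing.+-abelianGroup polyRing) using (inverseʳ-unique)

  D^-cong : ∀ k {F G} → F ≋ G → D^ k F ≋ D^ k G
  D^-cong zero    p = p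
  D^-cong (suc k) p = D^-cong k (D-cong p)

  deg-N : ∀ n → Deg< 1 (N n)
  deg-N n = deg-cong (≋-sym (N-C n)) deg-C

  module Auxiliary (f : Polynomial) (q : ℕ) (bounded-f : Deg< (suc q) f) where

    g : Polynomial
    g = f ^ₚ h

    -- The operator for which the derivative of f^e u is f^(e-1) times `∂ e u`.
    ∂ : ℕ → Polynomial → Polynomial
    ∂ e u = f ⊗ D u ⊕ N e ⊗ (D f ⊗ u)

    ∂-⊝ : ∀ e u u′ → ∂ e (u ⊝ u′) ≋ ∂ e u ⊝ ∂ e u′
    ∂-⊝ e u u′ = begin
      f ⊗ D (u ⊝ u′) ⊕ N e ⊗ (D f ⊗ (u ⊝ u′))
        ≈⟨ ⊕-congʳ {N e ⊗ (D f ⊗ (u ⊝ u′))} (⊗-congˡ {f} (D-⊝ u u′)) ⟩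
      f ⊗ (D u ⊝ D u′) ⊕ N e ⊗ (D f ⊗ (u ⊝ u′))
        ≈⟨ solve 7 (λ f a b n f′ u u′ → f :* (a :- b) :+ n :* (f′ :* (u :- u′)) :=
              (f :* a :+ n :* (f′ :* u)) :- (f :* b :+ n :* (f′ :* u′))) ≋-refl f (D u) (D u′) (N e) (D f) u u′ ⟩
      ∂ e u ⊝ ∂ e u′ ∎
      where
      open P-Reasoning
      open PSolver

    ∂-cong : ∀ e {u u′} → u ≋ u′ → ∂ e u ≋ ∂ e u′
    ∂-cong e eq = ⊕-cong (⊗-congˡ {f} (D-cong eq)) (⊗-congˡ {N e} (⊗-congˡ {D f} eq))

    deg-∂ : ∀ {n u} e → Deg< n u → Deg< (q ℕ.+ n) (∂ e u)
    deg-∂ e du = deg-⊕ (deg-⊗ {q} bounded-f (deg-D du)) (deg-⊗ {0} (deg-N e) (deg-⊗ {q} (deg-D bounded-f) du))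

    -- The cofactor of f ^ (e + s - k) in the k-th derivative of f ^ (e + s) u, for s = 0 or s = h
    -- (a junk value if k > e).
    iterate∂ : ℕ → ℕ → ℕ → Polynomial → Polynomial
    iterate∂ s e       zero    u = u
    iterate∂ s zero    (suc k) u = []
    iterate∂ s (suc e) (suc k) u = iterate∂ s e k (∂ (suc e ℕ.+ s) u)

    iterate∂-cong : ∀ s e k {u u′} → u ≋ u′ → iterate∂ s e k u ≋ iterate∂ s e k u′
    iterate∂-cong s e       zero    eq = eq
    iterate∂-cong s zero    (suc k) eq = ≋-refl
    iterate∂-cong s (suc e) (suc k) eq = iterate∂-cong s e k (∂-cong (suc e ℕ.+ s) eq)

    iterate∂-⊝ : ∀ s e k u u′ → iterate∂ s e k (u ⊝ u′) ≋ iterate∂ s e k u ⊝ iterate∂ s e k u′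
    iterate∂-⊝ s e       zero    u u′ = ≋-refl
    iterate∂-⊝ s zero    (suc k) u u′ = ≋-sym (⊝-inverse [])
    iterate∂-⊝ s (suc e) (suc k) u u′ = ≋-trans (iterate∂-cong s e k (∂-⊝ (suc e ℕ.+ s) u u′))
      (iterate∂-⊝ s e k (∂ (suc e ℕ.+ s) u) (∂ (suc e ℕ.+ s) u′))

    deg-iterate∂ : ∀ s e k {n u} → Deg< n u → Deg< (k ℕ.* q ℕ.+ n) (iterate∂ s e k u)
    deg-iterate∂ s e       zero    du = du
    deg-iterate∂ s zero    (suc k) du = deg-[]
    deg-iterate∂ s (suc e) (suc k) {n} du = deg-mono (ℕP.≤-reflexive rearranged)
      (deg-iterate∂ s e k (deg-∂ (suc e ℕ.+ s) du))
      where
      rearranged : k ℕ.* q ℕ.+ (q ℕ.+ n) ≡ suc k ℕ.* q ℕ.+ n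
      rearranged = ≡.trans (≡.sym (ℕP.+-assoc (k ℕ.* q) q n)) (≡.cong (ℕ._+ n) (ℕP.+-comm (k ℕ.* q) q))

    combination : ∀ {J} → (u v : Fin J → Polynomial) → Fin J → Polynomial
    combination u v j = u j ⊕ v j ⊗ g

    -- As g = f^h, the second summand is f^(e+1+h) v and is differentiated with the exponent e + 1 +
    -- h in place of e + 1. So the derivative has the same shape as the original, with one power of
    -- f less and new coefficients of controlled degree.
    D-step : ∀ e {J} (u v : Fin J → Polynomial) →
             D (f ^ₚ suc e ⊗ horner Xᵖ (combination u v)) ≋
             f ^ₚ e ⊗ horner Xᵖ (combination (∂ (suc e ℕ.+ 0) ∘ u) (∂ (suc e ℕ.+ h) ∘ v))
    D-step e {J} u v = begin
      D (f ^ₚ suc e ⊗ Z)                                  ≈⟨ D-⊗ (f ^ₚ suc e) Z ⟩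
      D (f ^ₚ suc e) ⊗ Z ⊕ f ^ₚ suc e ⊗ D Z
        ≈⟨ ⊕-cong (⊗-congʳ {Z} (D-^ f e)) (⊗-congˡ {f ^ₚ suc e} (D-horner Xᵖ (D-^p X) (combination u v))) ⟩
      (N (suc e) ⊗ (f ^ₚ e ⊗ D f)) ⊗ Z ⊕ f ^ₚ suc e ⊗ horner Xᵖ (D ∘ combination u v)
        ≈⟨ solve 6 (λ n fe f′ z f w → (n :* (fe :* f′)) :* z :+ (f :* fe) :* w := fe :* ((n :* f′) :* z :+ f :* w))
                ≋-refl (N (suc e)) (f ^ₚ e) (D f) Z f (horner Xᵖ (D ∘ combination u v)) ⟩
      f ^ₚ e ⊗ ((N (suc e) ⊗ D f) ⊗ Z ⊕ f ⊗ horner Xᵖ (D ∘ combination u v))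
        ≈⟨ ⊗-congˡ {f ^ₚ e} (⊕-cong (horner-⊗ Xᵖ (N (suc e) ⊗ D f) (combination u v)) (horner-⊗ Xᵖ f (D ∘ combination u v))) ⟩
      f ^ₚ e ⊗ (horner Xᵖ (λ j → (N (suc e) ⊗ D f) ⊗ combination u v j) ⊕ horner Xᵖ (λ j → f ⊗ D (combination u v j)))
        ≈⟨ ⊗-congˡ {f ^ₚ e} (horner-⊕ Xᵖ (λ j → (N (suc e) ⊗ D f) ⊗ combination u v j) (λ j → f ⊗ D (combination u v j))) ⟨
      f ^ₚ e ⊗ horner Xᵖ (λ j → (N (suc e) ⊗ D f) ⊗ combination u v j ⊕ f ⊗ D (combination u v j))
        ≈⟨ ⊗-congˡ {f ^ₚ e} (horner-cong Xᵖ (λ j → coefficientStep (u j) (v j))) ⟩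
      f ^ₚ e ⊗ horner Xᵖ (combination (∂ (suc e ℕ.+ 0) ∘ u) (∂ (suc e ℕ.+ h) ∘ v)) ∎
      where
      open P-Reasoning
      open PSolver
      open import Algebra.Properties.Monoid.Mult (CommutativeRing.+-monoid polyRing) using (×-homo-+)
      Z = horner Xᵖ (combination u v)
      n = N (suc e)
      coefficientStep : ∀ a b → (n ⊗ D f) ⊗ (a ⊕ b ⊗ g) ⊕ f ⊗ D (a ⊕ b ⊗ g) ≋
                                ∂ (suc e ℕ.+ 0) a ⊕ ∂ (suc e ℕ.+ h) b ⊗ g
      coefficientStep a b = begin
        (n ⊗ D f) ⊗ (a ⊕ b ⊗ g) ⊕ f ⊗ D (a ⊕ b ⊗ g)
          ≈⟨ ⊕-congˡ {(n ⊗ D f) ⊗ (a ⊕ b ⊗ g)} (⊗-congˡ {f} (≋-trans (D-⊕ a (b ⊗ g)) (⊕-congˡ {D a} (D-⊗ b g)))) ⟩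
        (n ⊗ D f) ⊗ (a ⊕ b ⊗ g) ⊕ f ⊗ (D a ⊕ (D b ⊗ g ⊕ b ⊗ D g))
          ≈⟨ solve 9 (λ n f′ a b g f a′ b′ g′ → (n :* f′) :* (a :+ b :* g) :+ f :* (a′ :+ (b′ :* g :+ b :* g′)) :=
                (f :* a′ :+ n :* (f′ :* a)) :+ ((f :* b′ :+ n :* (f′ :* b)) :* g :+ b :* (f :* g′)))
                ≋-refl n (D f) a b g f (D a) (D b) (D g) ⟩
        (f ⊗ D a ⊕ n ⊗ (D f ⊗ a)) ⊕ ((f ⊗ D b ⊕ n ⊗ (D f ⊗ b)) ⊗ g ⊕ b ⊗ (f ⊗ D g))
          ≈⟨ ⊕-congˡ {f ⊗ D a ⊕ n ⊗ (D f ⊗ a)} (⊕-congˡ {(f ⊗ D b ⊕ n ⊗ (D f ⊗ b)) ⊗ g} (⊗-congˡ {b} (⊗D-^ f h))) ⟩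
        (f ⊗ D a ⊕ n ⊗ (D f ⊗ a)) ⊕ ((f ⊗ D b ⊕ n ⊗ (D f ⊗ b)) ⊗ g ⊕ b ⊗ (N h ⊗ (g ⊗ D f)))
          ≈⟨ solve 8 (λ n f′ a b g f r t → (r :+ n :* (f′ :* a)) :+ ((f :+ n :* (f′ :* b)) :* g :+ b :* (t :* (g :* f′))) :=
                (r :+ n :* (f′ :* a)) :+ (f :+ (n :+ t) :* (f′ :* b)) :* g)
                ≋-refl n (D f) a b g (f ⊗ D b) (f ⊗ D a) (N h) ⟩
        (f ⊗ D a ⊕ n ⊗ (D f ⊗ a)) ⊕ (f ⊗ D b ⊕ (n ⊕ N h) ⊗ (D f ⊗ b)) ⊗ g
          ≈⟨ ⊕-cong (⊕-congˡ {f ⊗ D a} (⊗-congʳ {D f ⊗ a} (≋-reflexive (≡.cong N (≡.sym (ℕP.+-identityʳ (suc e)))))))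
                    (⊗-congʳ {g} (⊕-congˡ {f ⊗ D b} (⊗-congʳ {D f ⊗ b} (≋-sym (×-homo-+ 𝟙 (suc e) h))))) ⟩
        ∂ (suc e ℕ.+ 0) a ⊕ ∂ (suc e ℕ.+ h) b ⊗ g ∎
        where
        ≋-reflexive : ∀ {F G} → F ≡ G → F ≋ G
        ≋-reflexive ≡.refl = ≋-refl

    D^-auxiliary : ∀ k e {J} (u v : Fin J → Polynomial) → k ℕ.≤ e →
                   D^ k (f ^ₚ e ⊗ horner Xᵖ (combination u v)) ≋
                   f ^ₚ (e ℕ.∸ k) ⊗ horner Xᵖ (combination (iterate∂ 0 e k ∘ u) (iterate∂ h e k ∘ v))
    D^-auxiliary zero    e       u v _         = ≋-refl
    D^-auxiliary (suc k) (suc e) u v (s≤s k≤e) = ≋-trans (D^-cong k (D-step e u v))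
      (D^-auxiliary k e (∂ (suc e ℕ.+ 0) ∘ u) (∂ (suc e ℕ.+ h) ∘ v) k≤e)

    -- The cofactor in the k-th derivative after replacing X^p by X and g by α, which does not alter
    -- its value at a point x with f(x)^h = α. The degree has become small, so asking for it to
    -- vanish identically costs few conditions.
    reduced : ℕ → ℕ → ℕ → ∀ {J} (u v : Fin J → Polynomial) → Polynomial
    reduced α M k u v = horner X (λ j → iterate∂ 0 M k (u j) ⊕ C α ⊗ iterate∂ h M k (v j))

    reduced-⊝ : ∀ α M k {J} (u v u′ v′ : Fin J → Polynomial) →
                reduced α M k (λ j → u j ⊝ u′ j) (λ j → v j ⊝ v′ j) ≋ reduced α M k u v ⊝ reduced α M k u′ v′
    reduced-⊝ α M k u v u′ v′ = ≋-trans (horner-cong X λ j → begin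
        I 0 (u j ⊝ u′ j) ⊕ C α ⊗ I h (v j ⊝ v′ j)
          ≈⟨ ⊕-cong (iterate∂-⊝ 0 M k (u j) (u′ j)) (⊗-congˡ {C α} (iterate∂-⊝ h M k (v j) (v′ j))) ⟩
        (I 0 (u j) ⊝ I 0 (u′ j)) ⊕ C α ⊗ (I h (v j) ⊝ I h (v′ j))
          ≈⟨ solve 5 (λ a b c d e → (a :- b) :+ e :* (c :- d) := (a :+ e :* c) :- (b :+ e :* d))
                  ≋-refl (I 0 (u j)) (I 0 (u′ j)) (I h (v j)) (I h (v′ j)) (C α) ⟩
        (I 0 (u j) ⊕ C α ⊗ I h (v j)) ⊝ (I 0 (u′ j) ⊕ C α ⊗ I h (v′ j)) ∎)
      (horner-⊝ X (λ j → I 0 (u j) ⊕ C α ⊗ I h (v j)) (λ j → I 0 (u′ j) ⊕ C α ⊗ I h (v′ j)))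
      where
      open P-Reasoning
      open PSolver
      I : ℕ → Polynomial → Polynomial
      I s = iterate∂ s M k

    deg-reduced : ∀ α M k {J n} {u v : Fin J → Polynomial} → k ℕ.≤ M → (∀ j → Deg< n (u j)) → (∀ j → Deg< n (v j)) →
                  Deg< (J ℕ.* 1 ℕ.+ (M ℕ.* q ℕ.+ n)) (reduced α M k u v)
    deg-reduced α M k {n = n} k≤M du dv = deg-horner deg-lin (λ j → deg-⊕ (small 0 (du j)) (deg-⊗ {0} deg-C (small h (dv j))))
      where
      small : ∀ s {w} → Deg< n w → Deg< (M ℕ.* q ℕ.+ n) (iterate∂ s M k w)
      small s dw = deg-mono (ℕP.+-monoˡ-≤ n (ℕP.*-monoˡ-≤ q k≤M)) (deg-iterate∂ s M k dw)

    derivativesVanish : ∀ α M {J} (u v : Fin J → Polynomial) → (∀ k → k ℕ.< M → reduced α M k u v ≋ []) →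
                        ∀ x → eval f x ^ h ≈ₚ α →
                        ∀ k → k ℕ.< M → eval (D^ k (f ^ₚ M ⊗ horner Xᵖ (combination u v))) x ≈ₚ 0
    derivativesVanish α M u v z x fxʰ k k<M = begin
      eval (D^ k (f ^ₚ M ⊗ horner Xᵖ (combination u v))) x
        ≈⟨ eval-cong x (D^-auxiliary k M u v (ℕP.<⇒≤ k<M)) ⟩
      eval (f ^ₚ (M ℕ.∸ k) ⊗ Z) x                     ≈⟨ eval-⊗ (f ^ₚ (M ℕ.∸ k)) Z x ⟩
      c * eval Z x
        ≈⟨ *-congˡ {c} (eval-horner Xᵖ X x (eval-Xᵖ x) (λ j → pointwise (iterate∂ 0 M k (u j)) (iterate∂ h M k (v j)))) ⟩
      c * eval (reduced α M k u v) x                  ≈⟨ *-congˡ {c} (eval-zero x (z k k<M)) ⟩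
      c * 0                                           ≈⟨ zeroʳ c ⟩
      0                                               ∎
      where
      open K-Reasoning
      Z = horner Xᵖ (combination (iterate∂ 0 M k ∘ u) (iterate∂ h M k ∘ v))
      c = eval (f ^ₚ (M ℕ.∸ k)) x
      pointwise : ∀ a b → eval (a ⊕ b ⊗ g) x ≈ₚ eval (a ⊕ C α ⊗ b) x
      pointwise a b = begin
        eval (a ⊕ b ⊗ g) x              ≈⟨ trans (eval-⊕ a (b ⊗ g) x) (+-congˡ {eval a x} (eval-⊗ b g x)) ⟩
        eval a x + eval b x * eval g x
          ≈⟨ +-congˡ {eval a x} (trans (*-congˡ {eval b x} (trans (eval-^ f h x) fxʰ)) (*-comm (eval b x) α)) ⟩
        eval a x + α * eval b x         ≈⟨ +-congˡ {eval a x} (*-congʳ {eval b x} (eval-C α x)) ⟨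
        eval a x + eval (C α) x * eval b x
          ≈⟨ trans (eval-⊕ a (C α ⊗ b) x) (+-congˡ {eval a x} (eval-⊗ (C α) b x)) ⟨
        eval (a ⊕ C α ⊗ b) x            ∎

    module Bound
      (b : ℕ) (room : suc b ℕ.+ suc b ℕ.+ q ℕ.≤ p)
      (f₀≉0 : eval f 0 ≉ 0)
      (nonsquare : ∀ u v → Deg< (suc b) u → u ⊗ u ⊗ f ≋ C (eval f 0) ⊗ (v ⊗ v) → u ≋ []) where

      private
        c = eval f 0

      gg⊗f : g ⊗ g ⊗ f ≋ f ^ₚ p
      gg⊗f = ≋-trans (⊗-comm (g ⊗ g) f) (⊗-congˡ {f} (≋-sym (^-homo-* f h h)))
        where open import Algebra.Properties.Semiring.Exp (CommutativeRing.semiring polyRing) using (^-homo-*)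

      Xᵖ∣fᵖ-c : Xᵖ ∣ f ^ₚ p ⊝ C c
      Xᵖ∣fᵖ-c = lowZero⇒X^∣ p (f ^ₚ p ⊝ C c) λ i i<p → begin
        coefficient (f ^ₚ p ⊝ C c) i                        ≈⟨ coefficient-⊕ (f ^ₚ p) (⊖ C c) i ⟩
        coefficient (f ^ₚ p) i + coefficient (⊖ C c) i      ≈⟨ +-cong (frobenius f i i<p) (coefficient-⊖ (C c) i) ⟩
        coefficient (C c) i - coefficient (C c) i           ≈⟨ -‿inverseʳ (coefficient (C c) i) ⟩
        0                                                   ∎
        where open K-Reasoning

      -- u + v g ≡ 0 mod Xᵖ gives u² f ≡ v² fᵖ ≡ f(0) v² mod Xᵖ, an equality for reasons of degree.
      independent : ∀ u v → Deg< (suc b) u → Deg< (suc b) v → Xᵖ ∣ u ⊕ v ⊗ g → u ≋ [] × v ≋ []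
      independent u v du dv low = u≋0 , v≋0
        where
        difference : u ⊗ u ⊗ f ⊝ C c ⊗ (v ⊗ v) ≋ (u ⊕ v ⊗ g) ⊗ ((u ⊝ v ⊗ g) ⊗ f) ⊕ (f ^ₚ p ⊝ C c) ⊗ (v ⊗ v)
        difference = begin
          u ⊗ u ⊗ f ⊝ C c ⊗ (v ⊗ v)
            ≈⟨ solve 5 (λ u v g f c → u :* u :* f :- c :* (v :* v) :=
                  (u :+ v :* g) :* ((u :- v :* g) :* f) :+ (g :* g :* f :- c) :* (v :* v)) ≋-refl u v g f (C c) ⟩
          (u ⊕ v ⊗ g) ⊗ ((u ⊝ v ⊗ g) ⊗ f) ⊕ (g ⊗ g ⊗ f ⊝ C c) ⊗ (v ⊗ v)
            ≈⟨ ⊕-congˡ {(u ⊕ v ⊗ g) ⊗ ((u ⊝ v ⊗ g) ⊗ f)} (⊗-congʳ {v ⊗ v} (⊕-congʳ {⊖ C c} gg⊗f)) ⟩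
          (u ⊕ v ⊗ g) ⊗ ((u ⊝ v ⊗ g) ⊗ f) ⊕ (f ^ₚ p ⊝ C c) ⊗ (v ⊗ v) ∎
          where
          open P-Reasoning
          open PSolver
        divisible : Xᵖ ∣ u ⊗ u ⊗ f ⊝ C c ⊗ (v ⊗ v)
        divisible = ∣-cong {Xᵖ} (≋-sym difference) (∣-⊕ {Xᵖ} (∣-⊗ʳ {Xᵖ} ((u ⊝ v ⊗ g) ⊗ f) low) (∣-⊗ʳ {Xᵖ} (v ⊗ v) Xᵖ∣fᵖ-c))
        b+B≤p : b ℕ.+ suc b ℕ.+ q ℕ.≤ p
        b+B≤p = ℕP.≤-trans (ℕP.n≤1+n _) room
        low-degree : Deg< p (u ⊗ u ⊗ f ⊝ C c ⊗ (v ⊗ v))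
        low-degree = deg-⊕
          (deg-mono (ℕP.≤-trans (ℕP.≤-reflexive (ℕP.+-comm q (b ℕ.+ suc b))) b+B≤p)
            (deg-cong (⊗-comm f (u ⊗ u)) (deg-⊗ {q} bounded-f (deg-⊗ {b} du du))))
          (deg-⊖ (deg-mono (ℕP.≤-trans (ℕP.m≤m+n (b ℕ.+ suc b) q) b+B≤p) (deg-⊗ {0} deg-C (deg-⊗ {b} dv dv))))
        uuf≋cvv : u ⊗ u ⊗ f ≋ C c ⊗ (v ⊗ v)
        uuf≋cvv = ⊝≋0⇒≋ _ _ (∣-low⇒zero degree-Xᵖ low-degree divisible)
        u≋0 : u ≋ []
        u≋0 = nonsquare u v du uuf≋cvv
        square-zero : C c ⊗ (v ⊗ v) ≋ []
        square-zero = ≋-trans (≋-sym uuf≋cvv) (≋-trans (⊗-congʳ {f} (≋-trans (⊗-congʳ {u} u≋0) (⊗-zeroˡ u))) (⊗-zeroˡ f))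
        v≋0 : v ≋ []
        v≋0 = fromProduct (polyNoZeroDivisors (C c) (v ⊗ v) square-zero)
          where
          fromSquare : v ≋ [] ⊎ v ≋ [] → v ≋ []
          fromSquare (inj₁ y) = y
          fromSquare (inj₂ y) = y
          fromProduct : C c ≋ [] ⊎ v ⊗ v ≋ [] → v ≋ []
          fromProduct (inj₁ z) = ⊥-elim (f₀≉0 (at z 0))
          fromProduct (inj₂ z) = fromSquare (polyNoZeroDivisors v v z)

      -- Modulo X^p only the term j = 0 survives, and `independent` makes it vanish. Cancelling X^p
      -- then leaves the same situation with one term less.
      allIndependent : ∀ {J} (u v : Fin J → Polynomial) → (∀ j → Deg< (suc b) (u j)) → (∀ j → Deg< (suc b) (v j)) →
                       horner Xᵖ (combination u v) ≋ [] → ∀ j → u j ≋ [] × v j ≋ []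
      allIndependent {suc J} u v du dv z = λ where
          Fin.zero    → first
          (Fin.suc j) → allIndependent (u ∘ Fin.suc) (v ∘ Fin.suc) (du ∘ Fin.suc) (dv ∘ Fin.suc) rest-zero j
        where
        a = combination u v Fin.zero
        rest = horner Xᵖ (combination (u ∘ Fin.suc) (v ∘ Fin.suc))
        first : u Fin.zero ≋ [] × v Fin.zero ≋ []
        first = independent (u Fin.zero) (v Fin.zero) (du Fin.zero) (dv Fin.zero)
          (∣-cong {Xᵖ} (begin
            ⊖ (Xᵖ ⊗ rest)                           ≈⟨ solve 2 (λ a y → :- y := a :- (a :+ y)) ≋-refl a (Xᵖ ⊗ rest) ⟩
            a ⊝ (a ⊕ Xᵖ ⊗ rest)                     ≈⟨ ⊕-congˡ {a} (⊖-cong z) ⟩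
            a ⊝ []                                  ≈⟨ solve 1 (λ a → a :- con (+ 0) := a) ≋-refl a ⟩
            a                                       ∎) (∣-⊖ {Xᵖ} (rest , ≋-refl)))
          where
          open P-Reasoning
          open PSolver
        rest-zero : rest ≋ []
        rest-zero = fromProduct (polyNoZeroDivisors Xᵖ rest product)
          where
          a≋0 : a ≋ []
          a≋0 = ≋-trans (⊕-cong (proj₁ first) (≋-trans (⊗-congʳ {g} (proj₂ first)) (⊗-zeroˡ g))) (⊕-identityˡ [])
          product : Xᵖ ⊗ rest ≋ []
          product = ≋-trans (≋-sym (⊕-identityˡ (Xᵖ ⊗ rest))) (≋-trans (⊕-congʳ {Xᵖ ⊗ rest} (≋-sym a≋0)) z)
          fromProduct : Xᵖ ≋ [] ⊎ rest ≋ [] → rest ≋ []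
          fromProduct (inj₁ y) = ⊥-elim (degree-nonzero degree-Xᵖ y)
          fromProduct (inj₂ y) = y

      fromVector : ∀ {n} → (Fin n → Fin p) → Polynomial
      fromVector t = tabulate (toℕ ∘ t)

      deg-fromVector : ∀ {n} (t : Fin n → Fin p) → Deg< n (fromVector t)
      deg-fromVector {zero}  t = deg-[]
      deg-fromVector {suc n} t = deg-∷ (deg-fromVector (t ∘ Fin.suc))

      fromVector-injective : ∀ {n} (t t′ : Fin n → Fin p) → fromVector t ≋ fromVector t′ → ∀ i → t i ≡ t′ i
      fromVector-injective t t′ eq Fin.zero    =
        FinP.toℕ-injective (small-injective (FinP.toℕ<n (t Fin.zero)) (FinP.toℕ<n (t′ Fin.zero)) (at eq 0))
      fromVector-injective t t′ eq (Fin.suc i) = fromVector-injective (t ∘ Fin.suc) (t′ ∘ Fin.suc) (tail-cong eq) i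

      left right : Fin (suc b) → Fin (suc b ℕ.+ suc b)
      left i  = i ↑ˡ suc b
      right i = suc b ↑ʳ i

      residue : ℕ → Fin p
      residue a = fromℕ< (DM.m%n<n a p)

      residue-injective : ∀ a a′ → residue a ≡ residue a′ → a ≈ₚ a′
      residue-injective a a′ eq = residues (≡.trans (≡.sym (FinP.toℕ-fromℕ< (DM.m%n<n a p)))
        (≡.trans (≡.cong toℕ eq) (FinP.toℕ-fromℕ< (DM.m%n<n a′ p))))

      module _ (J : ℕ) where

        U-part V-part : (Fin (J ℕ.* (suc b ℕ.+ suc b)) → Fin p) → Fin J → Polynomial
        U-part w j = fromVector (λ i → w (combine j (left i)))
        V-part w j = fromVector (λ i → w (combine j (right i)))

        deg-U : ∀ w j → Deg< (suc b) (U-part w j)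
        deg-U w j = deg-fromVector (λ i → w (combine j (left i)))

        deg-V : ∀ w j → Deg< (suc b) (V-part w j)
        deg-V w j = deg-fromVector (λ i → w (combine j (right i)))

        parts-injective : ∀ w w′ → (∀ j → U-part w j ≋ U-part w′ j × V-part w j ≋ V-part w′ j) → ∀ i → w i ≡ w′ i
        parts-injective w w′ eq i = ≡.subst (λ k → w k ≡ w′ k) (FinP.combine-remQuot {J} (suc b ℕ.+ suc b) i)
          (pair (proj₁ (remQuot {J} (suc b ℕ.+ suc b) i)) (proj₂ (remQuot {J} (suc b ℕ.+ suc b) i)))
          where
          pair : ∀ j k → w (combine j k) ≡ w′ (combine j k)
          pair j k = ≡.subst (λ l → w (combine j l) ≡ w′ (combine j l)) (FinP.join-splitAt (suc b) (suc b) k)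
            (half (splitAt (suc b) k))
            where
            half : ∀ s → w (combine j (Fin.join (suc b) (suc b) s)) ≡ w′ (combine j (Fin.join (suc b) (suc b) s))
            half (inj₁ i) = fromVector-injective (λ i → w (combine j (left i))) (λ i → w′ (combine j (left i))) (proj₁ (eq j)) i
            half (inj₂ i) = fromVector-injective (λ i → w (combine j (right i))) (λ i → w′ (combine j (right i))) (proj₂ (eq j)) i

      -- There are fewer conditions than coordinates, so two vectors agree on all conditions, and by
      -- linearity their difference satisfies the homogeneous ones. The resulting Ψ is nonzero by
      -- `allIndependent` and vanishes to order M at every point of `xs`; comparing with its degree
      -- bounds their number. M ≤ p allows the order to be tested by derivatives.
      stepanov : ∀ α J M → M ℕ.≤ p →
                 M ℕ.* (J ℕ.* 1 ℕ.+ (M ℕ.* q ℕ.+ suc b)) ℕ.< J ℕ.* (suc b ℕ.+ suc b) →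
                 ∀ xs → AllPairs _≉_ xs → All (λ x → eval f x ^ h ≈ₚ α) xs →
                 length xs ℕ.* M ℕ.< M ℕ.* q ℕ.+ (J ℕ.* p ℕ.+ (h ℕ.* q ℕ.+ suc b))
      stepanov α J M M≤p unknowns xs xs≉ roots = conclude (collision (s≤s (ℕP.≤-trans 1≤h (ℕP.m≤m+n h h))) unknowns conditions)
        where
        width : ℕ
        width = J ℕ.* 1 ℕ.+ (M ℕ.* q ℕ.+ suc b)
        value : ∀ (w : Fin (J ℕ.* (suc b ℕ.+ suc b)) → Fin p) → Fin M → ℕ → ℕ
        value w k i = coefficient (reduced α M (toℕ k) (U-part J w) (V-part J w)) i
        -- One condition for every order k < M of differentiation and every coefficient below the
        -- degree bound `width` of the reduced cofactors.
        conditions : (Fin (J ℕ.* (suc b ℕ.+ suc b)) → Fin p) → Fin (M ℕ.* width) → Fin p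
        conditions w r = residue (value w (proj₁ (remQuot width r)) (toℕ (proj₂ (remQuot {M} width r))))
        conclude : (∃[ w ] ∃[ w′ ] ((∃[ i ] w i ≢ w′ i) × (∀ r → conditions w r ≡ conditions w′ r))) →
                   length xs ℕ.* M ℕ.< M ℕ.* q ℕ.+ (J ℕ.* p ℕ.+ (h ℕ.* q ℕ.+ suc b))
        conclude (w , w′ , (i , wi≢w′i) , same-conditions) =
          rootsBound M xs Ψ _ xs≉ (All.map multiple roots) Ψ≇0 bounded-Ψ
          where
          u v : Fin J → Polynomial
          u j = U-part J w j ⊝ U-part J w′ j
          v j = V-part J w j ⊝ V-part J w′ j
          du : ∀ j → Deg< (suc b) (u j)
          du j = deg-⊕ (deg-U J w j) (deg-⊖ (deg-U J w′ j))
          dv : ∀ j → Deg< (suc b) (v j)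
          dv j = deg-⊕ (deg-V J w j) (deg-⊖ (deg-V J w′ j))
          Z = horner Xᵖ (combination u v)
          Ψ = f ^ₚ M ⊗ Z
          f≇0 : f ≇ []
          f≇0 z = f₀≉0 (eval-zero 0 z)
          Z≇0 : Z ≇ []
          Z≇0 z = wi≢w′i (parts-injective J w w′ 
              (λ j → ⊝≋0⇒≋ (U-part J w j) (U-part J w′ j) (proj₁ (zero-parts j)) ,
                     ⊝≋0⇒≋ (V-part J w j) (V-part J w′ j) (proj₂ (zero-parts j))) i)
            where
            zero-parts : ∀ j → u j ≋ [] × v j ≋ []
            zero-parts = allIndependent u v du dv z
          Ψ≇0 : Ψ ≇ []
          Ψ≇0 = ⊗-nonzero (^-nonzero M f≇0) Z≇0
          bounded-Ψ : Deg< (M ℕ.* q ℕ.+ (J ℕ.* p ℕ.+ (h ℕ.* q ℕ.+ suc b))) Ψ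
          bounded-Ψ = deg-⊗ {M ℕ.* q} (deg-^ M bounded-f) (deg-horner (bounded degree-Xᵖ) (λ j →
            deg-⊕ (deg-mono (ℕP.m≤n+m (suc b) (h ℕ.* q)) (du j))
              (deg-cong (⊗-comm g (v j)) (deg-⊗ {h ℕ.* q} (deg-^ h bounded-f) (dv j)))))
          same-value : ∀ (k : Fin M) (l : Fin width) → value w k (toℕ l) ≈ₚ value w′ k (toℕ l)
          same-value k l = ≡.subst (λ kl → value w (proj₁ kl) (toℕ (proj₂ kl)) ≈ₚ value w′ (proj₁ kl) (toℕ (proj₂ kl)))
            (FinP.remQuot-combine k l) (residue-injective _ _ (same-conditions (combine k l)))
          reduced-zero : ∀ k → k ℕ.< M → reduced α M k u v ≋ []
          reduced-zero k k<M = ≋-trans (reduced-⊝ α M k (U-part J w) (V-part J w) (U-part J w′) (V-part J w′)) (≋⇒⊝≋0 equal)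
            where
            equal : reduced α M k (U-part J w) (V-part J w) ≋ reduced α M k (U-part J w′) (V-part J w′)
            equal .at i = cases (i ℕP.<? width)
              where
              high : ∀ z → width ℕ.≤ i → coefficient (reduced α M k (U-part J z) (V-part J z)) i ≈ₚ 0
              high z = vanish (deg-reduced α M k {u = U-part J z} {v = V-part J z} (ℕP.<⇒≤ k<M)
                (deg-U J z) (deg-V J z)) i
              cases : Dec (i ℕ.< width) → coefficient (reduced α M k (U-part J w) (V-part J w)) i ≈ₚ
                                          coefficient (reduced α M k (U-part J w′) (V-part J w′)) i
              cases (yes i<width) = ≡.subst₂ (λ k′ i′ → coefficient (reduced α M k′ (U-part J w) (V-part J w)) i′ ≈ₚ
                                                      coefficient (reduced α M k′ (U-part J w′) (V-part J w′)) i′)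
                (FinP.toℕ-fromℕ< k<M) (FinP.toℕ-fromℕ< i<width) (same-value (fromℕ< k<M) (fromℕ< i<width))
              cases (no  i≮width) = trans (high w (ℕP.≮⇒≥ i≮width)) (sym (high w′ (ℕP.≮⇒≥ i≮width)))
          multiple : ∀ {x} → eval f x ^ h ≈ₚ α → lin x ^ₚ M ∣ Ψ
          multiple {x} fxʰ = multiplicity x M Ψ (λ i 1≤i i<M → multiple-nonzero i 1≤i (ℕP.<-≤-trans i<M M≤p))
            (derivativesVanish α M u v reduced-zero x fxʰ)

-- Products of translates of a square-free polynomial are not squares.

module ShiftedProducts (h : ℕ) (isPrime : Prime (suc (h ℕ.+ h))) where
  open PrimeField h isPrime
  open CommutativeRing primeRing hiding (zero; +-rawMagma)

  prodShift : List ℕ → Polynomial → Polynomial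
  prodShift []      F = 𝟙
  prodShift (j ∷ S) F = shift j F ⊗ prodShift S F

  degree-prodShift : ∀ S {F d} → Degree F d → Degree (prodShift S F) (length S ℕ.* d)
  degree-prodShift []      dF = degree-cong C-1 (degree 1≉0 deg-C)
  degree-prodShift (j ∷ S) dF = degree-⊗ (degree-shift j dF) (degree-prodShift S dF)

  ∤𝟙 : ∀ {P e} → Irreducible P e → ¬ P ∣ 𝟙
  ∤𝟙 irr d = 1≉0 (trans (at C-1 0) (at (∣-low⇒zero (degreeOf irr) (deg-mono (nonconstant irr) (deg-cong C-1 deg-C)) d) 0))

  ∤-prodShift : ∀ {P e} → Irreducible P e → ∀ S {F} → All (λ j → ¬ P ∣ shift j F) S → ¬ P ∣ prodShift S F
  ∤-prodShift irr []      []        d = ∤𝟙 irr d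
  ∤-prodShift irr (j ∷ S) {F} (n ∷ ns) d = split (euclid irr (shift j F) (prodShift S F) d)
    where
    split : _ ∣ shift j F ⊎ _ ∣ prodShift S F → ⊥
    split (inj₁ q) = n q
    split (inj₂ q) = ∤-prodShift irr S ns q

  -- P and its translate have the same degree and leading coefficient, so divisibility forces
  -- equality. Then P takes the value P(0) at all p multiples of σ, too many roots for P - P(0),
  -- whose degree e is below p.
  noSelfShift : ∀ {P e} → Irreducible P e → e ℕ.< p → ∀ σ → 1 ℕ.≤ σ → σ ℕ.< p → ¬ P ∣ shift σ P
  noSelfShift {P} {e} irr e<p σ 1≤σ σ<p P∣ = ℕP.<-irrefl (length-applyUpTo point p)
    (ℕP.<-≤-trans (simpleRootsBound (applyUpTo point p) Ψ (suc e) (AllPairsP.applyUpTo⁺₁ point p distinct)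
      (AllP.applyUpTo⁺₂ point p rootΨ) Ψ≇0 (bounded degreeΨ)) e<p)
    where
    open import Algebra.Properties.AbelianGroup +-abelianGroup using (x∙y⁻¹≈ε⇒x≈y)
    dP = degreeOf irr
    invariant : shift σ P ≋ P
    invariant = ⊝≋0⇒≋ (shift σ P) P (∣-low⇒zero dP
      (deg-drop (deg-⊕ (deg-shift σ (bounded dP)) (deg-⊖ (bounded dP))) (begin
        coefficient (shift σ P ⊝ P) e                     ≈⟨ coefficient-⊕ (shift σ P) (⊖ P) e ⟩
        coefficient (shift σ P) e + coefficient (⊖ P) e   ≈⟨ +-cong (shift-top σ (bounded dP)) (coefficient-⊖ P e) ⟩
        coefficient P e - coefficient P e                 ≈⟨ -‿inverseʳ (coefficient P e) ⟩
        0                                                 ∎))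
      (∣-⊕ {P} P∣ (∣-⊖ {P} (∣-refl P))))
      where open K-Reasoning
    point : ℕ → ℕ
    point i = i * σ
    c = eval P 0
    Ψ = P ⊝ C c
    periodic : ∀ i → eval P (point i) ≈ₚ c
    periodic zero    = refl
    periodic (suc i) = begin
      eval P (σ + i * σ)          ≡⟨ ≡.cong (eval P) (ℕP.+-comm σ (i ℕ.* σ)) ⟩
      eval P (i * σ + σ)          ≈⟨ eval-shift σ P (i * σ) ⟨
      eval (shift σ P) (i * σ)    ≈⟨ eval-cong (i * σ) invariant ⟩
      eval P (i * σ)              ≈⟨ periodic i ⟩
      c                           ∎
      where open K-Reasoning
    rootΨ : ∀ i → eval Ψ (point i) ≈ₚ 0
    rootΨ i = trans (eval-⊝ P (C c) (point i)) (trans (+-cong (periodic i) (-‿cong (eval-C c (point i)))) (-‿inverseʳ c))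
    degreeΨ : Degree Ψ e
    degreeΨ = degree (λ z → leading dP (trans (sym (top-unchanged e (nonconstant irr))) z))
      (deg-⊕ (bounded dP) (deg-⊖ (deg-mono (s≤s z≤n) deg-C)))
      where
      top-unchanged : ∀ i → 1 ℕ.≤ i → coefficient Ψ i ≈ₚ coefficient P i
      top-unchanged (suc i) _ = trans (coefficient-⊕ P (⊖ C c) (suc i))
        (trans (+-congˡ {coefficient P (suc i)} (trans (coefficient-⊖ (C c) (suc i)) (zeroʳ (h ℕ.+ h)))) (+-identityʳ _))
    Ψ≇0 : Ψ ≇ []
    Ψ≇0 = degree-nonzero degreeΨ
    distinct : ∀ {i j} → i ℕ.< j → j ℕ.< p → point i ≉ point j
    distinct {i} {j} i<j j<p eq = ℕP.<⇒≢ i<j (small-injective (ℕP.<-trans i<j j<p) j<p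
      (x∙y⁻¹≈ε⇒x≈y i j (cancel-zeroˡ (small-nonzero 1≤σ σ<p) (begin
        σ * (i - j)             ≈⟨ solve 3 (λ s i j → s :* (i :- j) := i :* s :- j :* s) refl σ i j ⟩
        i * σ - j * σ           ≈⟨ +-congʳ { - (j * σ)} eq ⟩
        j * σ - j * σ           ≈⟨ -‿inverseʳ (j * σ) ⟩
        0                       ∎))))
      where
      open K-Reasoning
      open KSolver

  module NonSquare
    (F : Polynomial) (d : ℕ) (dF : Degree F d) (1≤d : 1 ℕ.≤ d)
    (squareFree : ∀ G e H → 1 ℕ.≤ e → Degree G e → ¬ G ⊗ G ⊗ H ≋ F)
    (w : ℕ) (window : d ℕ.* suc w ℕ.< p) where

    d<p : d ℕ.< p
    d<p = ℕP.≤-<-trans (ℕP.m≤m*n d (suc w)) window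

    prodShift-reshift : ∀ Σ {P P′ t} → shift t P′ ≋ P → prodShift (map (ℕ._+ t) Σ) P′ ≋ prodShift Σ P
    prodShift-reshift []      eq = ≋-refl
    prodShift-reshift (σ ∷ Σ) {P} {P′} {t} eq = ⊗-cong
      (≋-trans (≋-sym (shift-shift σ t P′)) (shift-cong σ eq)) (prodShift-reshift Σ eq)

    -- If P ∣ F(X + t), then P(X - t) is another irreducible factor of F.  All the translates of P met in this
    -- way are coprime, so their product divides F, and a suitable factor is reached in fewer than d steps.
    goodFactor : (∀ P e → Irreducible P e → P ∣ F → (∀ t → 1 ℕ.≤ t → t ℕ.≤ w → ¬ P ∣ shift t F) → ⊥) → ⊥
    goodFactor k = irreducibleFactor (suc d) F d ℕP.≤-refl dF 1≤d λ P e irr P∣F →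
      chain d P e [] (proj₁ P∣F) irr
        (≋-trans (proj₂ P∣F) (⊗-congʳ {proj₁ P∣F} (≋-sym (⊗-identityʳ P)))) [] ≡.refl
      where
      chain : ∀ fuel P e Σ K → Irreducible P e → F ≋ P ⊗ prodShift Σ P ⊗ K →
              All (λ σ → 1 ℕ.≤ σ × σ ℕ.≤ length Σ ℕ.* w) Σ → length Σ ℕ.+ fuel ≡ d → ⊥
      -- Now Σ has d entries, so F would be divisible by a product of d + 1 nonconstant polynomials.
      chain zero P e Σ K irr F≋ Σ-bound len = ℕP.<-irrefl ≡.refl (ℕP.≤-trans (s≤s d≤e*) (ℕP.≤-trans
          (ℕP.+-monoˡ-≤ (length Σ ℕ.* e) (nonconstant irr))
          (∣⇒degree-≤ (degree-⊗ (degreeOf irr) (degree-prodShift Σ (degreeOf irr))) dF (K , F≋))))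
        where
        d≤e* : d ℕ.≤ length Σ ℕ.* e
        d≤e* = ℕP.≤-trans (ℕP.≤-reflexive (≡.trans (≡.sym len) (≡.trans (ℕP.+-identityʳ _) (≡.sym (ℕP.*-identityʳ _)))))
          (ℕP.*-monoʳ-≤ (length Σ) (nonconstant irr))
      chain (suc fuel) P e Σ K irr F≋ Σ-bound len = k P e irr P∣F next
        where
        P∣F : P ∣ F
        P∣F = prodShift Σ P ⊗ K , ≋-trans F≋ (⊗-assoc P (prodShift Σ P) K)
        e<p : e ℕ.< p
        e<p = ℕP.≤-<-trans (∣⇒degree-≤ (degreeOf irr) dF P∣F) d<p
        len≤d : suc (length Σ) ℕ.≤ d
        len≤d = ℕP.≤-trans (ℕP.≤-trans (ℕP.m≤m+n (suc (length Σ)) fuel) (ℕP.≤-reflexive (≡.sym (ℕP.+-suc (length Σ) fuel))))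
          (ℕP.≤-reflexive len)
        -- Each replacement of P by P(X - t) with t ≤ w adds t to all distances between the
        -- translates collected so far. After at most d replacements they are at most d w, hence
        -- below p, as `noSelfShift` demands.
        small : ∀ {s} → s ℕ.≤ suc (length Σ) ℕ.* w → s ℕ.< p
        small s≤ = ℕP.≤-<-trans s≤ (ℕP.≤-<-trans (ℕP.*-mono-≤ len≤d (ℕP.n≤1+n w)) window)
        next : ∀ t → 1 ℕ.≤ t → t ℕ.≤ w → ¬ P ∣ shift t F
        next t 1≤t t≤w P∣shift = continue (euclid irr′ (P ⊗ prodShift Σ P) K P′∣product)
          where
          P′ = shift (- t) P
          irr′ : Irreducible P′ e
          irr′ = irreducible-shift (- t) irr
          shiftP′ : shift t P′ ≋ P
          shiftP′ = reshift t P
          P′∣F : P′ ∣ F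
          P′∣F = shift-∣⁻ t (∣-congˡ (≋-sym shiftP′) P∣shift)
          P′∣product : P′ ∣ P ⊗ prodShift Σ P ⊗ K
          P′∣product = ∣-cong {P′} F≋ P′∣F
          Σ′ = t ∷ map (ℕ._+ t) Σ
          product≋ : prodShift Σ′ P′ ≋ P ⊗ prodShift Σ P
          product≋ = ⊗-cong shiftP′ (prodShift-reshift Σ shiftP′)
          bound′ : All (λ σ → 1 ℕ.≤ σ × σ ℕ.≤ suc (length Σ) ℕ.* w) Σ′
          bound′ = (1≤t , ℕP.≤-trans t≤w (ℕP.m≤m+n w (length Σ ℕ.* w))) ∷ AllP.map⁺ (All.map
            (λ { {σ} (1≤σ , σ≤) → ℕP.≤-trans 1≤σ (ℕP.m≤m+n σ t) ,
                 ℕP.≤-trans (ℕP.+-mono-≤ σ≤ t≤w) (ℕP.≤-reflexive (ℕP.+-comm (length Σ ℕ.* w) w)) }) Σ-bound)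
          P′∤product : ¬ P′ ∣ P ⊗ prodShift Σ P
          P′∤product d = ∤-prodShift irr′ Σ′ (All.map (λ { {σ} (1≤σ , σ≤) → noSelfShift irr′ e<p σ 1≤σ (small σ≤) }) bound′)
            (∣-cong {P′} (≋-sym product≋) d)
          continue : P′ ∣ P ⊗ prodShift Σ P ⊎ P′ ∣ K → ⊥
          continue (inj₁ d) = P′∤product d
          continue (inj₂ (K′ , K≋)) = chain fuel P′ e Σ′ K′ irr′ (begin
              F                                      ≈⟨ F≋ ⟩
              P ⊗ prodShift Σ P ⊗ K                  ≈⟨ ⊗-cong (≋-sym product≋) K≋ ⟩
              prodShift Σ′ P′ ⊗ (P′ ⊗ K′)
                ≈⟨ solve 3 (λ a b c → a :* (b :* c) := b :* a :* c) ≋-refl (prodShift Σ′ P′) P′ K′ ⟩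
              P′ ⊗ prodShift Σ′ P′ ⊗ K′              ∎)
            (≡.subst (λ l → All (λ σ → 1 ℕ.≤ σ × σ ℕ.≤ suc l ℕ.* w) Σ′) (≡.sym (length-map (ℕ._+ t) Σ)) bound′)
            (≡.trans (≡.cong (λ l → suc (l ℕ.+ fuel)) (length-map (ℕ._+ t) Σ)) (≡.trans (≡.sym (ℕP.+-suc (length Σ) fuel)) len))
            where
            open P-Reasoning
            open PSolver

    -- `goodFactor` is available only for proving ⊥. Deciding first whether u vanishes brings the
    -- goal into that form. The constant c is moved to the other side by its inverse to match
    -- `squareDescent`.
    nonsquare : ∀ j S → All (λ i → j ℕ.< i × i ℕ.≤ j ℕ.+ w) S → ∀ c → c ≉ 0 →
                ∀ n u v → Deg< n u → u ⊗ u ⊗ prodShift (j ∷ S) F ≋ C c ⊗ (v ⊗ v) → u ≋ []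
    nonsquare j S near c c≉0 n u v bu eq = decide (zero? u)
      where
      f = prodShift (j ∷ S) F
      decide : Dec (u ≋ []) → u ≋ []
      decide (yes z) = z
      decide (no u≇0) = ⊥-elim (goodFactor descend)
        where
        descend : ∀ P e → Irreducible P e → P ∣ F → (∀ t → 1 ℕ.≤ t → t ℕ.≤ w → ¬ P ∣ shift t F) → ⊥
        descend P e irr (K , F≋) good = fromInverse (invert c c≉0)
          where
          Q = shift j P
          irrQ : Irreducible Q e
          irrQ = irreducible-shift j irr
          k = shift j K ⊗ prodShift S F
          f≋ : f ≋ Q ⊗ k
          f≋ = ≋-trans (⊗-congʳ {prodShift S F} (≋-trans (shift-cong j F≋) (shift-⊗ j P K)))
            (⊗-assoc Q (shift j K) (prodShift S F))
          P∤K : ¬ P ∣ K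
          P∤K (W , K≋) = squareFree P e W (nonconstant irr) (degreeOf irr)
            (≋-trans (⊗-assoc P P W) (≋-trans (⊗-congˡ {P} (≋-sym K≋)) (≋-sym F≋)))
          far : ∀ {i} → j ℕ.< i × i ℕ.≤ j ℕ.+ w → ¬ Q ∣ shift i F
          far {i} (j<i , i≤) d = good t (ℕP.m<n⇒0<n∸m j<i)
              (ℕP.≤-trans (ℕP.∸-monoˡ-≤ j i≤) (ℕP.≤-reflexive (ℕP.m+n∸m≡n j w)))
              (shift-∣⁻ j (∣-cong {Q} (≋-sym (≋-trans (shift-shift j t F) (shift-congˡ F (≡⇒≈ₚ (ℕP.m+[n∸m]≡n (ℕP.<⇒≤ j<i)))))) d))
            where t = i ℕ.∸ j
          Q∤k : ¬ Q ∣ k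
          Q∤k d = split (euclid irrQ (shift j K) (prodShift S F) d)
            where
            split : Q ∣ shift j K ⊎ Q ∣ prodShift S F → ⊥
            split (inj₁ q) = P∤K (shift-∣⁻ j q)
            split (inj₂ q) = ∤-prodShift irrQ S (All.map far near) q
          fromInverse : (∃[ c′ ] c * c′ ≈ₚ 1) → ⊥
          fromInverse (c′ , cc′≈1) = u≇0 (squareDescent irrQ f≋ Q∤k c′≉0 n u v bu (begin
              C c′ ⊗ (u ⊗ u ⊗ f)             ≈⟨ ⊗-congˡ {C c′} eq ⟩
              C c′ ⊗ (C c ⊗ (v ⊗ v))         ≈⟨ ⊗-assoc (C c′) (C c) (v ⊗ v) ⟨
              C c′ ⊗ C c ⊗ (v ⊗ v)           ≈⟨ ⊗-congʳ {v ⊗ v} (C-* c′ c) ⟨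
              C (c′ * c) ⊗ (v ⊗ v)
                ≈⟨ ⊗-congʳ {v ⊗ v} (≋-trans (C-cong (trans (*-comm c′ c) cc′≈1)) C-1) ⟩
              𝟙 ⊗ (v ⊗ v)                    ≈⟨ ⊗-identityˡ (v ⊗ v) ⟩
              v ⊗ v                          ∎))
            where
            open P-Reasoning
            c′≉0 : c′ ≉ 0
            c′≉0 z = 1≉0 (trans (sym cc′≈1) (trans (*-congˡ {c} z) (zeroʳ c)))

-- Stepanov's parameters and elementary inequalities.

module Estimates where
  open import Data.Nat using (_+_; _*_; _^_; _∸_; _≤_; _<_)
  open import Data.Nat.Properties
  open import Data.Nat.Tactic.RingSolver using (solve-∀)
  import Data.Integer.Tactic.RingSolver as ℤR
  open import Relation.Unary using (Pred; Decidable)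

  module ParameterChoice (Θ : ℕ) (2≤Θ : 2 ≤ Θ) where

    private
      instance
        Θ≢0 : ℕ.NonZero Θ
        Θ≢0 = ℕ.>-nonZero (≤-trans (s≤s z≤n) 2≤Θ)

    -- With M = 2 J - 1 and B = b + 1, the unknowns 2 J B exceed the part M B of the conditions by
    -- exactly B; so B has to beat the rest M (J + M Θ), which b equals. Roots number about J p / M,
    -- that is p/2 with a relative error 1/M. Together with the degree of g this leaves an excess of
    -- order Θ p / M, and to push that below p / Θ, M must be of the order Θ².
    ⟨J⟩ ⟨M⟩ ⟨b⟩ : ℕ
    ⟨J⟩ = Θ * (Θ + 2) + 1
    ⟨M⟩ = Θ * (Θ + 2) + Θ * (Θ + 2) + 1
    ⟨b⟩ = ⟨M⟩ * (⟨J⟩ + ⟨M⟩ * Θ)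

    enoughUnknowns : ⟨M⟩ * (⟨J⟩ * 1 + (⟨M⟩ * Θ + suc ⟨b⟩)) < ⟨J⟩ * (suc ⟨b⟩ + suc ⟨b⟩)
    enoughUnknowns = ≤-reflexive (identity Θ (Θ * (Θ + 2)) ⟨b⟩)
      where
      identity : ∀ t k b → let J = k + 1 ; M = k + k + 1 ; b = M * (J + M * t) in
                 suc (M * (J * 1 + (M * t + suc b))) ≡ J * (suc b + suc b)
      identity = solve-∀

    private
      1≤^ : ∀ i → 1 ≤ Θ ^ i
      1≤^ i = m^n>0 Θ i

      sum^ : ∀ i {a b} → a ≤ Θ ^ i → b ≤ Θ ^ i → a + b ≤ Θ ^ suc i
      sum^ i a≤ b≤ = ≤-trans (+-mono-≤ a≤ (≤-trans b≤ (m≤m+n _ 0))) (*-monoˡ-≤ (Θ ^ i) 2≤Θ)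

      product^ : ∀ i j {a b} → a ≤ Θ ^ i → b ≤ Θ ^ j → a * b ≤ Θ ^ (i + j)
      product^ i j a≤ b≤ = ≤-trans (*-mono-≤ a≤ b≤) (≤-reflexive (≡.sym (^-distribˡ-+-* Θ i j)))

      raise^ : ∀ {i j a} → i ≤ j → a ≤ Θ ^ i → a ≤ Θ ^ j
      raise^ i≤j a≤ = ≤-trans a≤ (^-monoʳ-≤ Θ i≤j)

      Θ≤ : Θ ≤ Θ ^ 1
      Θ≤ = ≤-reflexive (≡.sym (^-identityʳ Θ))

      k≤ : Θ * (Θ + 2) ≤ Θ ^ 3
      k≤ = product^ 1 2 Θ≤ (sum^ 1 Θ≤ (≤-trans 2≤Θ Θ≤))

      J≤ : ⟨J⟩ ≤ Θ ^ 4
      J≤ = sum^ 3 k≤ (1≤^ 3)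

      M≤ : ⟨M⟩ ≤ Θ ^ 5
      M≤ = sum^ 4 (sum^ 3 k≤ k≤) (1≤^ 4)

      b≤ : ⟨b⟩ ≤ Θ ^ 12
      b≤ = product^ 5 7 M≤ (sum^ 6 (raise^ (m≤m+n 4 2) J≤) (product^ 5 1 M≤ Θ≤))

      2B≤ : suc ⟨b⟩ + suc ⟨b⟩ ≤ Θ ^ 14
      2B≤ = sum^ 13 B≤ B≤
        where
        B≤ : suc ⟨b⟩ ≤ Θ ^ 13
        B≤ = sum^ 12 (1≤^ 12) b≤

    -- The crude bounds b ≤ Θ^12 and 2 (b + 1) ≤ Θ^14 lead to Θ^15; the exponent is rounded up to
    -- 16.
    room : suc ⟨b⟩ + suc ⟨b⟩ + Θ ≤ Θ ^ 16
    room = raise^ (m≤m+n 15 1) (sum^ 14 2B≤ (raise^ (m≤m+n 1 13) Θ≤))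

    multiplicity-small : ⟨M⟩ ≤ Θ ^ 16
    multiplicity-small = raise^ (m≤m+n 5 11) M≤

    square-small : 6 * (Θ * Θ) ≤ Θ ^ 16
    square-small = raise^ (m≤m+n 5 11) (product^ 3 2 (≤-trans (≤-trans (m≤m+n 6 2) (^-monoˡ-≤ 3 2≤Θ)) ≤-refl) (product^ 1 1 Θ≤ Θ≤))

    -- Since 2 J = M + 1, the bound on N gives 2 N ≤ p + (Θ + 2) p / M + 2 Θ, where 2 h ≤ p absorbs
    -- the degree of g and `room` the term 2 (b + 1). With N₀ ≤ Θ, what exceeds p is at most (Θ + 2)
    -- p / M + 3 Θ. Each of these two terms is at most p / (2 Θ), by the choice of M and by 6 Θ² ≤
    -- p.
    excess : ∀ p h N N₀ t → Θ ^ 16 ≤ p → h + h ≤ p → N₀ ≤ Θ →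
             N * ⟨M⟩ ≤ ⟨M⟩ * Θ + (⟨J⟩ * p + (h * Θ + suc ⟨b⟩)) → t + p ≤ 2 * N + N₀ → Θ * t ≤ p
    excess p h N N₀ t large 2h≤p N₀≤ NM≤ t+p≤ = *-cancelˡ-≤ (2 * M) (begin
        2 * M * (Θ * t)                             ≡⟨ regroup M Θ t ⟩
        2 * Θ * (t * M)                             ≤⟨ *-monoʳ-≤ (2 * Θ) tM≤ ⟩
        2 * Θ * (3 * (M * Θ) + (Θ + 2) * p)         ≡⟨ expand Θ M p ⟩
        6 * (Θ * Θ) * M + (k + k) * p
          ≤⟨ +-mono-≤ (*-monoˡ-≤ M (≤-trans square-small large)) (*-monoˡ-≤ p (m≤m+n (k + k) 1)) ⟩
        p * M + M * p                               ≡⟨ double p M ⟩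
        2 * M * p                                   ∎)
      where
      open ≤-Reasoning
      M = ⟨M⟩
      k = Θ * (Θ + 2)
      instance
        2M≢0 : ℕ.NonZero (2 * M)
        2M≢0 = ℕ.>-nonZero (≤-trans (s≤s z≤n) (≤-trans (m≤n+m 1 (k + k)) (m≤m+n M (M + 0))))
      regroup : ∀ M Θ t → 2 * M * (Θ * t) ≡ 2 * Θ * (t * M)
      regroup = solve-∀
      expand : ∀ Θ M p → 2 * Θ * (3 * (M * Θ) + (Θ + 2) * p) ≡ 6 * (Θ * Θ) * M + (Θ * (Θ + 2) + Θ * (Θ + 2)) * p
      expand = solve-∀
      double : ∀ p M → p * M + M * p ≡ 2 * M * p
      double = solve-∀
      2B≤p : suc ⟨b⟩ + suc ⟨b⟩ ≤ p
      2B≤p = ≤-trans (m≤m+n _ Θ) (≤-trans room large)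
      tM≤ : t * M ≤ 3 * (M * Θ) + (Θ + 2) * p
      tM≤ = +-cancelʳ-≤ (p * M) _ _ (begin
        t * M + p * M                               ≡⟨ *-distribʳ-+ M t p ⟨
        (t + p) * M                                 ≤⟨ *-monoˡ-≤ M t+p≤ ⟩
        (2 * N + N₀) * M                            ≡⟨ split N N₀ M ⟩
        2 * (N * M) + N₀ * M                        ≤⟨ +-mono-≤ (*-monoʳ-≤ 2 NM≤) (*-monoˡ-≤ M N₀≤) ⟩
        2 * (M * Θ + (⟨J⟩ * p + (h * Θ + suc ⟨b⟩))) + Θ * M
          ≡⟨ collect k Θ p h ⟨b⟩ ⟩
        3 * (M * Θ) + (p * M + p) + (h + h) * Θ + (suc ⟨b⟩ + suc ⟨b⟩)
          ≤⟨ +-mono-≤ (+-monoʳ-≤ (3 * (M * Θ) + (p * M + p)) (*-monoˡ-≤ Θ 2h≤p)) 2B≤p ⟩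
        3 * (M * Θ) + (p * M + p) + p * Θ + p       ≡⟨ gather (M * Θ) (p * M) p Θ ⟩
        3 * (M * Θ) + (Θ + 2) * p + p * M           ∎)
        where
        split : ∀ N N₀ M → (2 * N + N₀) * M ≡ 2 * (N * M) + N₀ * M
        split = solve-∀
        collect : ∀ k Θ p h b → let M = k + k + 1 in
                  2 * (M * Θ + ((k + 1) * p + (h * Θ + suc b))) + Θ * M ≡
                  3 * (M * Θ) + (p * M + p) + (h + h) * Θ + (suc b + suc b)
        collect = solve-∀
        gather : ∀ x y p Θ → 3 * x + (y + p) + p * Θ + p ≡ 3 * x + (Θ + 2) * p + y
        gather = solve-∀

  record StepanovParameters (Θ : ℕ) : Set where
    field
      J M b          : ℕ
      enoughUnknowns : M * (J * 1 + (M * Θ + suc b)) < J * (suc b + suc b)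
      room           : suc b + suc b + Θ ≤ Θ ^ 16
      M-small        : M ≤ Θ ^ 16
      excess         : ∀ p h N N₀ t → Θ ^ 16 ≤ p → h + h ≤ p → N₀ ≤ Θ →
                       N * M ≤ M * Θ + (J * p + (h * Θ + suc b)) → t + p ≤ 2 * N + N₀ → Θ * t ≤ p

  stepanovParameters : ∀ Θ → 2 ≤ Θ → StepanovParameters Θ
  stepanovParameters Θ 2≤Θ = record
    { J = ⟨J⟩ ; M = ⟨M⟩ ; b = ⟨b⟩ ; enoughUnknowns = enoughUnknowns ; room = room ; M-small = multiplicity-small ; excess = excess }
    where open ParameterChoice Θ 2≤Θ

  sumTo : ℕ → (ℕ → ℤ) → ℤ
  sumTo zero    f = + 0
  sumTo (suc n) f = f n ℤ.+ sumTo n f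

  indicator : ∀ {P : Set} → Dec P → ℕ
  indicator (yes _) = 1
  indicator (no _)  = 0

  length-filter-∷ : ∀ {A : Set} {P : Pred A 0ℓ} (P? : Decidable P) x xs →
                    length (filter P? (x ∷ xs)) ≡ indicator (P? x) + length (filter P? xs)
  length-filter-∷ P? x xs with P? x
  ... | yes _ = ≡.refl
  ... | no  _ = ≡.refl

  -- Turns a character sum into a count of points: a symbol z satisfies z + 1 ≤ 2 [z = 1] + [z = 0],
  -- and these inequalities are added up.
  sumTo-count : ∀ {P Q : Pred ℕ 0ℓ} (P? : Decidable P) (Q? : Decidable Q) z →
                (∀ i → z i ℤ.+ + 1 ℤ.≤ + (2 * indicator (P? i) + indicator (Q? i))) →
                ∀ n → sumTo n z ℤ.+ + n ℤ.≤ + (2 * length (filter P? (downFrom n)) + length (filter Q? (downFrom n)))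
  sumTo-count P? Q? z bound zero    = ℤP.≤-refl
  sumTo-count P? Q? z bound (suc n) = begin
    z n ℤ.+ sumTo n z ℤ.+ + suc n                       ≡⟨ move (z n) (sumTo n z) (+ n) ⟩
    (z n ℤ.+ + 1) ℤ.+ (sumTo n z ℤ.+ + n)               ≤⟨ ℤP.+-mono-≤ (bound n) (sumTo-count P? Q? z bound n) ⟩
    + (2 * i + j + (2 * a + b))                         ≡⟨ ≡.cong +_ (regroup i j a b) ⟩
    + (2 * (i + a) + (j + b))
      ≡⟨ ≡.cong₂ (λ x y → + (2 * x + y)) (length-filter-∷ P? n (downFrom n)) (length-filter-∷ Q? n (downFrom n)) ⟨
    + (2 * length (filter P? (downFrom (suc n))) + length (filter Q? (downFrom (suc n)))) ∎
    where
    open ℤP.≤-Reasoning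
    i = indicator (P? n)
    j = indicator (Q? n)
    a = length (filter P? (downFrom n))
    b = length (filter Q? (downFrom n))
    regroup : ∀ i j a b → 2 * i + j + (2 * a + b) ≡ 2 * (i + a) + (j + b)
    regroup = solve-∀
    move : ∀ x s n → x ℤ.+ s ℤ.+ (+ 1 ℤ.+ n) ≡ (x ℤ.+ + 1) ℤ.+ (s ℤ.+ n)
    move = ℤR.solve-∀

  excessBound : ∀ Θ p total T → T ℤ.+ + p ℤ.≤ + total → (∀ t → t + p ≤ total → Θ * t ≤ p) → + Θ ℤ.* T ℤ.≤ + p
  excessBound Θ p total T T+p≤ bound = begin
    + Θ ℤ.* T               ≤⟨ ℤP.*-monoˡ-≤-nonNeg (+ Θ) T≤ ⟩
    + Θ ℤ.* + t             ≡⟨ ℤP.pos-* Θ t ⟨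
    + (Θ * t)               ≤⟨ ℤ.+≤+ Θt≤p ⟩
    + p                     ∎
    where
    open ℤP.≤-Reasoning
    t = total ∸ p
    add-subtract : ∀ T p → T ≡ T ℤ.+ p ℤ.- p
    add-subtract = ℤR.solve-∀
    T≤ : T ℤ.≤ + t
    T≤ = begin
      T                              ≡⟨ add-subtract T (+ p) ⟩
      T ℤ.+ + p ℤ.- + p              ≤⟨ ℤP.+-monoˡ-≤ (ℤ.- + p) T+p≤ ⟩
      + total ℤ.- + p                ≡⟨ ℤP.m-n≡m⊖n total p ⟩
      total ℤ.⊖ p                    ≤⟨ ℤP.⊖-monoˡ-≤ p (m≤n+m∸n total p) ⟩
      (p + t) ℤ.⊖ p                  ≡⟨ ℤP.⊖-≥ (m≤m+n p t) ⟩
      + (p + t ∸ p)                  ≡⟨ ≡.cong +_ (m+n∸m≡n p t) ⟩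
      + t                            ∎
    Θt≤p : Θ * t ≤ p
    Θt≤p with ≤-total p total
    ... | inj₁ p≤total = bound t (≤-reflexive (m∸n+n≡m p≤total))
    ... | inj₂ total≤p = ≤-trans (≤-reflexive (≡.trans (≡.cong (Θ *_) (m≤n⇒m∸n≡0 total≤p)) (*-zeroʳ Θ))) z≤n

  square-+-≤ : ∀ a b → (a + b) * (a + b) ≤ 2 * (a * a) + 2 * (b * b)
  square-+-≤ a b with ≤-total a b
  ... | inj₁ a≤b = ≡.subst (λ c → (a + c) * (a + c) ≤ 2 * (a * a) + 2 * (c * c)) (m+[n∸m]≡n a≤b)
      (≤-trans (m≤m+n _ ((b ∸ a) * (b ∸ a))) (≤-reflexive (identity a (b ∸ a))))
    where
    identity : ∀ a k → (a + (a + k)) * (a + (a + k)) + k * k ≡ 2 * (a * a) + 2 * ((a + k) * (a + k))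
    identity = solve-∀
  ... | inj₂ b≤a = ≡.subst (λ c → (c + b) * (c + b) ≤ 2 * (c * c) + 2 * (b * b)) (m+[n∸m]≡n b≤a)
      (≤-trans (m≤m+n _ ((a ∸ b) * (a ∸ b))) (≤-reflexive (identity b (a ∸ b))))
    where
    identity : ∀ b k → (b + k + b) * (b + k + b) + k * k ≡ 2 * ((b + k) * (b + k)) + 2 * (b * b)
    identity = solve-∀

  -- Two uses of (a + b)² ≤ 2 a² + 2 b² give 60 = 2 (2 · 3 + 2 · 4) + 2 · 16. Here 3 comes from the
  -- second moment, 4 from the squared boundary error 2 m H of the windows, and 16 from the squared
  -- telescoping error 4 m. H³ ≤ p² absorbs both errors into the main term.
  combineBounds : ∀ H p m u τ s → 1 ≤ H → 1 ≤ m → H * H * H ≤ p * p →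
                  u ≤ τ + 4 * m → H * τ ≤ s + H * (2 * m * H) →
                  s * s ≤ p * (m * (3 * p * (H * (m * m)))) →
                  H * (u * u) ≤ 60 * (p * p * (m * m * m))
  combineBounds H@(suc _) p m@(suc m′) u τ s _ _ H³≤p² u≤ Hτ≤ s²≤ = *-cancelˡ-≤ H (begin
    H * (H * (u * u))                                    ≤⟨ *-monoʳ-≤ H (*-monoʳ-≤ H (≤-trans (*-mono-≤ u≤ u≤) (square-+-≤ τ (4 * m)))) ⟩
    H * (H * (2 * (τ * τ) + 2 * (4 * m * (4 * m))))      ≡⟨ split H τ m ⟩
    2 * (H * τ * (H * τ)) + 32 * (m * m * (H * H))
      ≤⟨ +-mono-≤ (*-monoʳ-≤ 2 (≤-trans (*-mono-≤ Hτ≤ Hτ≤) (square-+-≤ s (H * (2 * m * H)))))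
                     (*-monoʳ-≤ 32 small₂) ⟩
    2 * (2 * (s * s) + 2 * (H * (2 * m * H) * (H * (2 * m * H)))) + 32 * Y
      ≤⟨ +-monoˡ-≤ (32 * Y) (*-monoʳ-≤ 2 (+-mono-≤ (*-monoʳ-≤ 2 s²≤)
           (*-monoʳ-≤ 2 (≤-trans (≤-reflexive (quartic H m)) (*-monoʳ-≤ 4 small₄))))) ⟩
    2 * (2 * (p * (m * (3 * p * (H * (m * m))))) + 2 * (4 * Y)) + 32 * Y
      ≡⟨ collect p m H ⟩
    H * (60 * (p * p * (m * m * m)))                     ∎)
    where
    open ≤-Reasoning
    Y = p * p * (H * (m * m * m))
    split : ∀ H τ m → H * (H * (2 * (τ * τ) + 2 * (4 * m * (4 * m)))) ≡ 2 * (H * τ * (H * τ)) + 32 * (m * m * (H * H))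
    split = solve-∀
    quartic : ∀ H m → H * (2 * m * H) * (H * (2 * m * H)) ≡ 4 * (m * m * (H * (H * H * H)))
    quartic = solve-∀
    collect : ∀ p m H → let Y = p * p * (H * (m * m * m)) in
              2 * (2 * (p * (m * (3 * p * (H * (m * m))))) + 2 * (4 * Y)) + 32 * Y ≡ H * (60 * (p * p * (m * m * m)))
    collect = solve-∀
    m²≤m³ : m * m ≤ m * m * m
    m²≤m³ = m≤m*n (m * m) m
    small₄ : m * m * (H * (H * H * H)) ≤ Y
    small₄ = begin
      m * m * (H * (H * H * H))           ≤⟨ *-mono-≤ m²≤m³ (*-monoʳ-≤ H H³≤p²) ⟩
      m * m * m * (H * (p * p))           ≡⟨ swap m H p ⟩
      Y                                   ∎
      where
      swap : ∀ m H p → m * m * m * (H * (p * p)) ≡ p * p * (H * (m * m * m))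
      swap = solve-∀
    small₂ : m * m * (H * H) ≤ Y
    small₂ = ≤-trans (*-monoʳ-≤ (m * m) (*-monoʳ-≤ H (m≤n*m H (H * H)))) small₄

-- Bounds for sums of products of shifted Legendre symbols.

module CharacterSums (h : ℕ) (isPrime : Prime (suc (h ℕ.+ h))) where
  open Estimates
  open PrimeField h isPrime
  open ShiftedProducts h isPrime
  open Stepanov h isPrime
  open CommutativeRing primeRing hiding (zero; +-rawMagma)

  χ : Polynomial → ℕ → ℤ
  χ F n = legendre p (Defs.eval p F n)

  χ-sign : ∀ F n → SignOf (χ F n) (eval F n ^ h)
  χ-sign F n = SignOf-cong (^-congˡ h (reduce (eval F n))) (legendre-sign (Defs.eval p F n))

  prodχ : List ℕ → Polynomial → ℕ → ℤ
  prodχ []      F n = + 1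
  prodχ (j ∷ S) F n = χ F (n ℕ.+ j) ℤ.* prodχ S F n

  prodχ-sign : ∀ S F n → SignOf (prodχ S F n) (eval (prodShift S F) n ^ h)
  prodχ-sign []      F n = plus (trans (^-congˡ h (eval-𝟙 n)) (1^ h))
  prodχ-sign (j ∷ S) F n = SignOf-cong (begin
      eval F (n + j) ^ h * eval (prodShift S F) n ^ h             ≈⟨ *-congʳ (^-congˡ h (eval-shift j F n)) ⟨
      eval (shift j F) n ^ h * eval (prodShift S F) n ^ h         ≈⟨ ^-distrib-* (eval (shift j F) n) (eval (prodShift S F) n) h ⟨
      (eval (shift j F) n * eval (prodShift S F) n) ^ h           ≈⟨ ^-congˡ h (eval-⊗ (shift j F) (prodShift S F) n) ⟨
      eval (prodShift (j ∷ S) F) n ^ h                            ∎)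
    (SignOf-* (χ-sign F (n ℕ.+ j)) (prodχ-sign S F n))
    where
    open K-Reasoning
    open import Algebra.Properties.CommutativeSemiring.Exp commutativeSemiring using (^-distrib-*)

  eval-prodShift-translate : ∀ S F c x → eval (prodShift (map (ℕ._+ c) S) F) x ≈ₚ eval (prodShift S F) (x + c)
  eval-prodShift-translate []      F c x = trans (eval-𝟙 x) (sym (eval-𝟙 (x + c)))
  eval-prodShift-translate (j ∷ S) F c x = begin
    eval (shift (j + c) F ⊗ prodShift (map (ℕ._+ c) S) F) x
      ≈⟨ eval-⊗ (shift (j + c) F) (prodShift (map (ℕ._+ c) S) F) x ⟩
    eval (shift (j + c) F) x * eval (prodShift (map (ℕ._+ c) S) F) x
      ≈⟨ *-cong translate (eval-prodShift-translate S F c x) ⟩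
    eval (shift j F) (x + c) * eval (prodShift S F) (x + c)
      ≈⟨ eval-⊗ (shift j F) (prodShift S F) (x + c) ⟨
    eval (shift j F ⊗ prodShift S F) (x + c) ∎
    where
    open K-Reasoning
    translate : eval (shift (j + c) F) x ≈ₚ eval (shift j F) (x + c)
    translate = trans (eval-shift (j + c) F x)
      (trans (eval-congʳ F (≡⇒≈ₚ (≡.trans (≡.cong (x ℕ.+_) (ℕP.+-comm j c)) (≡.sym (ℕP.+-assoc x c j)))))
        (sym (eval-shift j F (x + c))))

  nonRoot : ∀ {q f} → Deg< (suc q) f → f ≇ [] → q ℕ.< p → ∃[ c ] eval f c ≉ 0
  nonRoot {q} {f} bf f≇0 q<p = extract (FinP.¬∀⟶∃¬ p (λ i → eval f (toℕ i) ≈ₚ 0) (λ i → eval f (toℕ i) ≟ₚ 0) allRoots)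
    where
    extract : (∃[ i ] ¬ eval f (toℕ {p} i) ≈ₚ 0) → ∃[ c ] eval f c ≉ 0
    extract (i , n) = toℕ i , n
    allRoots : ¬ (∀ (i : Fin p) → eval f (toℕ i) ≈ₚ 0)
    allRoots roots = ℕP.<-irrefl (length-applyUpTo (λ i → i) p) (ℕP.<-≤-trans
      (simpleRootsBound (applyUpTo (λ i → i) p) f (suc q)
        (AllPairsP.applyUpTo⁺₁ (λ i → i) p (λ i<j j<p eq → ℕP.<⇒≢ i<j (small-injective (ℕP.<-trans i<j j<p) j<p eq)))
        (AllP.applyUpTo⁺₁ (λ i → i) p (λ i<p → ≡.subst (λ k → eval f k ≈ₚ 0) (FinP.toℕ-fromℕ< i<p) (roots (fromℕ< i<p))))
        f≇0 bf) q<p)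

  ≈⇒indicator : ∀ {a b} → a ≈ₚ b → indicator (a ≟ₚ b) ≡ 1
  ≈⇒indicator {a} {b} eq with a ≟ₚ b
  ... | yes _ = ≡.refl
  ... | no n  = ⊥-elim (n eq)

  private
    accept₀ : ∀ {a} b → a ≈ₚ 0 → + 1 ℤ.≤ + (2 ℕ.* indicator (a ≟ₚ b) ℕ.+ indicator (a ≟ₚ 0))
    accept₀ {a} b eq = ℤ.+≤+ (ℕP.≤-trans (ℕP.≤-reflexive (≡.sym (≈⇒indicator eq))) (ℕP.m≤n+m _ (2 ℕ.* indicator (a ≟ₚ b))))

    accept : ∀ {a b} → a ≈ₚ b → + 2 ℤ.≤ + (2 ℕ.* indicator (a ≟ₚ b) ℕ.+ indicator (a ≟ₚ 0))
    accept {a} {b} eq = ℤ.+≤+ (ℕP.≤-trans (ℕP.≤-reflexive (≡.cong (2 ℕ.*_) (≡.sym (≈⇒indicator eq)))) (ℕP.m≤m+n _ _))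

  plus-bound : ∀ {z b} → SignOf z b → z ℤ.+ + 1 ℤ.≤ + (2 ℕ.* indicator (b ≟ₚ 1) ℕ.+ indicator (b ≟ₚ 0))
  plus-bound (zero eq)  = accept₀ 1 eq
  plus-bound (plus eq)  = accept eq
  plus-bound (minus eq) = ℤ.+≤+ z≤n

  minus-bound : ∀ {z b} → SignOf z b → ℤ.- z ℤ.+ + 1 ℤ.≤ + (2 ℕ.* indicator (b ≟ₚ (- 1)) ℕ.+ indicator (b ≟ₚ 0))
  minus-bound (zero eq)  = accept₀ (- 1) eq
  minus-bound (plus eq)  = ℤ.+≤+ z≤n
  minus-bound (minus eq) = accept eq

  selection-distinct : ∀ {P : ℕ → Set} (P? : ∀ i → Dec (P i)) → AllPairs _≉_ (filter P? (downFrom p))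
  selection-distinct P? = AllPairsP.filter⁺ P? (AllPairsP.applyDownFrom⁺₁ (λ i → i) p
    (λ j<i i<p eq → ℕP.<⇒≢ j<i (≡.sym (small-injective i<p (ℕP.<-trans j<i i<p) eq))))

  opaque
    level : (ℕ → ℕ) → ℕ → List ℕ
    level value α = filter (λ i → value i ≟ₚ α) (downFrom p)

    level-value : ∀ value α → All (λ i → value i ≈ₚ α) (level value α)
    level-value value α = AllP.all-filter (λ i → value i ≟ₚ α) (downFrom p)

    level-distinct : ∀ value α → AllPairs _≉_ (level value α)
    level-distinct value α = selection-distinct (λ i → value i ≟ₚ α)

    level-count : ∀ value α z →
      (∀ i → z i ℤ.+ + 1 ℤ.≤ + (2 ℕ.* indicator (value i ≟ₚ α) ℕ.+ indicator (value i ≟ₚ 0))) →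
      sumTo p z ℤ.+ + p ℤ.≤ + (2 ℕ.* length (level value α) ℕ.+ length (level value 0))
    level-count value α z bound = sumTo-count (λ i → value i ≟ₚ α) (λ i → value i ≟ₚ 0) z bound p

  zero-power : ∀ a → a ^ h ≈ₚ 0 → a ≈ₚ 0
  zero-power a eq with a ≟ₚ 0
  ... | yes q = q
  ... | no  q = ⊥-elim (power-nonzero h q eq)

  suc-injectiveₚ : ∀ x y → suc x ≈ₚ suc y → x ≈ₚ y
  suc-injectiveₚ x y = ∙-cancelˡ 1 x y
    where open import Algebra.Properties.Group +-group using (∙-cancelˡ)

  translate-injective : ∀ c x y → suc x + c ≈ₚ suc y + c → x ≈ₚ y
  translate-injective c x y eq = suc-injectiveₚ x y (∙-cancelʳ c (suc x) (suc y) eq)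
    where open import Algebra.Properties.Group +-group using (∙-cancelʳ)

  distinct-image : ∀ (φ : ℕ → ℕ) → (∀ x y → φ x ≈ₚ φ y → x ≈ₚ y) →
                   ∀ {xs} → AllPairs _≉_ xs → AllPairs _≉_ (map φ xs)
  distinct-image φ injective {xs} distinct = AllPairsP.map⁺ {R = _≉_} {f = φ} {xs = xs}
    (AllPairs.map (λ {x} {y} n eq → n (injective x y eq)) distinct)

  module Bounds
    (F : Polynomial) (d : ℕ) (dF : Degree F d) (1≤d : 1 ℕ.≤ d)
    (squareFree : ∀ G e H → 1 ℕ.≤ e → Degree G e → ¬ G ⊗ G ⊗ H ≋ F)
    (w : ℕ) (window : d ℕ.* suc w ℕ.< p)
    (Θ : ℕ) (parameters : StepanovParameters Θ) (Θ≤p : Θ ℕ.^ 16 ℕ.≤ p) where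

    open NonSquare F d dF 1≤d squareFree w window
    open StepanovParameters parameters

    module _ (j : ℕ) (S : List ℕ) (near : All (λ i → j ℕ.< i × i ℕ.≤ j ℕ.+ w) S) (short : length (j ∷ S) ℕ.* d ℕ.≤ Θ) where

      private
        f = prodShift (j ∷ S) F
        dimension : ∀ T → length T ≡ length (j ∷ S) → Deg< (suc Θ) (prodShift T F)
        dimension T eq = deg-mono (s≤s (ℕP.≤-trans (ℕP.≤-reflexive (≡.cong (ℕ._* d) eq)) short)) (bounded (degree-prodShift T dF))
        f≇0 : f ≇ []
        f≇0 = degree-nonzero (degree-prodShift (j ∷ S) dF)
        Θ<p : Θ ℕ.< p
        Θ<p = ℕP.<-≤-trans (ℕP.m<n+m Θ {suc b ℕ.+ suc b} (s≤s z≤n)) (ℕP.≤-trans room Θ≤p)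
        value : ℕ → ℕ
        value i = eval f (suc i) ^ h
        selected : ℕ → List ℕ
        selected = level value

      zeros-few : length (selected 0) ℕ.≤ Θ
      zeros-few = ℕP.≤-pred (≡.subst (ℕ._< suc Θ) (length-map suc (selected 0))
        (simpleRootsBound (map suc (selected 0)) f (suc Θ)
          (distinct-image suc suc-injectiveₚ (level-distinct value 0))
          (AllP.map⁺ (All.map (λ {i} → zero-power (eval f (suc i))) (level-value value 0)))
          f≇0 (dimension (j ∷ S) ≡.refl)))

      -- The independence argument divides modulo X^p and needs f(0) to be nonzero. As deg f < p
      -- there is a c with f(c) nonzero; moving f and the points by c reduces to this case and keeps
      -- all values and all differences of shifts.
      level-few : ∀ α → length (selected α) ℕ.* M ℕ.≤ M ℕ.* Θ ℕ.+ (J ℕ.* p ℕ.+ (h ℕ.* Θ ℕ.+ suc b))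
      level-few α = fromNonRoot (nonRoot (dimension (j ∷ S) ≡.refl) f≇0 Θ<p)
        where
        fromNonRoot : (∃[ c ] eval f c ≉ 0) → length (selected α) ℕ.* M ℕ.≤ M ℕ.* Θ ℕ.+ (J ℕ.* p ℕ.+ (h ℕ.* Θ ℕ.+ suc b))
        fromNonRoot (c , fc≉0) = ℕP.<⇒≤ (≡.subst (λ l → l ℕ.* M ℕ.< _) (length-map point (selected α))
            (stepanov α J M (ℕP.≤-trans M-small Θ≤p) enoughUnknowns (map point (selected α))
              (distinct-image point (translate-injective (- c)) (level-distinct value α))
              (AllP.map⁺ (All.map (λ {i} eq → trans (^-congˡ h (same-value i)) eq) (level-value value α)))))
          where
          S′ = map (ℕ._+ c) S
          f′ = prodShift (j ℕ.+ c ∷ S′) F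
          point : ℕ → ℕ
          point i = suc i + - c
          same-value : ∀ i → eval f′ (point i) ≈ₚ eval f (suc i)
          same-value i = trans (eval-prodShift-translate (j ∷ S) F c (point i)) (eval-congʳ f (begin
            suc i + - c + c             ≈⟨ +-assoc (suc i) (- c) c ⟩
            suc i + (- c + c)           ≈⟨ +-congˡ {suc i} (-‿inverseˡ c) ⟩
            suc i + 0                   ≈⟨ +-identityʳ (suc i) ⟩
            suc i                       ∎))
            where open K-Reasoning
          f′0 : eval f′ 0 ≉ 0
          f′0 eq = fc≉0 (trans (sym (eval-prodShift-translate (j ∷ S) F c 0)) eq)
          near′ : All (λ i → j ℕ.+ c ℕ.< i × i ℕ.≤ j ℕ.+ c ℕ.+ w) S′
          near′ = AllP.map⁺ (All.map (λ { {i} (j<i , i≤) → ℕP.+-monoˡ-< c j<i ,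
            ℕP.≤-trans (ℕP.+-monoˡ-≤ c i≤) (ℕP.≤-reflexive (≡.trans (ℕP.+-assoc j w c)
              (≡.trans (≡.cong (j ℕ.+_) (ℕP.+-comm w c)) (≡.sym (ℕP.+-assoc j c w))))) }) near)
          open Auxiliary f′ Θ (dimension (j ℕ.+ c ∷ S′) (≡.cong suc (length-map (ℕ._+ c) S)))
          open Bound b (ℕP.≤-trans room Θ≤p) f′0
            (λ u v du eq → nonsquare (j ℕ.+ c) S′ near′ (eval f′ 0) f′0 (suc b) u v du eq)

      private
        conclusion : ∀ α (z : ℕ → ℤ) → (∀ i → z i ℤ.+ + 1 ℤ.≤ + (2 ℕ.* indicator (value i ≟ₚ α) ℕ.+ indicator (value i ≟ₚ 0))) →
                     + Θ ℤ.* sumTo p z ℤ.≤ + p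
        conclusion α z bound = excessBound Θ p (2 ℕ.* length (selected α) ℕ.+ length (selected 0)) (sumTo p z)
          (level-count value α z bound)
          (λ t → excess p h (length (selected α)) (length (selected 0)) t Θ≤p (ℕP.n≤1+n (h ℕ.+ h)) zeros-few (level-few α))

      characterSum≤ : + Θ ℤ.* sumTo p (λ i → prodχ (j ∷ S) F (suc i)) ℤ.≤ + p
      characterSum≤ = conclusion 1 (λ i → prodχ (j ∷ S) F (suc i)) (λ i → plus-bound (prodχ-sign (j ∷ S) F (suc i)))

      -- Stepanov's method bounds numbers of points only from above, so the lower bound for the sum
      -- comes from an upper bound for the points where f^h = -1.
      characterSum≥ : + Θ ℤ.* sumTo p (λ i → ℤ.- prodχ (j ∷ S) F (suc i)) ℤ.≤ + p
      characterSum≥ = conclusion (- 1) (λ i → ℤ.- prodχ (j ∷ S) F (suc i)) (λ i → minus-bound (prodχ-sign (j ∷ S) F (suc i)))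

-- Random walks on sign patterns and the frequency of each pattern.

module SignPatterns where
  open import Data.Integer using (_+_; _*_; _≤_; ∣_∣; _≟_; +≤+; -≤+)
  open import Data.Integer.Properties
  open import Data.Integer.Tactic.RingSolver using (solve-∀)
  open import Relation.Nullary using (does)
  open import Relation.Binary.PropositionalEquality using (refl)
  open Estimates

  sumTo-cong : ∀ n {f g} → (∀ i → f i ≡ g i) → sumTo n f ≡ sumTo n g
  sumTo-cong zero    eq = refl
  sumTo-cong (suc n) eq = ≡.cong₂ _+_ (eq n) (sumTo-cong n eq)

  sumTo-mono : ∀ n {f g} → (∀ i → f i ≤ g i) → sumTo n f ≤ sumTo n g
  sumTo-mono zero    le = ≤-refl
  sumTo-mono (suc n) le = +-mono-≤ (le n) (sumTo-mono n le)

  sumTo-+ : ∀ n f g → sumTo n (λ i → f i + g i) ≡ sumTo n f + sumTo n g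
  sumTo-+ zero    f g = refl
  sumTo-+ (suc n) f g = ≡.trans (≡.cong (λ u → f n + g n + u) (sumTo-+ n f g)) (swap (f n) (g n) (sumTo n f) (sumTo n g))
    where
    swap : ∀ a b c d → a + b + (c + d) ≡ (a + c) + (b + d)
    swap = solve-∀

  sumTo-* : ∀ n c f → sumTo n (λ i → c * f i) ≡ c * sumTo n f
  sumTo-* zero    c f = ≡.sym (*-zeroʳ c)
  sumTo-* (suc n) c f = ≡.trans (≡.cong (λ u → c * f n + u) (sumTo-* n c f)) (≡.sym (*-distribˡ-+ c (f n) (sumTo n f)))

  sumTo-const : ∀ n c → sumTo n (λ _ → c) ≡ + n * c
  sumTo-const zero    c = ≡.sym (*-zeroˡ c)
  sumTo-const (suc n) c = ≡.trans (≡.cong (λ u → c + u) (sumTo-const n c)) (≡.sym (suc-* (+ n) c))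

  sumTo-nonneg : ∀ n {f} → (∀ i → + 0 ≤ f i) → + 0 ≤ sumTo n f
  sumTo-nonneg zero    f≥0 = ≤-refl
  sumTo-nonneg (suc n) f≥0 = +-mono-≤ (f≥0 n) (sumTo-nonneg n f≥0)

  sumTo-single : ∀ n {f} → (∀ i → + 0 ≤ f i) → ∀ k → k ℕ.< n → f k ≤ sumTo n f
  sumTo-single (suc n) {f} f≥0 k (s≤s k≤n) with k ℕP.≟ n
  ... | yes refl = ≤-trans (≤-reflexive (≡.sym (+-identityʳ (f k)))) (+-monoʳ-≤ (f k) (sumTo-nonneg n f≥0))
  ... | no  k≢n  = ≤-trans (sumTo-single n f≥0 k (ℕP.≤∧≢⇒< k≤n k≢n))
                     (≤-trans (≤-reflexive (≡.sym (+-identityˡ (sumTo n f)))) (+-monoˡ-≤ (sumTo n f) (f≥0 n)))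

  sumTo-swap : ∀ n m (f : ℕ → ℕ → ℤ) → sumTo n (λ i → sumTo m (f i)) ≡ sumTo m (λ j → sumTo n (λ i → f i j))
  sumTo-swap zero    m f = ≡.sym (≡.trans (sumTo-const m (+ 0)) (*-zeroʳ (+ m)))
  sumTo-swap (suc n) m f = ≡.trans (≡.cong (λ u → sumTo m (f n) + u) (sumTo-swap n m f))
    (≡.sym (sumTo-+ m (f n) (λ j → sumTo n (λ i → f i j))))

  square-nonneg : ∀ i → + 0 ≤ i * i
  square-nonneg (+ n)    = ≡.subst (+ 0 ≤_) (pos-* n n) (+≤+ z≤n)
  square-nonneg -[1+ n ] = +≤+ z≤n

  product-nonneg : ∀ {i j} → + 0 ≤ i → + 0 ≤ j → + 0 ≤ i * j
  product-nonneg {+ m} {+ n} _ _ = ≡.subst (+ 0 ≤_) (pos-* m n) (+≤+ z≤n)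

  data Trit : ℤ → Set where
    negative : Trit -[1+ 0 ]
    null     : Trit (+ 0)
    positive : Trit (+ 1)

  data IsSign : ℤ → Set where
    plus  : IsSign (+ 1)
    minus : IsSign -[1+ 0 ]

  ∣sign*∣ : ∀ {c} → IsSign c → ∀ i → ∣ c * i ∣ ≡ ∣ i ∣
  ∣sign*∣ plus  i = ≡.cong ∣_∣ (*-identityˡ i)
  ∣sign*∣ minus i = ≡.trans (≡.cong ∣_∣ (-1*i≡-i i)) (∣-i∣≡∣i∣ i)

  IsSign-* : ∀ {c e} → IsSign c → IsSign e → IsSign (c * e)
  IsSign-* plus  plus  = plus
  IsSign-* plus  minus = minus
  IsSign-* minus plus  = minus
  IsSign-* minus minus = plus

  sgn : Bool → ℤ
  sgn true  = + 1
  sgn false = -[1+ 0 ]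

  sgn-sign : ∀ b → IsSign (sgn b)
  sgn-sign true  = plus
  sgn-sign false = minus

  sumPatterns : ℕ → (List Bool → ℤ) → ℤ
  sumPatterns zero    f = f []
  sumPatterns (suc l) f = sumPatterns l (λ w → f (true ∷ w) + f (false ∷ w))

  sumPatterns-mono : ∀ l {f g} → (∀ w → length w ≡ l → f w ≤ g w) → sumPatterns l f ≤ sumPatterns l g
  sumPatterns-mono zero    le = le [] refl
  sumPatterns-mono (suc l) le = sumPatterns-mono l (λ w eq → +-mono-≤ (le _ (≡.cong suc eq)) (le _ (≡.cong suc eq)))

  sumPatterns-cong : ∀ l {f g} → (∀ w → f w ≡ g w) → sumPatterns l f ≡ sumPatterns l g
  sumPatterns-cong zero    eq = eq []
  sumPatterns-cong (suc l) eq = sumPatterns-cong l (λ w → ≡.cong₂ _+_ (eq _) (eq _))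

  sumPatterns-single : ∀ l {f} → (∀ w → + 0 ≤ f w) → ∀ w → length w ≡ l → f w ≤ sumPatterns l f
  sumPatterns-single zero    f≥0 []          _  = ≤-refl
  sumPatterns-single (suc l) {f} f≥0 (true ∷ w)  eq = ≤-trans
    (≤-trans (≤-reflexive (≡.sym (+-identityʳ (f (true ∷ w))))) (+-monoʳ-≤ (f (true ∷ w)) (f≥0 (false ∷ w))))
    (sumPatterns-single l (λ w → +-mono-≤ (f≥0 (true ∷ w)) (f≥0 (false ∷ w))) w (ℕP.suc-injective eq))
  sumPatterns-single (suc l) {f} f≥0 (false ∷ w) eq = ≤-trans
    (≤-trans (≤-reflexive (≡.sym (+-identityˡ (f (false ∷ w))))) (+-monoˡ-≤ (f (false ∷ w)) (f≥0 (true ∷ w))))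
    (sumPatterns-single l (λ w → +-mono-≤ (f≥0 (true ∷ w)) (f≥0 (false ∷ w))) w (ℕP.suc-injective eq))

  sumPatterns-+ : ∀ l f g → sumPatterns l (λ w → f w + g w) ≡ sumPatterns l f + sumPatterns l g
  sumPatterns-+ zero    f g = refl
  sumPatterns-+ (suc l) f g = ≡.trans (sumPatterns-cong l (λ w → swap (f (true ∷ w)) (g (true ∷ w)) (f (false ∷ w)) (g (false ∷ w))))
    (sumPatterns-+ l _ _)
    where
    swap : ∀ a b c d → a + b + (c + d) ≡ (a + c) + (b + d)
    swap = solve-∀

  sumPatterns-* : ∀ l c f → sumPatterns l (λ w → c * f w) ≡ c * sumPatterns l f
  sumPatterns-* zero    c f = refl
  sumPatterns-* (suc l) c f = ≡.trans (sumPatterns-cong l (λ w → ≡.sym (*-distribˡ-+ c (f (true ∷ w)) (f (false ∷ w)))))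
    (sumPatterns-* l c _)

  sumPatterns-const : ∀ l c → sumPatterns l (λ _ → c) ≡ + (2 ℕ.^ l) * c
  sumPatterns-const zero    c = ≡.sym (*-identityˡ c)
  sumPatterns-const (suc l) c = ≡.trans (sumPatterns-const l (c + c)) (≡.trans (double (+ (2 ℕ.^ l)) c)
    (≡.cong (_* c) (≡.sym (pos-* 2 (2 ℕ.^ l)))))
    where
    double : ∀ t c → t * (c + c) ≡ (+ 2 * t) * c
    double = solve-∀

  sumTo-sumPatterns : ∀ n l (f : ℕ → List Bool → ℤ) →
                      sumTo n (λ i → sumPatterns l (f i)) ≡ sumPatterns l (λ w → sumTo n (λ i → f i w))
  sumTo-sumPatterns n zero    f = refl
  sumTo-sumPatterns n (suc l) f = ≡.trans (sumTo-sumPatterns n l (λ i w → f i (true ∷ w) + f i (false ∷ w)))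
    (sumPatterns-cong l (λ w → sumTo-+ n (λ i → f i (true ∷ w)) (λ i → f i (false ∷ w))))

  -- Patterns list the most recent step first.
  rises : List Bool → ℕ
  rises []          = 0
  rises (true  ∷ w) = suc (rises w)
  rises (false ∷ w) = rises w

  walk : (ℕ → ℤ) → List Bool → ℤ
  walk c []      = + 0
  walk c (b ∷ w) = walk c w + sgn b * c (rises w)

  walk-cong : ∀ {c c′} → (∀ v → c v ≡ c′ v) → ∀ w → walk c w ≡ walk c′ w
  walk-cong eq []      = refl
  walk-cong eq (b ∷ w) = ≡.cong₂ (λ x y → x + sgn b * y) (walk-cong eq w) (eq (rises w))

  -- The steps are orthogonal (a martingale): the two signs of the last step cancel the cross terms.
  walk-variance : ∀ l (c : ℕ → ℤ) B → (∀ v → c v * c v ≤ B) →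
                  sumPatterns l (λ w → walk c w * walk c w) ≤ + (2 ℕ.^ l) * (+ l * B)
  walk-variance zero    c B c²≤B = ≤-reflexive (≡.sym (≡.trans (*-identityˡ (+ 0 * B)) (*-zeroˡ B)))
  walk-variance (suc l) c B c²≤B = begin
    sumPatterns l (λ w → square (walk c w + + 1 * c (rises w)) + square (walk c w + -[1+ 0 ] * c (rises w)))
      ≡⟨ sumPatterns-cong l (λ w → parallelogram (walk c w) (c (rises w))) ⟩
    sumPatterns l (λ w → + 2 * square (walk c w) + + 2 * square (c (rises w)))
      ≤⟨ sumPatterns-mono l (λ w _ → +-monoʳ-≤ (+ 2 * square (walk c w)) (*-monoˡ-≤-nonNeg (+ 2) (c²≤B (rises w)))) ⟩
    sumPatterns l (λ w → + 2 * square (walk c w) + + 2 * B)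
      ≡⟨ sumPatterns-+ l (λ w → + 2 * square (walk c w)) (λ _ → + 2 * B) ⟩
    sumPatterns l (λ w → + 2 * square (walk c w)) + sumPatterns l (λ _ → + 2 * B)
      ≡⟨ ≡.cong₂ _+_ (sumPatterns-* l (+ 2) (λ w → square (walk c w))) (sumPatterns-const l (+ 2 * B)) ⟩
    + 2 * sumPatterns l (λ w → square (walk c w)) + t * (+ 2 * B)
      ≤⟨ +-monoˡ-≤ (t * (+ 2 * B)) (*-monoˡ-≤-nonNeg (+ 2) (walk-variance l c B c²≤B)) ⟩
    + 2 * (t * (+ l * B)) + t * (+ 2 * B)
      ≡⟨ collect t (+ l) B ⟩
    (+ 2 * t) * ((+ 1 + + l) * B)
      ≡⟨ ≡.cong (_* (+ suc l * B)) (pos-* 2 (2 ℕ.^ l)) ⟨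
    + (2 ℕ.^ suc l) * (+ suc l * B) ∎
    where
    open ≤-Reasoning
    t = + (2 ℕ.^ l)
    square : ℤ → ℤ
    square x = x * x
    parallelogram : ∀ a c → (a + + 1 * c) * (a + + 1 * c) + (a + -[1+ 0 ] * c) * (a + -[1+ 0 ] * c) ≡ + 2 * (a * a) + + 2 * (c * c)
    parallelogram = solve-∀
    collect : ∀ t l B → + 2 * (t * (l * B)) + t * (+ 2 * B) ≡ (+ 2 * t) * ((+ 1 + l) * B)
    collect = solve-∀

  module Patterns
    (χ : ℕ → ℤ) (trit : ∀ n → Trit (χ n)) {σ : ℤ} (σ-sign : IsSign σ) (p H d : ℕ) where

    Θ : ℕ
    Θ = 2 ℕ.^ H

    instance
      Θ≢0 : ℕ.NonZero Θ
      Θ≢0 = ℕP.m^n≢0 2 H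

    product : List ℕ → ℕ → ℤ
    product []      n = + 1
    product (j ∷ S) n = χ (n ℕ.+ j) * product S n

    isHit : ℕ → Bool
    isHit n = does (χ n ≟ σ)

    isZero : ℕ → ℤ
    isZero n = + indicator (χ n ≟ + 0)

    pattern-at : ℕ → ℕ → List Bool
    pattern-at i zero    = []
    pattern-at i (suc l) = isHit (i ℕ.+ suc l) ∷ pattern-at i l

    length-pattern-at : ∀ i l → length (pattern-at i l) ≡ l
    length-pattern-at i zero    = refl
    length-pattern-at i (suc l) = ≡.cong suc (length-pattern-at i l)

    factor : ℕ → ℕ → Bool → ℤ
    factor i l b = + 1 + σ * sgn b * χ (i ℕ.+ suc l)

    -- If no symbol in the window vanishes, this is 2^l when `w` is the pattern at `i` and 0
    -- otherwise, so its sum over `i` counts occurrences. Expanded, it is a combination of products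
    -- of symbols.
    weight : ℕ → List Bool → ℤ
    weight i []      = + 1
    weight i (b ∷ w) = factor i (length w) b * weight i w

    factor-nonneg : ∀ i l b → + 0 ≤ factor i l b
    factor-nonneg i l b = cases (IsSign-* σ-sign (sgn-sign b)) (trit (i ℕ.+ suc l))
      where
      cases : ∀ {c x} → IsSign c → Trit x → + 0 ≤ + 1 + c * x
      cases plus  negative = +≤+ z≤n
      cases plus  null     = +≤+ z≤n
      cases plus  positive = +≤+ z≤n
      cases minus negative = +≤+ z≤n
      cases minus null     = +≤+ z≤n
      cases minus positive = +≤+ z≤n

    weight-nonneg : ∀ i w → + 0 ≤ weight i w
    weight-nonneg i []      = +≤+ z≤n
    weight-nonneg i (b ∷ w) = product-nonneg (factor-nonneg i (length w) b) (weight-nonneg i w)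

    zeros : ℕ → ℕ → ℤ
    zeros i zero    = + 0
    zeros i (suc l) = isZero (i ℕ.+ suc l) + zeros i l

    zeros-nonneg : ∀ i l → + 0 ≤ zeros i l
    zeros-nonneg i zero    = +≤+ z≤n
    zeros-nonneg i (suc l) = +-mono-≤ (+≤+ z≤n) (zeros-nonneg i l)

    factor-hit : ∀ i l → + 2 ≤ factor i l (isHit (i ℕ.+ suc l)) + + 2 * isZero (i ℕ.+ suc l)
    factor-hit i l = cases σ-sign (trit (i ℕ.+ suc l))
      where
      cases : ∀ {c x} → IsSign c → Trit x → + 2 ≤ (+ 1 + c * sgn (does (x ≟ c)) * x) + + 2 * + indicator (x ≟ + 0)
      cases plus  negative = +≤+ ℕP.≤-refl
      cases plus  null     = +≤+ (s≤s (s≤s z≤n))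
      cases plus  positive = +≤+ ℕP.≤-refl
      cases minus negative = +≤+ ℕP.≤-refl
      cases minus null     = +≤+ (s≤s (s≤s z≤n))
      cases minus positive = +≤+ ℕP.≤-refl

    -- A vanishing symbol is recorded as a miss, and its factor is 1 instead of 2. Adding 2^l for
    -- each zero in the window restores the lower bound.
    weight-at-pattern : ∀ i l → + (2 ℕ.^ l) ≤ weight i (pattern-at i l) + + (2 ℕ.^ l) * zeros i l
    weight-at-pattern i zero    = +≤+ (s≤s z≤n)
    weight-at-pattern i (suc l) = begin
      + (2 ℕ.^ suc l)                     ≡⟨ pos-* 2 (2 ℕ.^ l) ⟩
      + 2 * t                             ≤⟨ bound (isZeroCases (χ (i ℕ.+ suc l) ≟ + 0)) ⟩
      f * k + + 2 * t * (z + zs)          ≡⟨ ≡.cong (λ u → factor i u (isHit (i ℕ.+ suc l)) * k + + 2 * t * (z + zs)) (length-pattern-at i l) ⟨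
      weight i (pattern-at i (suc l)) + + 2 * t * (z + zs)
        ≡⟨ ≡.cong (λ u → weight i (pattern-at i (suc l)) + u * (z + zs)) (pos-* 2 (2 ℕ.^ l)) ⟨
      weight i (pattern-at i (suc l)) + + (2 ℕ.^ suc l) * zeros i (suc l) ∎
      where
      open ≤-Reasoning
      t = + (2 ℕ.^ l)
      f = factor i l (isHit (i ℕ.+ suc l))
      k = weight i (pattern-at i l)
      z = isZero (i ℕ.+ suc l)
      zs = zeros i l
      isZeroCases : ∀ {P : Set} (P? : Dec P) → + indicator P? ≡ + 0 ⊎ + indicator P? ≡ + 1
      isZeroCases (yes _) = inj₂ refl
      isZeroCases (no _)  = inj₁ refl
      bound : z ≡ + 0 ⊎ z ≡ + 1 → + 2 * t ≤ f * k + + 2 * t * (z + zs)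
      bound (inj₁ eq) = begin
        + 2 * t                               ≤⟨ *-monoˡ-≤-nonNeg (+ 2) (weight-at-pattern i l) ⟩
        + 2 * (k + t * zs)                    ≡⟨ expand k t zs ⟩
        + 2 * k + + 2 * t * (+ 0 + zs)        ≤⟨ +-monoˡ-≤ _ (*-monoʳ-≤-nonNeg k {{ℤ.nonNegative (weight-nonneg i (pattern-at i l))}} 2≤f) ⟩
        f * k + + 2 * t * (+ 0 + zs)          ≡⟨ ≡.cong (λ u → f * k + + 2 * t * (u + zs)) eq ⟨
        f * k + + 2 * t * (z + zs)            ∎
        where
        expand : ∀ k t z → + 2 * (k + t * z) ≡ + 2 * k + + 2 * t * (+ 0 + z)
        expand = solve-∀
        2≤f : + 2 ≤ f
        2≤f = ≤-trans (factor-hit i l) (≤-reflexive (≡.trans (≡.cong (λ u → f + + 2 * u) eq) (+-identityʳ f)))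
      -- A zero at the new position: the correction alone already reaches 2 t, and of the weight
      -- only its sign is used.
      bound (inj₂ eq) = begin
        + 2 * t                               ≡⟨ expand (+ 2 * t) ⟩
        + 0 + + 2 * t * (+ 1 + + 0)
          ≤⟨ +-mono-≤ (product-nonneg (factor-nonneg i l (isHit (i ℕ.+ suc l))) (weight-nonneg i (pattern-at i l)))
               (*-monoˡ-≤-nonNeg (+ 2 * t) {{ℤ.nonNegative (product-nonneg {+ 2} {t} (+≤+ z≤n) (+≤+ z≤n))}} (+-monoʳ-≤ (+ 1) (zeros-nonneg i l))) ⟩
        f * k + + 2 * t * (+ 1 + zs)          ≡⟨ ≡.cong (λ u → f * k + + 2 * t * (u + zs)) eq ⟨
        f * k + + 2 * t * (z + zs)            ∎
        where
        expand : ∀ t → t ≡ + 0 + t * (+ 1 + + 0)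
        expand = solve-∀

    module _
      (characterSums : ∀ j S → 1 ℕ.≤ j → All (λ i → j ℕ.< i × i ℕ.≤ H) S → length (j ∷ S) ℕ.≤ H → j ℕ.≤ H →
                       Θ ℕ.* ∣ sumTo p (λ i → product (j ∷ S) (suc i)) ∣ ℕ.≤ p)
      (fewZeros : ∀ j → sumTo p (λ i → isZero (suc i ℕ.+ j)) ≤ + d)
      (large : Θ ℕ.* (H ℕ.* d) ℕ.≤ p) where

      -- A partially expanded product: the symbols at the positions in `S` have been picked, and the
      -- factors belonging to `w` are still to be expanded.
      correlation : List ℕ → List Bool → ℤ
      correlation S w = sumTo p (λ i → product S (suc i) * weight (suc i) w)

      correlation-∷ : ∀ S b w → correlation S (b ∷ w) ≡ correlation S w + σ * sgn b * correlation (suc (length w) ∷ S) w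
      correlation-∷ S b w = begin
        sumTo p (λ i → product S (suc i) * (factor (suc i) l b * weight (suc i) w))
          ≡⟨ sumTo-cong p (λ i → expand (product S (suc i)) (σ * sgn b) (χ (suc i ℕ.+ suc l)) (weight (suc i) w)) ⟩
        sumTo p (λ i → product S (suc i) * weight (suc i) w + σ * sgn b * (product (suc l ∷ S) (suc i) * weight (suc i) w))
          ≡⟨ sumTo-+ p (λ i → product S (suc i) * weight (suc i) w) (λ i → σ * sgn b * (product (suc l ∷ S) (suc i) * weight (suc i) w)) ⟩
        correlation S w + sumTo p (λ i → σ * sgn b * (product (suc l ∷ S) (suc i) * weight (suc i) w))
          ≡⟨ ≡.cong (λ u → correlation S w + u) (sumTo-* p (σ * sgn b) (λ i → product (suc l ∷ S) (suc i) * weight (suc i) w)) ⟩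
        correlation S w + σ * sgn b * correlation (suc l ∷ S) w ∎
        where
        open ≡.≡-Reasoning
        l = length w
        expand : ∀ P c x k → P * ((+ 1 + c * x) * k) ≡ P * k + c * (x * P * k)
        expand = solve-∀

      -- Expanding one factor 1 ± χ doubles the number of terms, and each final term is a character
      -- sum of size at most p / Θ. A newly picked position `suc (length w)` lies below all earlier
      -- ones, so the head of the list stays the smallest shift, as the bound for character sums
      -- requires.
      correlation-bound : ∀ w j S → length w ℕ.< j → j ℕ.≤ H → All (λ i → j ℕ.< i × i ℕ.≤ H) S →
                          length (j ∷ S) ℕ.+ length w ℕ.≤ H →
                          Θ ℕ.* ∣ correlation (j ∷ S) w ∣ ℕ.≤ 2 ℕ.^ length w ℕ.* p
      correlation-bound [] j S 0<j j≤H near len = ≡.subst (λ u → Θ ℕ.* ∣ u ∣ ℕ.≤ 1 ℕ.* p)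
        (sumTo-cong p (λ i → ≡.sym (*-identityʳ (product (j ∷ S) (suc i)))))
        (ℕP.≤-trans (characterSums j S 0<j near (ℕP.≤-trans (ℕP.m≤m+n _ 0) len) j≤H) (ℕP.≤-reflexive (≡.sym (ℕP.*-identityˡ p))))
      correlation-bound (b ∷ w) j S w<j j≤H near len = begin
        Θ ℕ.* ∣ correlation (j ∷ S) (b ∷ w) ∣           ≡⟨ ≡.cong (λ u → Θ ℕ.* ∣ u ∣) (correlation-∷ (j ∷ S) b w) ⟩
        Θ ℕ.* ∣ A + c * B ∣                             ≤⟨ ℕP.*-monoʳ-≤ Θ (∣i+j∣≤∣i∣+∣j∣ A (c * B)) ⟩
        Θ ℕ.* (∣ A ∣ ℕ.+ ∣ c * B ∣)                     ≡⟨ ≡.cong (λ u → Θ ℕ.* (∣ A ∣ ℕ.+ u)) (∣sign*∣ (IsSign-* σ-sign (sgn-sign b)) B) ⟩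
        Θ ℕ.* (∣ A ∣ ℕ.+ ∣ B ∣)                         ≡⟨ ℕP.*-distribˡ-+ Θ ∣ A ∣ ∣ B ∣ ⟩
        Θ ℕ.* ∣ A ∣ ℕ.+ Θ ℕ.* ∣ B ∣
          ≤⟨ ℕP.+-mono-≤ (correlation-bound w j S (ℕP.<⇒≤ w<j) j≤H near (ℕP.≤-trans (ℕP.+-monoʳ-≤ (length (j ∷ S)) (ℕP.n≤1+n _)) len))
               (correlation-bound w (suc (length w)) (j ∷ S) ℕP.≤-refl (ℕP.<⇒≤ (ℕP.<-≤-trans w<j j≤H))
                 ((w<j , j≤H) ∷ All.map (λ { (j<i , i≤H) → ℕP.<-trans w<j j<i , i≤H }) near)
                 (ℕP.≤-trans (ℕP.≤-reflexive (≡.sym (ℕP.+-suc (length (j ∷ S)) (length w)))) len)) ⟩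
        t ℕ.* p ℕ.+ t ℕ.* p                             ≡⟨ ≡.cong (λ u → t ℕ.* p ℕ.+ u) (ℕP.+-identityʳ (t ℕ.* p)) ⟨
        2 ℕ.* (t ℕ.* p)                                 ≡⟨ ℕP.*-assoc 2 t p ⟨
        2 ℕ.^ length (b ∷ w) ℕ.* p                      ∎
        where
        open ℕP.≤-Reasoning
        A = correlation (j ∷ S) w
        B = correlation (suc (length w) ∷ j ∷ S) w
        c = σ * sgn b
        t = 2 ℕ.^ length w

      -- The term that picks no symbol is the main term p. Every other term has a largest picked
      -- position, and the terms are grouped by it into correlations.
      totalWeight : ∀ w → length w ℕ.≤ H → + Θ * sumTo p (λ i → weight (suc i) w) ≤ + Θ * + p + + (2 ℕ.^ length w ℕ.* p)
      totalWeight w len≤ = ≤-trans (≤-reflexive (≡.cong (+ Θ *_) (sumTo-cong p (λ i → ≡.sym (*-identityˡ (weight (suc i) w)))))) (go w len≤)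
        where
        open ≤-Reasoning
        go : ∀ w → length w ℕ.≤ H → + Θ * correlation [] w ≤ + Θ * + p + + (2 ℕ.^ length w ℕ.* p)
        -- The error starts at p instead of 0, so that adding t p to an error of t p doubles it at
        -- every letter.
        go [] _ = begin
          + Θ * sumTo p (λ _ → + 1)        ≡⟨ ≡.cong (+ Θ *_) (≡.trans (sumTo-const p (+ 1)) (*-identityʳ (+ p))) ⟩
          + Θ * + p                        ≡⟨ +-identityʳ (+ Θ * + p) ⟨
          + Θ * + p + + 0                  ≤⟨ +-monoʳ-≤ (+ Θ * + p) (+≤+ z≤n) ⟩
          + Θ * + p + + (1 ℕ.* p)          ∎
        go (b ∷ w) len≤ = begin
          + Θ * correlation [] (b ∷ w)                     ≡⟨ ≡.cong (+ Θ *_) (correlation-∷ [] b w) ⟩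
          + Θ * (correlation [] w + c * B)                 ≡⟨ *-distribˡ-+ (+ Θ) (correlation [] w) (c * B) ⟩
          + Θ * correlation [] w + + Θ * (c * B)
            ≤⟨ +-mono-≤ (go w (ℕP.<⇒≤ len≤)) cB≤ ⟩
          + Θ * + p + + (t ℕ.* p) + + (t ℕ.* p)            ≡⟨ +-assoc (+ Θ * + p) (+ (t ℕ.* p)) (+ (t ℕ.* p)) ⟩
          + Θ * + p + + (t ℕ.* p ℕ.+ t ℕ.* p)
            ≡⟨ ≡.cong (λ u → + Θ * + p + + u) (≡.trans (≡.cong (λ u → t ℕ.* p ℕ.+ u) (≡.sym (ℕP.+-identityʳ (t ℕ.* p)))) (≡.sym (ℕP.*-assoc 2 t p))) ⟩
          + Θ * + p + + (2 ℕ.^ length (b ∷ w) ℕ.* p)       ∎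
          where
          B = correlation (suc (length w) ∷ []) w
          c = σ * sgn b
          t = 2 ℕ.^ length w
          i≤∣i∣ : ∀ i → i ≤ + ∣ i ∣
          i≤∣i∣ (+ n)    = ≤-refl
          i≤∣i∣ -[1+ n ] = -≤+
          cB≤ : + Θ * (c * B) ≤ + (t ℕ.* p)
          cB≤ = begin
            + Θ * (c * B)              ≤⟨ *-monoˡ-≤-nonNeg (+ Θ) (i≤∣i∣ (c * B)) ⟩
            + Θ * + ∣ c * B ∣          ≡⟨ ≡.cong (λ u → + Θ * + u) (∣sign*∣ (IsSign-* σ-sign (sgn-sign b)) B) ⟩
            + Θ * + ∣ B ∣              ≡⟨ pos-* Θ ∣ B ∣ ⟨
            + (Θ ℕ.* ∣ B ∣)            ≤⟨ +≤+ (correlation-bound w (suc (length w)) [] ℕP.≤-refl len≤ [] len≤) ⟩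
            + (t ℕ.* p)                ∎

      totalZeros : ∀ l → sumTo p (λ i → zeros (suc i) l) ≤ + l * + d
      totalZeros zero    = ≤-reflexive (≡.trans (sumTo-const p (+ 0)) (≡.trans (*-zeroʳ (+ p)) (≡.sym (*-zeroˡ (+ d)))))
      totalZeros (suc l) = begin
        sumTo p (λ i → isZero (suc i ℕ.+ suc l) + zeros (suc i) l)  ≡⟨ sumTo-+ p (λ i → isZero (suc i ℕ.+ suc l)) (λ i → zeros (suc i) l) ⟩
        sumTo p (λ i → isZero (suc i ℕ.+ suc l)) + sumTo p (λ i → zeros (suc i) l)
          ≤⟨ +-mono-≤ (fewZeros (suc l)) (totalZeros l) ⟩
        + d + + l * + d                                             ≡⟨ suc-* (+ l) (+ d) ⟨
        + suc l * + d                                               ∎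
        where open ≤-Reasoning

      -- The 3 is made up of p for the main term, p for the character sums, and p for the zeros, of
      -- which there are at most d at each of the H positions, with Θ H d ≤ p.
      totalMajorant : ∀ w → length w ≡ H → sumTo p (λ i → weight (suc i) w + + Θ * zeros (suc i) H) ≤ + 3 * + p
      totalMajorant w refl = *-cancelˡ-≤-pos _ _ (+ Θ) {{ℤ.positive (ℤ.+<+ (ℕ.>-nonZero⁻¹ Θ))}} (begin
        + Θ * sumTo p (λ i → weight (suc i) w + + Θ * zeros (suc i) H)
          ≡⟨ ≡.cong (+ Θ *_) (≡.trans (sumTo-+ p (λ i → weight (suc i) w) (λ i → + Θ * zeros (suc i) H))
               (≡.cong (λ u → sumTo p (λ i → weight (suc i) w) + u) (sumTo-* p (+ Θ) (λ i → zeros (suc i) H)))) ⟩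
        + Θ * (sumTo p (λ i → weight (suc i) w) + + Θ * sumTo p (λ i → zeros (suc i) H))
          ≡⟨ *-distribˡ-+ (+ Θ) _ _ ⟩
        + Θ * sumTo p (λ i → weight (suc i) w) + + Θ * (+ Θ * sumTo p (λ i → zeros (suc i) H))
          ≤⟨ +-mono-≤ (totalWeight w ℕP.≤-refl) (*-monoˡ-≤-nonNeg (+ Θ) zeros≤) ⟩
        + Θ * + p + + (Θ ℕ.* p) + + Θ * + p
          ≡⟨ ≡.cong (λ u → + Θ * + p + u + + Θ * + p) (pos-* Θ p) ⟩
        + Θ * + p + + Θ * + p + + Θ * + p                  ≡⟨ triple (+ Θ) (+ p) ⟩
        + Θ * (+ 3 * + p)                                  ∎)
        where
        open ≤-Reasoning
        triple : ∀ t p → t * p + t * p + t * p ≡ t * (+ 3 * p)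
        triple = solve-∀
        zeros≤ : + Θ * sumTo p (λ i → zeros (suc i) H) ≤ + p
        zeros≤ = begin
          + Θ * sumTo p (λ i → zeros (suc i) H)            ≤⟨ *-monoˡ-≤-nonNeg (+ Θ) (totalZeros H) ⟩
          + Θ * (+ H * + d)                                ≡⟨ ≡.cong (+ Θ *_) (pos-* H d) ⟨
          + Θ * + (H ℕ.* d)                                ≡⟨ pos-* Θ (H ℕ.* d) ⟨
          + (Θ ℕ.* (H ℕ.* d))                              ≤⟨ +≤+ large ⟩
          + p                                              ∎

      -- Every pattern is met at most 3 p / Θ times, in a form weighted by G. The majorant is at
      -- least Θ at the true pattern and nonnegative at all others, so the term of the true pattern
      -- may be replaced by the sum over all patterns; no comparison of patterns is needed.
      patternAverage : ∀ G → (∀ w → + 0 ≤ G w) →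
                       + Θ * sumTo p (λ i → G (pattern-at (suc i) H)) ≤ + 3 * + p * sumPatterns H G
      patternAverage G G≥0 = begin
        + Θ * sumTo p (λ i → G (pattern-at (suc i) H))       ≡⟨ sumTo-* p (+ Θ) (λ i → G (pattern-at (suc i) H)) ⟨
        sumTo p (λ i → + Θ * G (pattern-at (suc i) H))       ≤⟨ sumTo-mono p dominated ⟩
        sumTo p (λ i → sumPatterns H (λ w → majorant i w * G w))
          ≡⟨ sumTo-sumPatterns p H (λ i w → majorant i w * G w) ⟩
        sumPatterns H (λ w → sumTo p (λ i → majorant i w * G w))
          ≡⟨ sumPatterns-cong H (λ w → ≡.trans (sumTo-cong p (λ i → *-comm (majorant i w) (G w)))
               (≡.trans (sumTo-* p (G w) (λ i → majorant i w)) (*-comm (G w) _))) ⟩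
        sumPatterns H (λ w → sumTo p (λ i → majorant i w) * G w)
          ≤⟨ sumPatterns-mono H (λ w eq → *-monoʳ-≤-nonNeg (G w) {{ℤ.nonNegative (G≥0 w)}} (totalMajorant w eq)) ⟩
        sumPatterns H (λ w → + 3 * + p * G w)                ≡⟨ sumPatterns-* H (+ 3 * + p) G ⟩
        + 3 * + p * sumPatterns H G                          ∎
        where
        open ≤-Reasoning
        majorant : ℕ → List Bool → ℤ
        majorant i w = weight (suc i) w + + Θ * zeros (suc i) H
        majorant-nonneg : ∀ i w → + 0 ≤ majorant i w
        majorant-nonneg i w = +-mono-≤ (weight-nonneg (suc i) w) (product-nonneg {+ Θ} (+≤+ z≤n) (zeros-nonneg (suc i) H))
        dominated : ∀ i → + Θ * G (pattern-at (suc i) H) ≤ sumPatterns H (λ w → majorant i w * G w)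
        dominated i = ≤-trans
          (*-monoʳ-≤-nonNeg (G (pattern-at (suc i) H)) {{ℤ.nonNegative (G≥0 _)}} (weight-at-pattern (suc i) H))
          (sumPatterns-single H (λ w → product-nonneg (majorant-nonneg i w) (G≥0 w)) (pattern-at (suc i) H) (length-pattern-at (suc i) H))

-- From the counting function to window sums and their second moment.

module WalkDeviation where
  import Data.Nat.Tactic.RingSolver as ℕR
  open import Data.Integer using (_+_; _*_; -_; _-_; _≤_; ∣_∣; _≟_; +≤+)
  open import Data.Integer.Properties
  open import Data.Integer.Tactic.RingSolver using (solve-∀)
  open import Relation.Nullary using (does)
  open import Relation.Binary.PropositionalEquality using (refl)
  open Estimates
  open SignPatterns

  cauchySchwarz : ∀ n f → sumTo n f * sumTo n f ≤ + n * sumTo n (λ i → f i * f i)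
  cauchySchwarz zero    f = ≤-refl
  cauchySchwarz (suc n) f = begin
    (x + S) * (x + S)                         ≡⟨ expand x S ⟩
    x * x + + 2 * (x * S) + S * S             ≤⟨ +-mono-≤ (+-monoʳ-≤ (x * x) cross) (cauchySchwarz n f) ⟩
    x * x + (+ n * (x * x) + Q) + + n * Q     ≡⟨ collect (x * x) Q (+ n) ⟩
    + suc n * (x * x + Q)                     ∎
    where
    open ≤-Reasoning
    x = f n
    S = sumTo n f
    Q = sumTo n (λ i → f i * f i)
    expand : ∀ x S → (x + S) * (x + S) ≡ x * x + + 2 * (x * S) + S * S
    expand = solve-∀
    collect : ∀ y Q n → y + (n * y + Q) + n * Q ≡ (+ 1 + n) * (y + Q)
    collect = solve-∀
    amgm : ∀ y → + 2 * (x * y) ≤ x * x + y * y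
    amgm y = begin
      + 2 * (x * y)                               ≡⟨ +-identityʳ (+ 2 * (x * y)) ⟨
      + 2 * (x * y) + + 0                         ≤⟨ +-monoʳ-≤ (+ 2 * (x * y)) (square-nonneg (x - y)) ⟩
      + 2 * (x * y) + (x - y) * (x - y)           ≡⟨ complete x y ⟩
      x * x + y * y                               ∎
      where
      complete : ∀ x y → + 2 * (x * y) + (x - y) * (x - y) ≡ x * x + y * y
      complete = solve-∀
    cross : + 2 * (x * S) ≤ + n * (x * x) + Q
    cross = begin
      + 2 * (x * S)                               ≡⟨ *-assoc (+ 2) x S ⟨
      + 2 * x * S                                 ≡⟨ sumTo-* n (+ 2 * x) f ⟨
      sumTo n (λ i → + 2 * x * f i)               ≡⟨ sumTo-cong n (λ i → *-assoc (+ 2) x (f i)) ⟩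
      sumTo n (λ i → + 2 * (x * f i))             ≤⟨ sumTo-mono n (λ i → amgm (f i)) ⟩
      sumTo n (λ i → x * x + f i * f i)           ≡⟨ sumTo-+ n (λ _ → x * x) (λ i → f i * f i) ⟩
      sumTo n (λ _ → x * x) + Q                   ≡⟨ ≡.cong (λ u → u + Q) (sumTo-const n (x * x)) ⟩
      + n * (x * x) + Q                           ∎

  sumTo-shift : ∀ n (u : ℕ → ℤ) → sumTo n (λ i → u (suc i)) ≡ sumTo n u + (u n - u 0)
  sumTo-shift zero    u = ≡.sym (≡.trans (+-identityˡ (u 0 - u 0)) (+-inverseʳ (u 0)))
  sumTo-shift (suc n) u = ≡.trans (≡.cong (λ v → u (suc n) + v) (sumTo-shift n u)) (rearrange (u (suc n)) (sumTo n u) (u n) (u 0))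
    where
    rearrange : ∀ a S b c → a + (S + (b - c)) ≡ b + S + (a - c)
    rearrange = solve-∀

  sumTo-telescope : ∀ n (u : ℕ → ℤ) → sumTo n (λ i → u (suc i) - u i) ≡ u n - u 0
  sumTo-telescope zero    u = ≡.sym (+-inverseʳ (u 0))
  sumTo-telescope (suc n) u = ≡.trans (≡.cong (λ v → u (suc n) - u n + v) (sumTo-telescope n u)) (rearrange (u (suc n)) (u n) (u 0))
    where
    rearrange : ∀ a b c → a - b + (b - c) ≡ a - c
    rearrange = solve-∀

  ∣i-j∣≤ : ∀ i j {B} → ∣ i ∣ ℕ.≤ B → ∣ j ∣ ℕ.≤ B → ∣ i - j ∣ ℕ.≤ B ℕ.+ B
  ∣i-j∣≤ i j i≤ j≤ = ℕP.≤-trans (∣i-j∣≤∣i∣+∣j∣ i j) (ℕP.+-mono-≤ i≤ j≤)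

  ∣i∣²≡i² : ∀ i → + (∣ i ∣ ℕ.* ∣ i ∣) ≡ i * i
  ∣i∣²≡i² (+ n)    = pos-* n n
  ∣i∣²≡i² -[1+ n ] = refl

  module Deviation
    (χ : ℕ → ℤ) (trit : ∀ n → Trit (χ n)) {σ : ℤ} (σ-sign : IsSign σ) (p H d : ℕ)
    (characterSums : ∀ j S → 1 ℕ.≤ j → All (λ i → j ℕ.< i × i ℕ.≤ H) S → length (j ∷ S) ℕ.≤ H → j ℕ.≤ H →
                     2 ℕ.^ H ℕ.* ∣ sumTo p (λ i → Patterns.product χ trit σ-sign p H d (j ∷ S) (suc i)) ∣ ℕ.≤ p)
    (fewZeros : ∀ j → sumTo p (λ i → Patterns.isZero χ trit σ-sign p H d (suc i ℕ.+ j)) ≤ + d)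
    (large : 2 ℕ.^ H ℕ.* (H ℕ.* d) ℕ.≤ p)
    (1≤H : 1 ℕ.≤ H) (H³≤p² : H ℕ.* H ℕ.* H ℕ.≤ p ℕ.* p)
    (R : ℕ → ℕ) (R-step : ∀ k → R (suc k) ≡ indicator (χ (suc k) ≟ σ) ℕ.+ R k)
    (m′ a : ℕ) where

    open Patterns χ trit σ-sign p H d

    m : ℕ
    m = suc m′

    γ : ℕ → ℤ
    γ r = + m * + indicator (r DM.% m ℕP.≟ a) - + 1

    γ-mod : ∀ r v → γ (r ℕ.+ v) ≡ γ (r DM.% m ℕ.+ v)
    γ-mod r v = ≡.cong (λ u → + m * + indicator (u ℕP.≟ a) - + 1) (begin
      (r ℕ.+ v) DM.% m                        ≡⟨ DM.%-distribˡ-+ r v m ⟩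
      (r DM.% m ℕ.+ v DM.% m) DM.% m          ≡⟨ ≡.cong (λ u → (u ℕ.+ v DM.% m) DM.% m) (DM.m%n%n≡m%n r m) ⟨
      (r DM.% m DM.% m ℕ.+ v DM.% m) DM.% m   ≡⟨ DM.%-distribˡ-+ (r DM.% m) v m ⟨
      (r DM.% m ℕ.+ v) DM.% m                 ∎)
      where open ≡.≡-Reasoning

    ∣γ∣≤m : ∀ r → ∣ γ r ∣ ℕ.≤ m
    ∣γ∣≤m r = cases (r DM.% m ℕP.≟ a)
      where
      cases : ∀ {P : Set} (P? : Dec P) → ∣ + m * + indicator P? - + 1 ∣ ℕ.≤ m
      cases (yes _) = ≡.subst (λ u → ∣ u - + 1 ∣ ℕ.≤ m) (≡.sym (*-identityʳ (+ m))) (ℕP.n≤1+n m′)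
      cases (no _)  = ≡.subst (λ u → ∣ u - + 1 ∣ ℕ.≤ m) (≡.sym (*-zeroʳ (+ m))) (s≤s z≤n)

    γ²≤ : ∀ r → γ r * γ r ≤ + (m ℕ.* m)
    γ²≤ r = ≡.subst (_≤ + (m ℕ.* m)) (∣i∣²≡i² (γ r)) (+≤+ (ℕP.*-mono-≤ (∣γ∣≤m r) (∣γ∣≤m r)))

    step : ℕ → ℤ
    step k = sgn (isHit (suc k)) * γ (R k)

    ∣step∣≤m : ∀ k → ∣ step k ∣ ℕ.≤ m
    ∣step∣≤m k = ℕP.≤-trans (ℕP.≤-reflexive (∣sign*∣ (sgn-sign (isHit (suc k))) (γ (R k)))) (∣γ∣≤m (R k))

    drift : ℤ
    drift = sumTo p (λ i → step (suc i))

    excess : ℤ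
    excess = sumTo p (λ i → γ (R (suc i)))

    -- φ is the sum of γ over [0, r).
    φ : ℕ → ℤ
    φ r = + m * + indicator (a ℕP.<? r DM.% m) - + (r DM.% m)

    suc-mod : ∀ r → (suc (r DM.% m) ≡ m × suc r DM.% m ≡ 0) ⊎ (suc (r DM.% m) ℕ.< m × suc r DM.% m ≡ suc (r DM.% m))
    suc-mod r with ℕP.m≤n⇒m<n∨m≡n (DM.m%n<n r m)
    ... | inj₁ lt = inj₂ (lt , ≡.trans reduced (DM.m<n⇒m%n≡m lt))
      where
      reduced : suc r DM.% m ≡ suc (r DM.% m) DM.% m
      reduced = ≡.trans (≡.cong (λ u → suc u DM.% m) (DM.m≡m%n+[m/n]*n r m)) (DM.[m+kn]%n≡m%n (suc (r DM.% m)) (r DM./ m) m)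
    ... | inj₂ eq = inj₁ (eq , ≡.trans reduced (≡.trans (≡.cong (DM._% m) eq) (DM.n%n≡0 m)))
      where
      reduced : suc r DM.% m ≡ suc (r DM.% m) DM.% m
      reduced = ≡.trans (≡.cong (λ u → suc u DM.% m) (DM.m≡m%n+[m/n]*n r m)) (DM.[m+kn]%n≡m%n (suc (r DM.% m)) (r DM./ m) m)

    -- Only the wrap from the residue m - 1 to 0 needs an argument: γ sums to 0 over a full period,
    -- since a < m is met exactly once.
    φ-step : a ℕ.< m → ∀ r → φ (suc r) ≡ φ r + γ r
    φ-step a<m r = cases (suc-mod r)
      where
      ρ = r DM.% m
      indicator-no : ∀ {P : Set} (P? : Dec P) → ¬ P → indicator P? ≡ 0
      indicator-no (yes q) n = ⊥-elim (n q)
      indicator-no (no _)  n = refl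
      indicator-yes : ∀ {P : Set} (P? : Dec P) → P → indicator P? ≡ 1
      indicator-yes (yes _) q = refl
      indicator-yes (no n)  q = ⊥-elim (n q)
      indicator-sum : ∀ x → indicator (a ℕP.<? suc x) ≡ indicator (a ℕP.<? x) ℕ.+ indicator (x ℕP.≟ a)
      indicator-sum x with ℕP.<-cmp a x
      ... | tri< a<x a≢x _ = ≡.trans (indicator-yes (a ℕP.<? suc x) (ℕP.m<n⇒m<1+n a<x))
              (≡.cong₂ ℕ._+_ (≡.sym (indicator-yes (a ℕP.<? x) a<x)) (≡.sym (indicator-no (x ℕP.≟ a) (λ eq → a≢x (≡.sym eq)))))
      ... | tri≈ a≮x a≡x _ = ≡.trans (indicator-yes (a ℕP.<? suc x) (s≤s (ℕP.≤-reflexive a≡x)))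
              (≡.cong₂ ℕ._+_ (≡.sym (indicator-no (a ℕP.<? x) a≮x)) (≡.sym (indicator-yes (x ℕP.≟ a) (≡.sym a≡x))))
      ... | tri> a≮x a≢x x<a = ≡.trans (indicator-no (a ℕP.<? suc x) (λ lt → ℕP.<-irrefl refl (ℕP.<-≤-trans x<a (ℕP.≤-pred lt))))
              (≡.cong₂ ℕ._+_ (≡.sym (indicator-no (a ℕP.<? x) a≮x)) (≡.sym (indicator-no (x ℕP.≟ a) (λ eq → a≢x (≡.sym eq)))))
      regular : + m * + indicator (a ℕP.<? suc ρ) - + suc ρ ≡ φ r + γ r
      regular = ≡.trans (≡.cong (λ u → + m * + u - + suc ρ) (indicator-sum ρ))
        (expand (+ m) (+ indicator (a ℕP.<? ρ)) (+ indicator (ρ ℕP.≟ a)) (+ ρ))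
        where
        expand : ∀ m x y ρ → m * (x + y) - (+ 1 + ρ) ≡ (m * x - ρ) + (m * y - + 1)
        expand = solve-∀
      cases : (suc ρ ≡ m × suc r DM.% m ≡ 0) ⊎ (suc ρ ℕ.< m × suc r DM.% m ≡ suc ρ) → φ (suc r) ≡ φ r + γ r
      cases (inj₂ (_ , eq)) = ≡.trans (≡.cong (λ u → + m * + indicator (a ℕP.<? u) - + u) eq) regular
      cases (inj₁ (full , eq)) = begin
        φ (suc r)                                   ≡⟨ ≡.cong (λ u → + m * + indicator (a ℕP.<? u) - + u) eq ⟩
        + m * + indicator (a ℕP.<? 0) - + 0         ≡⟨ ≡.cong (λ u → + m * + u - + 0) (indicator-no (a ℕP.<? 0) (λ ())) ⟩
        + m * + 0 - + 0                             ≡⟨ wrap (+ m) ⟩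
        + m * + 1 - + m                             ≡⟨ ≡.cong (λ u → + m * + u - + m) (indicator-yes (a ℕP.<? m) a<m) ⟨
        + m * + indicator (a ℕP.<? m) - + m         ≡⟨ ≡.cong (λ u → + m * + indicator (a ℕP.<? u) - + u) full ⟨
        + m * + indicator (a ℕP.<? suc ρ) - + suc ρ ≡⟨ regular ⟩
        φ r + γ r                                   ∎
        where
        open ≡.≡-Reasoning
        wrap : ∀ m → m * + 0 - + 0 ≡ m * + 1 - m
        wrap = solve-∀

    ∣φ∣≤m : ∀ r → ∣ φ r ∣ ℕ.≤ m
    ∣φ∣≤m r = cases (a ℕP.<? r DM.% m)
      where
      ρ≤m : r DM.% m ℕ.≤ m
      ρ≤m = ℕP.<⇒≤ (DM.m%n<n r m)
      cases : ∀ {P : Set} (P? : Dec P) → ∣ + m * + indicator P? - + (r DM.% m) ∣ ℕ.≤ m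
      cases (yes _) = ≡.subst (λ u → ∣ u ∣ ℕ.≤ m)
        (≡.trans (≡.sym (≡.trans (m-n≡m⊖n m (r DM.% m)) (⊖-≥ ρ≤m))) (≡.cong (λ u → u - + (r DM.% m)) (≡.sym (*-identityʳ (+ m)))))
        (ℕP.m∸n≤m m (r DM.% m))
      cases (no _)  = ≡.subst (ℕ._≤ m)
        (≡.trans (≡.sym (∣-i∣≡∣i∣ (+ (r DM.% m)))) (≡.cong ∣_∣ (≡.sym (≡.trans (≡.cong (λ u → u - + (r DM.% m)) (*-zeroʳ (+ m))) (+-identityˡ (- (+ (r DM.% m))))))))
        ρ≤m

    -- Twice the sum of γ over the rises telescopes.
    excess+drift : a ℕ.< m → ∣ excess + drift ∣ ℕ.≤ 4 ℕ.* m
    excess+drift a<m = begin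
      ∣ excess + drift ∣
        ≡⟨ ≡.cong ∣_∣ (sumTo-+ p (λ i → γ (R (suc i))) (λ i → step (suc i))) ⟨
      ∣ sumTo p (λ i → γ (R (suc i)) + step (suc i)) ∣
        ≡⟨ ≡.cong ∣_∣ (sumTo-cong p (λ i → rise (suc i))) ⟩
      ∣ sumTo p (λ i → + 2 * (φ (R (suc (suc i))) - φ (R (suc i)))) ∣
        ≡⟨ ≡.cong ∣_∣ (≡.trans (sumTo-* p (+ 2) (λ i → φ (R (suc (suc i))) - φ (R (suc i))))
             (≡.cong (λ u → + 2 * u) (sumTo-telescope p (λ i → φ (R (suc i)))))) ⟩
      ∣ + 2 * (φ (R (suc p)) - φ (R 1)) ∣               ≡⟨ abs-* (+ 2) (φ (R (suc p)) - φ (R 1)) ⟩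
      2 ℕ.* ∣ φ (R (suc p)) - φ (R 1) ∣
        ≤⟨ ℕP.*-monoʳ-≤ 2 (∣i-j∣≤ (φ (R (suc p))) (φ (R 1)) (∣φ∣≤m (R (suc p))) (∣φ∣≤m (R 1))) ⟩
      2 ℕ.* (m ℕ.+ m)                                   ≡⟨ four m ⟩
      4 ℕ.* m                                           ∎
      where
      open ℕP.≤-Reasoning
      four : ∀ m → 2 ℕ.* (m ℕ.+ m) ≡ 4 ℕ.* m
      four = ℕR.solve-∀
      rise : ∀ k → γ (R k) + step k ≡ + 2 * (φ (R (suc k)) - φ (R k))
      rise k = cases (χ (suc k) ≟ σ) (R-step k)
        where
        up : ∀ x y → y + + 1 * y ≡ + 2 * ((x + y) - x)
        up = solve-∀
        down : ∀ x y → y + -[1+ 0 ] * y ≡ + 2 * (x - x)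
        down = solve-∀
        cases : ∀ {P : Set} (P? : Dec P) → R (suc k) ≡ indicator P? ℕ.+ R k →
                γ (R k) + sgn (does P?) * γ (R k) ≡ + 2 * (φ (R (suc k)) - φ (R k))
        cases (yes _) eq = ≡.trans (up (φ (R k)) (γ (R k))) (≡.cong (λ u → + 2 * (u - φ (R k)))
          (≡.sym (≡.trans (≡.cong φ eq) (φ-step a<m (R k)))))
        cases (no _)  eq = ≡.trans (down (φ (R k)) (γ (R k))) (≡.cong (λ u → + 2 * (u - φ (R k))) (≡.sym (≡.cong φ eq)))

    -- The sum of `step` over x, ..., x + l - 1, written as a walk so that it depends on x only
    -- through the sign pattern and the starting value `R x`.
    window : ℕ → ℕ → ℤ
    window x l = walk (λ v → γ (R x ℕ.+ v)) (pattern-at x l)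

    R-window : ∀ x l → R (x ℕ.+ l) ≡ R x ℕ.+ rises (pattern-at x l)
    R-window x zero    = ≡.trans (≡.cong R (ℕP.+-identityʳ x)) (≡.sym (ℕP.+-identityʳ (R x)))
    R-window x (suc l) = ≡.trans (≡.cong R (ℕP.+-suc x l)) (≡.trans (R-step (x ℕ.+ l))
      (≡.trans (≡.cong₂ ℕ._+_ (≡.cong (λ u → indicator (χ u ≟ σ)) (≡.sym (ℕP.+-suc x l))) (R-window x l))
        (cases (χ (x ℕ.+ suc l) ≟ σ))))
      where
      cases : ∀ {P : Set} (P? : Dec P) →
              indicator P? ℕ.+ (R x ℕ.+ rises (pattern-at x l)) ≡ R x ℕ.+ rises (does P? ∷ pattern-at x l)
      cases (yes _) = ≡.sym (ℕP.+-suc (R x) (rises (pattern-at x l)))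
      cases (no _)  = refl

    window-step : ∀ x l → window x (suc l) ≡ window x l + step (x ℕ.+ l)
    window-step x l = ≡.cong₂ (λ u v → window x l + sgn (isHit u) * γ v) (ℕP.+-suc x l) (≡.sym (R-window x l))

    -- Moving the range of summation by one place changes only its two end terms, each of size at
    -- most m.
    shiftedDrift : ∀ l → ∣ sumTo p (λ i → step (suc i ℕ.+ l)) - drift ∣ ℕ.≤ 2 ℕ.* m ℕ.* l
    shiftedDrift zero = ℕP.≤-trans (ℕP.≤-reflexive (≡.cong ∣_∣ (≡.trans
      (≡.cong (λ u → u - drift) (sumTo-cong p (λ i → ≡.cong step (ℕP.+-identityʳ (suc i))))) (+-inverseʳ drift)))) z≤n
    shiftedDrift (suc l) = begin
      ∣ sumTo p (λ i → step (suc i ℕ.+ suc l)) - drift ∣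
        ≡⟨ ≡.cong (λ u → ∣ u - drift ∣) (≡.trans (sumTo-cong p (λ i → ≡.cong step (ℕP.+-suc (suc i) l))) (sumTo-shift p u)) ⟩
      ∣ sumTo p u + (u p - u 0) - drift ∣             ≡⟨ ≡.cong ∣_∣ (regroup (sumTo p u) (u p - u 0) drift) ⟩
      ∣ (sumTo p u - drift) + (u p - u 0) ∣           ≤⟨ ∣i+j∣≤∣i∣+∣j∣ (sumTo p u - drift) (u p - u 0) ⟩
      ∣ sumTo p u - drift ∣ ℕ.+ ∣ u p - u 0 ∣
        ≤⟨ ℕP.+-mono-≤ (shiftedDrift l) (∣i-j∣≤ (u p) (u 0) (∣step∣≤m (suc p ℕ.+ l)) (∣step∣≤m (suc l))) ⟩
      2 ℕ.* m ℕ.* l ℕ.+ (m ℕ.+ m)                     ≡⟨ next m l ⟩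
      2 ℕ.* m ℕ.* suc l                               ∎
      where
      open ℕP.≤-Reasoning
      u : ℕ → ℤ
      u i = step (suc i ℕ.+ l)
      regroup : ∀ S e T → S + e - T ≡ (S - T) + e
      regroup = solve-∀
      next : ∀ m l → 2 ℕ.* m ℕ.* l ℕ.+ (m ℕ.+ m) ≡ 2 ℕ.* m ℕ.* suc l
      next = ℕR.solve-∀

    windowSum : ℕ → ℤ
    windowSum l = sumTo p (λ i → window (suc i) l)

    -- The window sums add up l translates of the drift, and each translate differs from the drift
    -- by boundary terms only.
    drift-windowSum : ∀ l → l ℕ.≤ H → ∣ + l * drift - windowSum l ∣ ℕ.≤ l ℕ.* (2 ℕ.* m ℕ.* H)
    drift-windowSum zero    _   = ℕP.≤-reflexive (≡.cong ∣_∣ (≡.cong₂ _-_ (*-zeroˡ drift)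
      (≡.trans (sumTo-const p (+ 0)) (*-zeroʳ (+ p)))))
    drift-windowSum (suc l) l<H = begin
      ∣ + suc l * drift - windowSum (suc l) ∣
        ≡⟨ ≡.cong (λ u → ∣ + suc l * drift - u ∣) (≡.trans (sumTo-cong p (λ i → window-step (suc i) l))
             (sumTo-+ p (λ i → window (suc i) l) (λ i → step (suc i ℕ.+ l)))) ⟩
      ∣ + suc l * drift - (windowSum l + S) ∣           ≡⟨ ≡.cong ∣_∣ (regroup (+ l) drift (windowSum l) S) ⟩
      ∣ (+ l * drift - windowSum l) - (S - drift) ∣     ≤⟨ ∣i-j∣≤∣i∣+∣j∣ (+ l * drift - windowSum l) (S - drift) ⟩
      ∣ + l * drift - windowSum l ∣ ℕ.+ ∣ S - drift ∣
        ≤⟨ ℕP.+-mono-≤ (drift-windowSum l (ℕP.<⇒≤ l<H)) (ℕP.≤-trans (shiftedDrift l) (ℕP.*-monoʳ-≤ (2 ℕ.* m) (ℕP.<⇒≤ l<H))) ⟩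
      l ℕ.* (2 ℕ.* m ℕ.* H) ℕ.+ 2 ℕ.* m ℕ.* H           ≡⟨ ℕP.+-comm (l ℕ.* (2 ℕ.* m ℕ.* H)) (2 ℕ.* m ℕ.* H) ⟩
      suc l ℕ.* (2 ℕ.* m ℕ.* H)                         ∎
      where
      open ℕP.≤-Reasoning
      S = sumTo p (λ i → step (suc i ℕ.+ l))
      regroup : ∀ l T W S → (+ 1 + l) * T - (W + S) ≡ (l * T - W) - (S - T)
      regroup = solve-∀

    -- With the starting residue r held fixed, the squared walk is a function of the pattern alone.
    -- The pattern average then bounds it by the mean over independent signs, and the factor Θ
    -- cancels.
    residueSquares : ∀ r → sumTo p (λ i → walk (λ v → γ (r ℕ.+ v)) (pattern-at (suc i) H) * walk (λ v → γ (r ℕ.+ v)) (pattern-at (suc i) H))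
                     ≤ + (3 ℕ.* p ℕ.* (H ℕ.* (m ℕ.* m)))
    residueSquares r = *-cancelˡ-≤-pos _ _ (+ Θ) {{ℤ.positive (ℤ.+<+ (ℕ.>-nonZero⁻¹ Θ))}} (begin
      + Θ * sumTo p (λ i → G (pattern-at (suc i) H))
        ≤⟨ patternAverage characterSums fewZeros large G (λ w → square-nonneg (walk c w)) ⟩
      + 3 * + p * sumPatterns H G
        ≤⟨ *-monoˡ-≤-nonNeg (+ 3 * + p) {{ℤ.nonNegative (product-nonneg {+ 3} {+ p} (+≤+ z≤n) (+≤+ z≤n))}}
             (walk-variance H c (+ (m ℕ.* m)) (λ v → γ²≤ (r ℕ.+ v))) ⟩
      + 3 * + p * (+ Θ * (+ H * + (m ℕ.* m)))
        ≡⟨ ≡.cong₂ (λ u v → u * (+ Θ * v)) (pos-* 3 p) (pos-* H (m ℕ.* m)) ⟨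
      + (3 ℕ.* p) * (+ Θ * + (H ℕ.* (m ℕ.* m)))
        ≡⟨ exchange (+ (3 ℕ.* p)) (+ Θ) (+ (H ℕ.* (m ℕ.* m))) ⟩
      + Θ * (+ (3 ℕ.* p) * + (H ℕ.* (m ℕ.* m)))
        ≡⟨ ≡.cong (λ u → + Θ * u) (pos-* (3 ℕ.* p) (H ℕ.* (m ℕ.* m))) ⟨
      + Θ * + (3 ℕ.* p ℕ.* (H ℕ.* (m ℕ.* m))) ∎)
      where
      open ≤-Reasoning
      c : ℕ → ℤ
      c v = γ (r ℕ.+ v)
      G : List Bool → ℤ
      G w = walk c w * walk c w
      exchange : ∀ x t y → x * (t * y) ≡ t * (x * y)
      exchange = solve-∀

    -- The starting residue R (suc i) % m depends on i; summing over all residues costs a factor m.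
    windowSquares : sumTo p (λ i → window (suc i) H * window (suc i) H) ≤ + (m ℕ.* (3 ℕ.* p ℕ.* (H ℕ.* (m ℕ.* m))))
    windowSquares = begin
      sumTo p (λ i → window (suc i) H * window (suc i) H)
        ≤⟨ sumTo-mono p (λ i → ≤-trans (≤-reflexive (≡.cong (λ u → u * u) (walk-cong (γ-mod (R (suc i))) (pattern-at (suc i) H))))
             (sumTo-single m (λ r → square-nonneg (walk (λ v → γ (r ℕ.+ v)) (pattern-at (suc i) H))) (R (suc i) DM.% m) (DM.m%n<n (R (suc i)) m))) ⟩
      sumTo p (λ i → sumTo m (λ r → square r i))       ≡⟨ sumTo-swap p m (λ i r → square r i) ⟩
      sumTo m (λ r → sumTo p (square r))               ≤⟨ sumTo-mono m residueSquares ⟩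
      sumTo m (λ _ → + B)                              ≡⟨ sumTo-const m (+ B) ⟩
      + m * + B                                        ≡⟨ pos-* m B ⟨
      + (m ℕ.* B)                                      ∎
      where
      open ≤-Reasoning
      B = 3 ℕ.* p ℕ.* (H ℕ.* (m ℕ.* m))
      square : ℕ → ℕ → ℤ
      square r i = walk (λ v → γ (r ℕ.+ v)) (pattern-at (suc i) H) * walk (λ v → γ (r ℕ.+ v)) (pattern-at (suc i) H)

    -- The window sum is squared by Cauchy-Schwarz over the p starting points; the passage from
    -- excess to drift and from drift to windows costs the two error terms in `combineBounds`.
    excessBound² : a ℕ.< m → H ℕ.* (∣ excess ∣ ℕ.* ∣ excess ∣) ℕ.≤ 60 ℕ.* (p ℕ.* p ℕ.* (m ℕ.* m ℕ.* m))
    excessBound² a<m = combineBounds H p m (∣ excess ∣) (∣ drift ∣) (∣ windowSum H ∣) 1≤H (s≤s z≤n) H³≤p² excess≤ drift≤ windowSum≤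
      where
      excess≤ : ∣ excess ∣ ℕ.≤ ∣ drift ∣ ℕ.+ 4 ℕ.* m
      excess≤ = begin
        ∣ excess ∣                               ≡⟨ ≡.cong ∣_∣ (cancel excess drift) ⟩
        ∣ (excess + drift) - drift ∣             ≤⟨ ∣i-j∣≤∣i∣+∣j∣ (excess + drift) drift ⟩
        ∣ excess + drift ∣ ℕ.+ ∣ drift ∣         ≤⟨ ℕP.+-monoˡ-≤ ∣ drift ∣ (excess+drift a<m) ⟩
        4 ℕ.* m ℕ.+ ∣ drift ∣                    ≡⟨ ℕP.+-comm (4 ℕ.* m) ∣ drift ∣ ⟩
        ∣ drift ∣ ℕ.+ 4 ℕ.* m                    ∎
        where
        open ℕP.≤-Reasoning
        cancel : ∀ x y → x ≡ (x + y) - y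
        cancel = solve-∀
      drift≤ : H ℕ.* ∣ drift ∣ ℕ.≤ ∣ windowSum H ∣ ℕ.+ H ℕ.* (2 ℕ.* m ℕ.* H)
      drift≤ = begin
        H ℕ.* ∣ drift ∣                                         ≡⟨ abs-* (+ H) drift ⟨
        ∣ + H * drift ∣                                         ≡⟨ ≡.cong ∣_∣ (split (+ H * drift) (windowSum H)) ⟩
        ∣ windowSum H + (+ H * drift - windowSum H) ∣           ≤⟨ ∣i+j∣≤∣i∣+∣j∣ (windowSum H) (+ H * drift - windowSum H) ⟩
        ∣ windowSum H ∣ ℕ.+ ∣ + H * drift - windowSum H ∣       ≤⟨ ℕP.+-monoʳ-≤ ∣ windowSum H ∣ (drift-windowSum H ℕP.≤-refl) ⟩
        ∣ windowSum H ∣ ℕ.+ H ℕ.* (2 ℕ.* m ℕ.* H)               ∎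
        where
        open ℕP.≤-Reasoning
        split : ∀ x y → x ≡ y + (x - y)
        split = solve-∀
      windowSum≤ : ∣ windowSum H ∣ ℕ.* ∣ windowSum H ∣ ℕ.≤ p ℕ.* (m ℕ.* (3 ℕ.* p ℕ.* (H ℕ.* (m ℕ.* m))))
      windowSum≤ = drop‿+≤+ (begin
        + (∣ windowSum H ∣ ℕ.* ∣ windowSum H ∣)                       ≡⟨ ∣i∣²≡i² (windowSum H) ⟩
        windowSum H * windowSum H                                     ≤⟨ cauchySchwarz p (λ i → window (suc i) H) ⟩
        + p * sumTo p (λ i → window (suc i) H * window (suc i) H)     ≤⟨ *-monoˡ-≤-nonNeg (+ p) windowSquares ⟩
        + p * + (m ℕ.* (3 ℕ.* p ℕ.* (H ℕ.* (m ℕ.* m))))               ≡⟨ pos-* p _ ⟨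
        + (p ℕ.* (m ℕ.* (3 ℕ.* p ℕ.* (H ℕ.* (m ℕ.* m)))))             ∎)
        where open ≤-Reasoning

-- From integer inequalities to rational ones.

module RationalBounds where
  open import Data.Integer using (∣_∣)
  import Data.Integer.Tactic.RingSolver as ℤR
  open import Data.Rational as ℚ using (ℚ)
  import Data.Rational.Properties as ℚP
  open import Data.Rational.Unnormalised as ℚᵘ using (ℚᵘ; mkℚᵘ)
  import Data.Rational.Unnormalised.Properties as ℚᵘP
  open import Relation.Binary.PropositionalEquality using (refl)
  open import Defs using (_÷_)
  open Estimates
  open SignPatterns
  open WalkDeviation

  toℚᵘ-÷ : ∀ a b → ℚ.toℚᵘ (a ÷ suc b) ℚᵘ.≃ mkℚᵘ (+ a) b
  toℚᵘ-÷ a b = ℚP.toℚᵘ-fromℚᵘ (mkℚᵘ (+ a) b)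

  -- N / p - 1 / m equals z / (p m), so dividing the integer bound by p² m² leaves C m.
  squaredDifference : ∀ N p′ m′ L C → let p = suc p′ ; m = suc m′ ; z = + m ℤ.* + N ℤ.- + p ; t = (N ÷ p) ℚ.- (1 ÷ m) in
                      L ℕ.* (∣ z ∣ ℕ.* ∣ z ∣) ℕ.≤ C ℕ.* (p ℕ.* p ℕ.* (m ℕ.* m ℕ.* m)) →
                      (t ℚ.* t) ℚ.* (L ÷ 1) ℚ.≤ (C ℕ.* m) ÷ 1
  squaredDifference N p′ m′ L C Lz²≤ = ℚP.toℚᵘ-cancel-≤ (begin
    ℚ.toℚᵘ ((t ℚ.* t) ℚ.* (L ÷ 1))              ≃⟨ ℚP.toℚᵘ-homo-* (t ℚ.* t) (L ÷ 1) ⟩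
    ℚ.toℚᵘ (t ℚ.* t) ℚᵘ.* ℚ.toℚᵘ (L ÷ 1)
      ≃⟨ ℚᵘP.*-cong (ℚᵘP.≃-trans (ℚP.toℚᵘ-homo-* t t) (ℚᵘP.*-cong t≃ t≃)) (toℚᵘ-÷ L 0) ⟩
    (u ℚᵘ.* u) ℚᵘ.* mkℚᵘ (+ L) 0                ≤⟨ ℚᵘ.*≤* inequality ⟩
    mkℚᵘ (+ (C ℕ.* m)) 0                        ≃⟨ toℚᵘ-÷ (C ℕ.* m) 0 ⟨
    ℚ.toℚᵘ ((C ℕ.* m) ÷ 1)                      ∎)
    where
    open ℚᵘP.≤-Reasoning
    p = suc p′
    m = suc m′
    z = + m ℤ.* + N ℤ.- + p
    t = (N ÷ p) ℚ.- (1 ÷ m)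
    u = mkℚᵘ (+ N) p′ ℚᵘ.- mkℚᵘ (+ 1) m′
    t≃ : ℚ.toℚᵘ t ℚᵘ.≃ u
    t≃ = ℚᵘP.≃-trans (ℚP.toℚᵘ-homo-+ (N ÷ p) (ℚ.- (1 ÷ m)))
      (ℚᵘP.+-cong (toℚᵘ-÷ N p′) (ℚᵘP.≃-trans (ℚP.toℚᵘ-homo‿- (1 ÷ m)) (ℚᵘP.-‿cong (toℚᵘ-÷ 1 m′))))
    numerator : ∀ z L → (z ℤ.* z) ℤ.* L ℤ.* + 1 ≡ L ℤ.* (z ℤ.* z)
    numerator = ℤR.solve-∀
    z≡ : ∀ N m p → N ℤ.* m ℤ.+ ℤ.- (+ 1) ℤ.* p ≡ m ℤ.* N ℤ.- p
    z≡ = ℤR.solve-∀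
    denominator : ∀ C m p → C ℤ.* (p ℤ.* p ℤ.* (m ℤ.* m ℤ.* m)) ≡ C ℤ.* m ℤ.* (p ℤ.* m ℤ.* (p ℤ.* m) ℤ.* + 1)
    denominator = ℤR.solve-∀
    lifted : ∀ C → + (C ℕ.* (p ℕ.* p ℕ.* (m ℕ.* m ℕ.* m))) ≡ + C ℤ.* (+ p ℤ.* + p ℤ.* (+ m ℤ.* + m ℤ.* + m))
    lifted C = ≡.trans (ℤP.pos-* C _) (≡.cong (+ C ℤ.*_) (≡.trans (ℤP.pos-* (p ℕ.* p) _)
      (≡.cong₂ ℤ._*_ (ℤP.pos-* p p) (≡.trans (ℤP.pos-* (m ℕ.* m) m) (≡.cong (ℤ._* + m) (ℤP.pos-* m m))))))
    inequality : (ℚᵘ.↥ u ℤ.* ℚᵘ.↥ u) ℤ.* + L ℤ.* + 1 ℤ.≤ + (C ℕ.* m) ℤ.* ℚᵘ.↧ ((u ℚᵘ.* u) ℚᵘ.* mkℚᵘ (+ L) 0)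
    inequality = ℤP.≤-trans (ℤP.≤-reflexive (≡.trans (≡.cong (λ x → (x ℤ.* x) ℤ.* + L ℤ.* + 1) (z≡ (+ N) (+ m) (+ p)))
        (≡.trans (numerator z (+ L)) (≡.trans (≡.cong (+ L ℤ.*_) (≡.sym (∣i∣²≡i² z))) (≡.sym (ℤP.pos-* L _))))))
      (ℤP.≤-trans (ℤ.+≤+ Lz²≤) (ℤP.≤-reflexive (≡.trans (lifted C) (≡.trans (denominator (+ C) (+ m) (+ p))
        (≡.cong₂ ℤ._*_ (≡.sym (ℤP.pos-* C m)) refl)))))

  sumBound : ∀ (g : ℕ → ℚ) l B xs → All (λ a → g a ℚ.* (l ÷ 1) ℚ.≤ B ÷ 1) xs →
             foldr ℚ._+_ ℚ.0ℚ (map g xs) ℚ.* (l ÷ 1) ℚ.≤ (length xs ℕ.* B) ÷ 1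
  sumBound g l B []       []       = ℚP.≤-reflexive (ℚP.*-zeroˡ (l ÷ 1))
  sumBound g l B (x ∷ xs) (b ∷ bs) = begin
    (g x ℚ.+ S) ℚ.* (l ÷ 1)                          ≡⟨ ℚP.*-distribʳ-+ (l ÷ 1) (g x) S ⟩
    g x ℚ.* (l ÷ 1) ℚ.+ S ℚ.* (l ÷ 1)                ≤⟨ ℚP.+-mono-≤ b (sumBound g l B xs bs) ⟩
    (B ÷ 1) ℚ.+ ((length xs ℕ.* B) ÷ 1)              ≡⟨ ÷1-+ B (length xs ℕ.* B) ⟨
    (B ℕ.+ length xs ℕ.* B) ÷ 1                      ∎
    where
    open ℚP.≤-Reasoning
    S = foldr ℚ._+_ ℚ.0ℚ (map g xs)
    ÷1-+ : ∀ a b → (a ℕ.+ b) ÷ 1 ≡ (a ÷ 1) ℚ.+ (b ÷ 1)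
    ÷1-+ a b = ℚP.toℚᵘ-injective (ℚᵘP.≃-trans (toℚᵘ-÷ (a ℕ.+ b) 0) (ℚᵘP.≃-trans (ℚᵘ.*≡* (cross (+ a) (+ b)))
      (ℚᵘP.≃-sym (ℚᵘP.≃-trans (ℚP.toℚᵘ-homo-+ (a ÷ 1) (b ÷ 1)) (ℚᵘP.+-cong (toℚᵘ-÷ a 0) (toℚᵘ-÷ b 0))))))
      where
      cross : ∀ a b → (a ℤ.+ b) ℤ.* + 1 ≡ (a ℤ.* + 1 ℤ.+ b ℤ.* + 1) ℤ.* + 1
      cross = ℤR.solve-∀

  ÷1-* : ∀ a b → (a ℕ.* b) ÷ 1 ≡ (a ÷ 1) ℚ.* (b ÷ 1)
  ÷1-* a b = ℚP.toℚᵘ-injective (ℚᵘP.≃-trans (toℚᵘ-÷ (a ℕ.* b) 0) (ℚᵘP.≃-trans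
    (ℚᵘ.*≡* (≡.cong (ℤ._* + 1) (ℤP.pos-* a b)))
    (ℚᵘP.≃-sym (ℚᵘP.≃-trans (ℚP.toℚᵘ-homo-* (a ÷ 1) (b ÷ 1)) (ℚᵘP.*-cong (toℚᵘ-÷ a 0) (toℚᵘ-÷ b 0))))))

-- Logarithms, translation of the definitions, and the bound for one prime.

module Assembly where
  import Data.Nat.Tactic.RingSolver as ℕR
  open import Data.Nat.Divisibility using (divides)
  open import Data.Nat.Induction using (<-rec)
  open import Data.Nat.Logarithm using (⌊log₂_⌋; ⌊log₂⌋-mono-≤; ⌊log₂⌊n/2⌋⌋≡⌊log₂n⌋∸1)
  open import Data.Nat.Primality using (prime⇒irreducible)
  open import Data.List using (_++_)
  open import Data.List.Properties using (length-upTo; length-++; map-++; filter-++; upTo-∷ʳ)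
  open import Data.Integer using (∣_∣)
  import Data.Integer.Tactic.RingSolver as ℤR
  open import Data.Rational as ℚ using (ℚ)
  import Data.Rational.Properties as ℚP
  open import Relation.Unary using (Pred; Decidable)
  open import Defs using (Poly; coeff; polyAdd; polyMul; HasDegree; SquareFree; countSym; Phi; Dev; _÷_)
  open Estimates
  open SignPatterns
  open WalkDeviation
  open RationalBounds

  2^⌊log₂⌋≤ : ∀ n → 1 ℕ.≤ n → 2 ℕ.^ ⌊log₂ n ⌋ ℕ.≤ n
  2^⌊log₂⌋≤ = <-rec (λ n → 1 ℕ.≤ n → 2 ℕ.^ ⌊log₂ n ⌋ ℕ.≤ n) step
    where
    step : ∀ n → (∀ {k} → k ℕ.< n → 1 ℕ.≤ k → 2 ℕ.^ ⌊log₂ k ⌋ ℕ.≤ k) → 1 ℕ.≤ n → 2 ℕ.^ ⌊log₂ n ⌋ ℕ.≤ n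
    step (suc zero)        rec _ = s≤s z≤n
    step n@(suc (suc n-2)) rec _ = begin
      2 ℕ.^ ⌊log₂ n ⌋                    ≡⟨ ≡.cong (2 ℕ.^_) log≡ ⟩
      2 ℕ.* 2 ℕ.^ ⌊log₂ k ⌋              ≤⟨ ℕP.*-monoʳ-≤ 2 (rec (ℕP.⌊n/2⌋<n (suc n-2)) (s≤s z≤n)) ⟩
      2 ℕ.* k                            ≡⟨ ≡.cong (k ℕ.+_) (ℕP.+-identityʳ k) ⟩
      k ℕ.+ k                            ≤⟨ ℕP.+-monoʳ-≤ k (ℕP.⌊n/2⌋≤⌈n/2⌉ n) ⟩
      k ℕ.+ ℕ.⌈ n /2⌉                    ≡⟨ ℕP.⌊n/2⌋+⌈n/2⌉≡n n ⟩
      n                                  ∎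
      where
      open ℕP.≤-Reasoning
      k = ℕ.⌊ n /2⌋
      log≡ : ⌊log₂ n ⌋ ≡ suc ⌊log₂ k ⌋
      log≡ = ≡.sym (≡.trans (≡.cong suc (⌊log₂⌊n/2⌋⌋≡⌊log₂n⌋∸1 n))
        (ℕP.m+[n∸m]≡n {1} (⌊log₂⌋-mono-≤ {2} {n} (s≤s (s≤s z≤n)))))

  suc≤2^ : ∀ n → suc n ℕ.≤ 2 ℕ.^ n
  suc≤2^ zero    = s≤s z≤n
  suc≤2^ (suc n) = ℕP.≤-trans (ℕP.+-mono-≤ (ℕP.m^n>0 2 n) (suc≤2^ n))
    (ℕP.≤-reflexive (≡.cong (2 ℕ.^ n ℕ.+_) (≡.sym (ℕP.+-identityʳ (2 ℕ.^ n)))))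

  -- Ensures that a product of at most H translates of F has degree at most Θ = 2^H. At H = 2 d it
  -- follows from 2 d ≤ 2^d and d ≤ 2^d; afterwards the left side grows by d and the right side
  -- doubles.
  multiple≤2^ : ∀ d H → 1 ℕ.≤ d → 2 ℕ.* d ℕ.≤ H → H ℕ.* d ℕ.≤ 2 ℕ.^ H
  multiple≤2^ d H 1≤d 2d≤H = ≡.subst (λ k → k ℕ.* d ℕ.≤ 2 ℕ.^ k) (ℕP.m∸n+n≡m 2d≤H) (grow (H ℕ.∸ 2 ℕ.* d))
    where
    double≤2^ : ∀ e → 1 ℕ.≤ e → 2 ℕ.* e ℕ.≤ 2 ℕ.^ e
    double≤2^ (suc e) _ = ℕP.*-monoʳ-≤ 2 (suc≤2^ e)
    grow : ∀ k → (k ℕ.+ 2 ℕ.* d) ℕ.* d ℕ.≤ 2 ℕ.^ (k ℕ.+ 2 ℕ.* d)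
    grow zero    = ℕP.≤-trans (ℕP.*-mono-≤ (double≤2^ d 1≤d) (ℕP.<⇒≤ (suc≤2^ d))) (ℕP.≤-reflexive
      (≡.trans (≡.sym (ℕP.^-distribˡ-+-* 2 d d)) (≡.cong (λ u → 2 ℕ.^ (d ℕ.+ u)) (≡.sym (ℕP.+-identityʳ d)))))
    grow (suc k) = ℕP.≤-trans (ℕP.+-mono-≤ d≤ (grow k))
      (ℕP.≤-reflexive (≡.cong (2 ℕ.^ K ℕ.+_) (≡.sym (ℕP.+-identityʳ (2 ℕ.^ K)))))
      where
      K = k ℕ.+ 2 ℕ.* d
      d≤ : d ℕ.≤ 2 ℕ.^ K
      d≤ = ℕP.≤-trans (ℕP.m≤m+n d (d ℕ.+ 0)) (ℕP.≤-trans (ℕP.m≤n+m (2 ℕ.* d) k) (ℕP.<⇒≤ (suc≤2^ K)))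

  oddPrime : ∀ p → Prime p → 2 ℕ.< p → ∃[ h ] p ≡ suc (h ℕ.+ h)
  oddPrime p isPrime 2<p = cases (p DM.% 2) (DM.m%n<n p 2) (DM.m≡m%n+[m/n]*n p 2)
    where
    k = p DM./ 2
    cases : ∀ r → r ℕ.< 2 → p ≡ r ℕ.+ k ℕ.* 2 → ∃[ h ] p ≡ suc (h ℕ.+ h)
    cases zero _ eq with prime⇒irreducible isPrime (divides k eq)
    ... | inj₁ ()
    ... | inj₂ 2≡p = ⊥-elim (ℕP.<⇒≢ 2<p 2≡p)
    cases (suc zero) _ eq = k , ≡.trans eq (≡.cong suc (≡.trans (ℕP.*-comm k 2) (≡.cong (k ℕ.+_) (ℕP.+-identityʳ k))))
    cases (suc (suc r)) (s≤s (s≤s ())) eq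

  count : ∀ {P : Pred ℕ 0ℓ} → Decidable P → ℕ → ℕ
  count P? n = length (filter P? (map suc (upTo n)))

  count-suc : ∀ {P : Pred ℕ 0ℓ} (P? : Decidable P) n → count P? (suc n) ≡ indicator (P? (suc n)) ℕ.+ count P? n
  count-suc P? n = begin
    length (filter P? (map suc (upTo (suc n))))             ≡⟨ ≡.cong (λ xs → length (filter P? (map suc xs))) (upTo-∷ʳ n) ⟨
    length (filter P? (map suc (upTo n ++ n ∷ [])))         ≡⟨ ≡.cong (λ xs → length (filter P? xs)) (map-++ suc (upTo n) (n ∷ [])) ⟩
    length (filter P? (map suc (upTo n) ++ suc n ∷ []))     ≡⟨ ≡.cong length (filter-++ P? (map suc (upTo n)) (suc n ∷ [])) ⟩
    length (filter P? (map suc (upTo n)) ++ filter P? (suc n ∷ []))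
      ≡⟨ length-++ (filter P? (map suc (upTo n))) ⟩
    count P? n ℕ.+ length (filter P? (suc n ∷ []))
      ≡⟨ ≡.cong (count P? n ℕ.+_) (≡.trans (length-filter-∷ P? (suc n) []) (ℕP.+-identityʳ _)) ⟩
    count P? n ℕ.+ indicator (P? (suc n))                   ≡⟨ ℕP.+-comm (count P? n) (indicator (P? (suc n))) ⟩
    indicator (P? (suc n)) ℕ.+ count P? n                   ∎
    where open ≡.≡-Reasoning

  sumTo-indicator : ∀ {P : Pred ℕ 0ℓ} (P? : Decidable P) n → sumTo n (λ i → + indicator (P? i)) ≡ + length (filter P? (downFrom n))
  sumTo-indicator P? zero    = ≡.refl
  sumTo-indicator P? (suc n) = ≡.trans (≡.cong (λ u → + indicator (P? n) ℤ.+ u) (sumTo-indicator P? n))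
    (≡.cong +_ (≡.sym (length-filter-∷ P? n (downFrom n))))

  sumTo-count-centred : ∀ {P : Pred ℕ 0ℓ} (P? : Decidable P) m n →
                        sumTo n (λ i → m ℤ.* + indicator (P? (suc i)) ℤ.- + 1) ≡ m ℤ.* + count P? n ℤ.- + n
  sumTo-count-centred P? m zero    = ≡.sym (≡.trans (ℤP.+-identityʳ (m ℤ.* + 0)) (ℤP.*-zeroʳ m))
  sumTo-count-centred P? m (suc n) = ≡.trans (≡.cong (λ u → m ℤ.* + i ℤ.- + 1 ℤ.+ u) (sumTo-count-centred P? m n))
    (≡.trans (collect m (+ i) (+ count P? n) (+ n)) (≡.cong (λ u → m ℤ.* + u ℤ.- + suc n) (≡.sym (count-suc P? n))))
    where
    i = indicator (P? (suc n))
    collect : ∀ m i c n → m ℤ.* i ℤ.- + 1 ℤ.+ (m ℤ.* c ℤ.- n) ≡ m ℤ.* (i ℤ.+ c) ℤ.- (+ 1 ℤ.+ n)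
    collect = ℤR.solve-∀

  module Translation (h : ℕ) (isPrime : Prime (suc (h ℕ.+ h))) where
    open PrimeField h isPrime

    coefficient≡coeff : ∀ F i → coefficient F i ≡ coeff F i
    coefficient≡coeff []      i       = ≡.refl
    coefficient≡coeff (a ∷ F) zero    = ≡.refl
    coefficient≡coeff (a ∷ F) (suc i) = coefficient≡coeff F i

    add≡polyAdd : ∀ F G → add F G ≡ polyAdd F G
    add≡polyAdd []      G       = ≡.refl
    add≡polyAdd (a ∷ F) []      = ≡.refl
    add≡polyAdd (a ∷ F) (b ∷ G) = ≡.cong (a ℕ.+ b ∷_) (add≡polyAdd F G)

    mul≡polyMul : ∀ F G → mul F G ≡ polyMul F G
    mul≡polyMul []      G = ≡.refl
    mul≡polyMul (a ∷ F) G = ≡.trans (≡.cong (λ H → add (scale a G) (0 ∷ H)) (mul≡polyMul F G)) (add≡polyAdd (scale a G) _)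

    opaque
      unfolding _⊗_

      ⊗≡polyMul : ∀ F G → F ⊗ G ≡ polyMul F G
      ⊗≡polyMul = mul≡polyMul

    HasDegree⇒Degree : ∀ {F d} → HasDegree p F d → Degree F d
    HasDegree⇒Degree {F} {d} (lead , high) = degree
      (λ eq → lead (≡.trans (≡.cong (DM._% p) (≡.sym (coefficient≡coeff F d))) (same eq)))
      (deg (λ i d<i → residues (≡.trans (≡.cong (DM._% p) (coefficient≡coeff F i)) (high i d<i))))

    Degree⇒HasDegree : ∀ {F d} → Degree F d → HasDegree p F d
    Degree⇒HasDegree {F} {d} dF =
      (λ eq → leading dF (residues (≡.trans (≡.cong (DM._% p) (coefficient≡coeff F d)) eq))) ,
      λ i d<i → ≡.trans (≡.cong (DM._% p) (≡.sym (coefficient≡coeff F i))) (same (vanish (bounded dF) i d<i))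

    SquareFree⇒ : ∀ {F} → SquareFree p F → ∀ G e H → 1 ℕ.≤ e → Degree G e → ¬ G ⊗ G ⊗ H ≋ F
    SquareFree⇒ {F} sf G e H 1≤e dG eq = sf (G , H , e , 1≤e , Degree⇒HasDegree dG , λ i →
      ≡.trans (≡.cong (DM._% p) (≡.trans (≡.cong (λ K → coeff K i)
          (≡.sym (≡.trans (⊗≡polyMul (G ⊗ G) H) (≡.cong (λ K → polyMul K H) (⊗≡polyMul G G)))))
        (≡.sym (coefficient≡coeff (G ⊗ G ⊗ H) i))))
      (≡.trans (same (at eq i)) (≡.cong (DM._% p) (coefficient≡coeff F i))))

  module Residues
    (h : ℕ) (isPrime : Prime (suc (h ℕ.+ h)))
    (F : Poly) (d : ℕ) (1≤d : 1 ℕ.≤ d)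
    (degF : HasDegree (suc (h ℕ.+ h)) F d) (squareFree : SquareFree (suc (h ℕ.+ h)) F)
    (H : ℕ) (2d≤H : 2 ℕ.* d ℕ.≤ H) (large : (2 ℕ.^ H) ℕ.^ 16 ℕ.≤ suc (h ℕ.+ h)) where

    open PrimeField h isPrime
    open CharacterSums h isPrime
    open Translation h isPrime

    private
      Θ : ℕ
      Θ = 2 ℕ.^ H
      dF : Degree F d
      dF = HasDegree⇒Degree degF
      1≤H : 1 ℕ.≤ H
      1≤H = ℕP.≤-trans 1≤d (ℕP.≤-trans (ℕP.m≤m+n d (d ℕ.+ 0)) 2d≤H)
      2≤Θ : 2 ℕ.≤ Θ
      2≤Θ = ℕP.^-monoʳ-≤ 2 1≤H
      Hd≤Θ : H ℕ.* d ℕ.≤ Θ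
      Hd≤Θ = multiple≤2^ d H 1≤d 2d≤H
      instance
        Θ≢0 : ℕ.NonZero Θ
        Θ≢0 = ℕP.m^n≢0 2 H
      powers : ∀ i → i ℕ.≤ 16 → Θ ℕ.^ i ℕ.≤ p
      powers i i≤16 = ℕP.≤-trans (ℕP.^-monoʳ-≤ Θ i≤16) large
      Θ²≤p : Θ ℕ.* Θ ℕ.≤ p
      Θ²≤p = ≡.subst (ℕ._≤ p) (≡.cong (Θ ℕ.*_) (ℕP.*-identityʳ Θ)) (powers 2 (ℕP.m≤m+n 2 14))
      d≤Θ : d ℕ.≤ Θ
      d≤Θ = ℕP.≤-trans (ℕP.m≤n*m d H {{ℕ.>-nonZero 1≤H}}) Hd≤Θ
      window : d ℕ.* suc H ℕ.< p
      window = begin-strict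
        d ℕ.* suc H              ≡⟨ ℕP.*-suc d H ⟩
        d ℕ.+ d ℕ.* H            ≤⟨ ℕP.+-mono-≤ d≤Θ (ℕP.≤-trans (ℕP.≤-reflexive (ℕP.*-comm d H)) Hd≤Θ) ⟩
        Θ ℕ.+ Θ                  ≡⟨ ≡.cong (Θ ℕ.+_) (ℕP.+-identityʳ Θ) ⟨
        2 ℕ.* Θ                  ≤⟨ ℕP.*-monoˡ-≤ Θ 2≤Θ ⟩
        Θ ℕ.* Θ                  ≡⟨ ≡.cong (Θ ℕ.*_) (ℕP.*-identityʳ Θ) ⟨
        Θ ℕ.^ 2                  <⟨ ℕP.^-monoʳ-< Θ 2≤Θ {2} {3} (s≤s (s≤s (s≤s z≤n))) ⟩
        Θ ℕ.^ 3                  ≤⟨ powers 3 (ℕP.m≤m+n 3 13) ⟩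
        p                        ∎
        where open ℕP.≤-Reasoning
      H³≤p² : H ℕ.* H ℕ.* H ℕ.≤ p ℕ.* p
      H³≤p² = ℕP.≤-trans (ℕP.≤-reflexive (cube H)) (ℕP.≤-trans
        (ℕP.^-monoˡ-≤ 3 (ℕP.<⇒≤ (suc≤2^ H))) (ℕP.≤-trans (powers 3 (ℕP.m≤m+n 3 13)) (ℕP.m≤m*n p p)))
        where
        cube : ∀ x → x ℕ.* x ℕ.* x ≡ x ℕ.* (x ℕ.* (x ℕ.* 1))
        cube = ℕR.solve-∀
      largeZeros : Θ ℕ.* (H ℕ.* d) ℕ.≤ p
      largeZeros = ℕP.≤-trans (ℕP.*-monoʳ-≤ Θ Hd≤Θ) Θ²≤p

    trit : ∀ n → Trit (χ F n)
    trit n = fromSign (χ-sign F n)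
      where
      fromSign : ∀ {z b} → SignOf z b → Trit z
      fromSign (zero _)  = null
      fromSign (plus _)  = positive
      fromSign (minus _) = negative

    module _ {σ : ℤ} (σ-sign : IsSign σ) where

      private
        module Pat = Patterns (χ F) trit σ-sign p H d

      product≡prodχ : ∀ S n → Pat.product S n ≡ prodχ S F n
      product≡prodχ []      n = ≡.refl
      product≡prodχ (j ∷ S) n = ≡.cong (χ F (n ℕ.+ j) ℤ.*_) (product≡prodχ S n)

      absolute : ∀ T → + Θ ℤ.* T ℤ.≤ + p → + Θ ℤ.* (ℤ.- T) ℤ.≤ + p → Θ ℕ.* ∣ T ∣ ℕ.≤ p
      absolute (+ n)    le _  = ℤP.drop‿+≤+ (ℤP.≤-trans (ℤP.≤-reflexive (ℤP.pos-* Θ n)) le)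
      absolute -[1+ n ] _  le = ℤP.drop‿+≤+ (ℤP.≤-trans (ℤP.≤-reflexive (ℤP.pos-* Θ (suc n))) le)

      characterSums : ∀ j S → 1 ℕ.≤ j → All (λ i → j ℕ.< i × i ℕ.≤ H) S → length (j ∷ S) ℕ.≤ H → j ℕ.≤ H →
                      Θ ℕ.* ∣ sumTo p (λ i → Pat.product (j ∷ S) (suc i)) ∣ ℕ.≤ p
      characterSums j S 1≤j near len j≤H = absolute total
        (≡.subst (λ u → + Θ ℤ.* u ℤ.≤ + p) (sumTo-cong p (λ i → ≡.sym (product≡prodχ (j ∷ S) (suc i))))
          (characterSum≤ j S near′ short))
        (≡.subst (λ u → + Θ ℤ.* u ℤ.≤ + p) negated (characterSum≥ j S near′ short))
        where
        open Bounds F d dF 1≤d (SquareFree⇒ squareFree) H window Θ (stepanovParameters Θ 2≤Θ) large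
        total = sumTo p (λ i → Pat.product (j ∷ S) (suc i))
        near′ : All (λ i → j ℕ.< i × i ℕ.≤ j ℕ.+ H) S
        near′ = All.map (λ { (j<i , i≤H) → j<i , ℕP.≤-trans i≤H (ℕP.m≤n+m H j) }) near
        short : length (j ∷ S) ℕ.* d ℕ.≤ Θ
        short = ℕP.≤-trans (ℕP.*-monoˡ-≤ d len) Hd≤Θ
        negated : sumTo p (λ i → ℤ.- prodχ (j ∷ S) F (suc i)) ≡ ℤ.- total
        negated = ≡.trans (sumTo-cong p (λ i → ≡.trans (≡.cong (λ u → ℤ.- u) (≡.sym (product≡prodχ (j ∷ S) (suc i)))) (≡.sym (ℤP.-1*i≡-i _))))
          (≡.trans (sumTo-* p -[1+ 0 ] (λ i → Pat.product (j ∷ S) (suc i))) (ℤP.-1*i≡-i total))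

      fewZeros : ∀ j → sumTo p (λ i → Pat.isZero (suc i ℕ.+ j)) ℤ.≤ + d
      fewZeros j = ≡.subst (ℤ._≤ + d) (≡.sym (sumTo-indicator vanishes? p)) (ℤ.+≤+ (ℕP.≤-pred
        (≡.subst (ℕ._< suc d) (length-map point roots)
          (simpleRootsBound (map point roots) F (suc d)
            (distinct-image point (translate-injective j) (selection-distinct vanishes?))
            (AllP.map⁺ (All.map (λ {i} → root (point i)) (AllP.all-filter vanishes? (downFrom p))))
            (degree-nonzero dF) (bounded dF)))))
        where
        point : ℕ → ℕ
        point i = suc i ℕ.+ j
        vanishes? : ∀ i → Dec (χ F (point i) ≡ + 0)
        vanishes? i = χ F (point i) ℤ.≟ + 0
        roots = filter vanishes? (downFrom p)
        root : ∀ n → χ F n ≡ + 0 → eval F n ≈ₚ 0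
        root n eq = fromSign (χ-sign F n) eq
          where
          fromSign : ∀ {z} → SignOf z (eval F n ^ h) → z ≡ + 0 → eval F n ≈ₚ 0
          fromSign (zero q)  _ = zero-power (eval F n) q
          fromSign (plus _)  ()
          fromSign (minus _) ()

      deviation : ∀ m′ a → a ℕ.< suc m′ →
                  let z = + suc m′ ℤ.* + count (λ k → countSym σ p F k DM.% suc m′ ℕP.≟ a) p ℤ.- + p in
                  H ℕ.* (∣ z ∣ ℕ.* ∣ z ∣) ℕ.≤ 60 ℕ.* (p ℕ.* p ℕ.* (suc m′ ℕ.* suc m′ ℕ.* suc m′))
      deviation m′ a a<m = ≡.subst (λ z → H ℕ.* (∣ z ∣ ℕ.* ∣ z ∣) ℕ.≤ 60 ℕ.* (p ℕ.* p ℕ.* (suc m′ ℕ.* suc m′ ℕ.* suc m′)))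
        (sumTo-count-centred (λ k → countSym σ p F k DM.% suc m′ ℕP.≟ a) (+ suc m′) p)
        (Dv.excessBound² a<m)
        where
        module Dv = Deviation (χ F) trit σ-sign p H d characterSums fewZeros largeZeros 1≤H H³≤p²
          (countSym σ p F) (λ k → count-suc (λ n → χ F n ℤ.≟ σ) k) m′ a

      -- 1920 = 32 · 60: the factor H in `deviation` is traded for L at the price 32. Each of the m
      -- residues then contributes 1920 m.
      deviationBound : ∀ L → L ℕ.≤ 32 ℕ.* H → ∀ m → 1 ℕ.≤ m →
                       Dev (countSym σ) p F m ℚ.* (L ÷ 1) ℚ.≤ (1920 ÷ 1) ℚ.* ((m ℕ.^ 2) ÷ 1)
      deviationBound L L≤ (suc m′) _ = begin
        Dev (countSym σ) p F m ℚ.* (L ÷ 1)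
          ≤⟨ sumBound g L (1920 ℕ.* m) (upTo m) (AllP.applyUpTo⁺₁ (λ a → a) m (λ {a} → term a)) ⟩
        (length (upTo m) ℕ.* (1920 ℕ.* m)) ÷ 1      ≡⟨ ≡.cong (_÷ 1) (≡.trans (≡.cong (ℕ._* (1920 ℕ.* m)) (length-upTo m)) (square m)) ⟩
        (1920 ℕ.* m ℕ.^ 2) ÷ 1                      ≡⟨ ÷1-* 1920 (m ℕ.^ 2) ⟩
        (1920 ÷ 1) ℚ.* ((m ℕ.^ 2) ÷ 1)              ∎
        where
        open ℚP.≤-Reasoning
        m = suc m′
        g : ℕ → ℚ
        g a = let t = Phi (countSym σ) p F m a ℚ.- (1 ÷ m) in t ℚ.* t
        square : ∀ m → m ℕ.* (1920 ℕ.* m) ≡ 1920 ℕ.* (m ℕ.* (m ℕ.* 1))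
        square = ℕR.solve-∀
        term : ∀ a → a ℕ.< m → g a ℚ.* (L ÷ 1) ℚ.≤ (1920 ℕ.* m) ÷ 1
        term a a<m = squaredDifference visits (h ℕ.+ h) m′ L 1920 (scaleBound y B (deviation m′ a a<m))
          where
          visits = count (λ k → countSym σ p F k DM.% m ℕP.≟ a) p
          y = let z = + m ℤ.* + visits ℤ.- + p in ∣ z ∣ ℕ.* ∣ z ∣
          B = p ℕ.* p ℕ.* (m ℕ.* m ℕ.* m)
          scaleBound : ∀ y B → H ℕ.* y ℕ.≤ 60 ℕ.* B → L ℕ.* y ℕ.≤ 1920 ℕ.* B
          scaleBound y B le = ℕP.≤-trans (ℕP.*-monoˡ-≤ y L≤) (ℕP.≤-trans (ℕP.≤-reflexive (ℕP.*-assoc 32 H y))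
            (ℕP.≤-trans (ℕP.*-monoʳ-≤ 32 le) (ℕP.≤-reflexive (≡.sym (ℕP.*-assoc 32 60 B)))))

-- Choice of the constants and of the window length.

open import Defs
open import Data.Nat using (ℕ; _^_)
open import Data.Nat.Primality using (Prime)
open import Data.Nat.Logarithm using (⌊log₂_⌋)
open import Data.Integer using (+_)
open import Data.Rational using (ℚ; 0ℚ; _≤_; _<_; _*_)
open import Data.Product using (∃-syntax; _×_)
import Data.Nat as N
open import Data.Nat as ℕ using (suc; z≤n; s≤s)
open import Data.Nat.Logarithm using (⌊log₂⌋-mono-≤; ⌊log₂[2^n]⌋≡n)
import Data.Nat.DivMod as DM
import Data.Nat.Properties as ℕP
import Data.Nat.Tactic.RingSolver as ℕR
import Data.Rational as ℚ
import Data.Rational.Properties as ℚP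
open import Data.Product using (_,_)
open import Relation.Binary.PropositionalEquality as ≡ using (_≡_)
open SignPatterns using (IsSign; plus; minus)
open Assembly

theorem2 : ∃[ c ] (0ℚ < c ×
    (∀ (d : ℕ) → 1 N.≤ d →
    ∃[ C ] ∃[ P₀ ] (∀ (p : ℕ) → Prime p → P₀ N.≤ p →
    ∀ (F : Poly) → HasDegree p F d → SquareFree p F →
    ∀ (m : ℕ) → 2 N.≤ m →
    (m ^ 4) ÷ 1 ≤ c * (⌊log₂ p ⌋ ÷ 1) →
    (Dev R p F m * (⌊log₂ p ⌋ ÷ 1) ≤ C * ((m ^ 2) ÷ 1))
    × (Dev Nn p F m * (⌊log₂ p ⌋ ÷ 1) ≤ C * ((m ^ 2) ÷ 1)))))
-- The threshold 2^(32 d) makes log₂ p at least 32 d, so that H, a sixteenth of it, is at least 2 d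
-- as `multiple≤2^` requires.
theorem2 = ℚ.1ℚ , ℚP.positive⁻¹ ℚ.1ℚ , λ d 1≤d → 1920 ÷ 1 , 2 ^ (2 ℕ.* d ℕ.* 16) , bounds d 1≤d
  where
  bounds : ∀ d → 1 N.≤ d → ∀ p → Prime p → 2 ^ (2 ℕ.* d ℕ.* 16) N.≤ p → ∀ F → HasDegree p F d → SquareFree p F →
           ∀ m → 2 N.≤ m → (m ^ 4) ÷ 1 ≤ ℚ.1ℚ * (⌊log₂ p ⌋ ÷ 1) →
           (Dev R p F m * (⌊log₂ p ⌋ ÷ 1) ≤ (1920 ÷ 1) * ((m ^ 2) ÷ 1)) ×
           (Dev Nn p F m * (⌊log₂ p ⌋ ÷ 1) ≤ (1920 ÷ 1) * ((m ^ 2) ÷ 1))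
  bounds d 1≤d p isPrime P₀≤p F degF squareFree m 2≤m _ = odd (oddPrime p isPrime 2<p)
    where
    L H : ℕ
    L = ⌊log₂ p ⌋
    H = L DM./ 16
    2≤2d : 2 N.≤ 2 ℕ.* d
    2≤2d = ℕP.*-monoʳ-≤ 2 1≤d
    2<p : 2 ℕ.< p
    2<p = ℕP.<-≤-trans (ℕP.^-monoʳ-< 2 (s≤s (s≤s z≤n)) {1} (ℕP.*-mono-≤ 2≤2d (s≤s (z≤n {15})))) P₀≤p
    2d≤H : 2 ℕ.* d N.≤ H
    2d≤H = ℕP.≤-trans (ℕP.≤-reflexive (≡.sym (DM.m*n/n≡m (2 ℕ.* d) 16)))
      (DM./-monoˡ-≤ 16 (ℕP.≤-trans (ℕP.≤-reflexive (≡.sym (⌊log₂[2^n]⌋≡n (2 ℕ.* d ℕ.* 16)))) (⌊log₂⌋-mono-≤ P₀≤p)))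
    large : (2 ^ H) ^ 16 N.≤ p
    large = ℕP.≤-trans (ℕP.≤-reflexive (ℕP.^-*-assoc 2 H 16))
      (ℕP.≤-trans (ℕP.^-monoʳ-≤ 2 (DM.m/n*n≤m L 16)) (2^⌊log₂⌋≤ p (ℕP.≤-trans (s≤s z≤n) 2<p)))
    -- Rounding down in the definition of H loses at most a factor 2, because H is at least 1.
    L≤32H : L N.≤ 32 ℕ.* H
    L≤32H = begin
      L                            ≡⟨ DM.m≡m%n+[m/n]*n L 16 ⟩
      L DM.% 16 ℕ.+ H ℕ.* 16       ≤⟨ ℕP.+-monoˡ-≤ (H ℕ.* 16) (ℕP.<⇒≤ (DM.m%n<n L 16)) ⟩
      16 ℕ.+ H ℕ.* 16              ≤⟨ ℕP.+-monoˡ-≤ (H ℕ.* 16) (ℕP.*-monoˡ-≤ 16 (ℕP.≤-trans (s≤s z≤n) (ℕP.≤-trans 2≤2d 2d≤H))) ⟩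
      H ℕ.* 16 ℕ.+ H ℕ.* 16        ≡⟨ double H ⟩
      32 ℕ.* H                     ∎
      where
      open ℕP.≤-Reasoning
      double : ∀ H → H ℕ.* 16 ℕ.+ H ℕ.* 16 ≡ 32 ℕ.* H
      double = ℕR.solve-∀
    odd : (∃[ h ] p ≡ suc (h ℕ.+ h)) →
          (Dev R p F m * (L ÷ 1) ≤ (1920 ÷ 1) * ((m ^ 2) ÷ 1)) × (Dev Nn p F m * (L ÷ 1) ≤ (1920 ÷ 1) * ((m ^ 2) ÷ 1))
    odd (h , eq) = split h eq isPrime degF squareFree large
      where
      -- The prime is generalised so that the equation p = 2 h + 1 can be matched, while L and H
      -- remain tied to the original p.
      split : ∀ h {p} → p ≡ suc (h ℕ.+ h) → Prime p → HasDegree p F d → SquareFree p F → (2 ^ H) ^ 16 N.≤ p →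
              (Dev R p F m * (L ÷ 1) ≤ (1920 ÷ 1) * ((m ^ 2) ÷ 1)) × (Dev Nn p F m * (L ÷ 1) ≤ (1920 ÷ 1) * ((m ^ 2) ÷ 1))
      split h ≡.refl isPrime degF squareFree large = bound plus , bound minus
        where
        bound : ∀ {σ} → IsSign σ → Dev (countSym σ) (suc (h ℕ.+ h)) F m * (L ÷ 1) ≤ (1920 ÷ 1) * ((m ^ 2) ÷ 1)
        bound σ-sign = Residues.deviationBound h isPrime F d 1≤d degF squareFree H 2d≤H large σ-sign L L≤32H m
          (ℕP.≤-trans (s≤s z≤n) 2≤m)
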